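{- Let $s\geq 2$ and $t\geq 1$ be integers and let $\Gamma$ be a co-edge-regular graph with spectrum $$\{\big(s(2t+1)-1\big)^{1},\ (st-1)^{2t},\ (-1)^{(s-1)(t+1)^{2}},\ (-s-1)^{t^2}\}$$ (exponents denote multiplicities). If $t\geq 11(s+1)^3(s+2)$, then $\Gamma$ is (isomorphic to) the $s$-clique extension of the $(t+1)\times(t+1)$-grid.
   Context: Graphs are finite and simple; the spectrum of a graph is the multiset of eigenvalues of its adjacency matrix. A graph is co-edge-regular if it is regular and there is a constant $\mu$ such that any two distinct nonadjacent vertices have exactly $\mu$ common neighbours. The $n\times n$-grid is the Cartesian product $K_n\Box K_n$. For a positive integer $s$, the $s$-clique extension of a graph $G$ is the graph obtained from $G$ by replacing each vertex $x$ by a clique $\widetilde X$ on $s$ vertices, where $\tilde x\in\widetilde X$ and $\tilde y\in \widetilde Y$ (for distinct vertices $x,y$) are adjacent if and only if $x\sim y$ in $G$ (and vertices within the same $\widetilde X$ are all adjacent). -}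

module Defs where

open import Data.Nat as ℕ using (ℕ; zero; suc)
open import Data.Integer as ℤ using (ℤ; +_; -_; _-_; _^_)
open import Data.Fin using (Fin; zero; suc; punchIn)
open import Data.Bool using (Bool; true; false; _∧_)
open import Data.Product using (_×_; _,_; Σ; ∃)
open import Data.Sum using (_⊎_)
open import Relation.Binary.PropositionalEquality using (_≡_; _≢_)
open import Function.Bundles using (_↔_; Inverse)

record Graph (n : ℕ) : Set where
  field
    adj    : Fin n → Fin n → Bool
    sym    : ∀ x y → adj x y ≡ adj y x
    irrefl : ∀ x → adj x x ≡ false
open Graph public

sumℕ : ∀ {n} → (Fin n → ℕ) → ℕ
sumℕ {zero}  f = 0
sumℕ {suc n} f = f zero ℕ.+ sumℕ (λ i → f (suc i))

sumℤ : ∀ {n} → (Fin n → ℤ) → ℤ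
sumℤ {zero}  f = + 0
sumℤ {suc n} f = f zero ℤ.+ sumℤ (λ i → f (suc i))

b2ℕ : Bool → ℕ
b2ℕ true  = 1
b2ℕ false = 0

b2ℤ : Bool → ℤ
b2ℤ true  = + 1
b2ℤ false = + 0

degree : ∀ {n} → Graph n → Fin n → ℕ
degree G x = sumℕ (λ z → b2ℕ (adj G x z))

commonNbrs : ∀ {n} → Graph n → Fin n → Fin n → ℕ
commonNbrs G x y = sumℕ (λ z → b2ℕ (adj G x z ∧ adj G y z))

Regular : ∀ {n} → Graph n → Set
Regular {n} G = ∃ λ (k : ℕ) → ∀ (x : Fin n) → degree G x ≡ k

CoEdgeRegular : ∀ {n} → Graph n → Set
CoEdgeRegular {n} G =
  Regular G ×
  ∃ λ (μ : ℕ) → ∀ (x y : Fin n) → x ≢ y → adj G x y ≡ false → commonNbrs G x y ≡ μ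

Matrix : ℕ → Set
Matrix n = Fin n → Fin n → ℤ

sign : ∀ {n} → Fin n → ℤ
sign zero    = + 1
sign (suc j) = - sign j

det : ∀ {n} → Matrix n → ℤ
det {zero}  M = + 1
det {suc n} M =
  sumℤ (λ j → sign j ℤ.* (M zero j ℤ.* det (λ i k → M (suc i) (punchIn j k))))

adjMatrix : ∀ {n} → Graph n → Matrix n
adjMatrix G i j = b2ℤ (adj G i j)

δ : ∀ {n} → Fin n → Fin n → ℤ
δ zero    zero    = + 1
δ zero    (suc _) = + 0
δ (suc _) zero    = + 0
δ (suc i) (suc j) = δ i j

charPoly : ∀ {n} → Matrix n → ℤ → ℤ
charPoly A x = det (λ i j → x ℤ.* δ i j - A i j)

-- Spectrum as a list of (eigenvalue, multiplicity) pairs: the characteristic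
-- polynomial equals ∏ (x - θ)^m (equality of integer polynomials, checked as
-- equality of the polynomial functions on ℤ, which is equivalent).
open import Data.List using (List; []; _∷_; foldr)

prodSpec : List (ℤ × ℕ) → ℤ → ℤ
prodSpec spec x = foldr (λ { (θ , m) acc → ((x - θ) ^ m) ℤ.* acc }) (+ 1) spec

HasSpectrum : ∀ {n} → Graph n → List (ℤ × ℕ) → Set
HasSpectrum G spec = ∀ (x : ℤ) → charPoly (adjMatrix G) x ≡ prodSpec spec x

GridAdj : (m : ℕ) → (Fin m × Fin m) → (Fin m × Fin m) → Set
GridAdj m (i , j) (i' , j') = (i ≡ i' × j ≢ j') ⊎ (i ≢ i' × j ≡ j')

CliqueExtAdj : {W : Set} → (W → W → Set) → (s : ℕ) → (W × Fin s) → (W × Fin s) → Set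
CliqueExtAdj R s (x , a) (y , b) = ((x , a) ≢ (y , b)) × ((x ≡ y) ⊎ R x y)

IsomorphicTo : ∀ {n} → Graph n → (V : Set) → (V → V → Set) → Set
IsomorphicTo {n} G V R =
  Σ (Fin n ↔ V) λ f →
    ∀ (x y : Fin n) → (adj G x y ≡ true → R (Inverse.to f x) (Inverse.to f y))
                    × (R (Inverse.to f x) (Inverse.to f y) → adj G x y ≡ true)

CliqueExtGridIso : ∀ {n} → Graph n → (s m : ℕ) → Set
CliqueExtGridIso G s m = IsomorphicTo G ((Fin m × Fin m) × Fin s) (CliqueExtAdj (GridAdj m) s)

theSpectrum : ℕ → ℕ → List (ℤ × ℕ)
theSpectrum s t =
    (+ (s ℕ.* (2 ℕ.* t ℕ.+ 1)) - + 1 , 1)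
  ∷ (+ (s ℕ.* t) - + 1 , 2 ℕ.* t)
  ∷ (- + 1 , (s ℕ.∸ 1) ℕ.* ((t ℕ.+ 1) ℕ.^ 2))
  ∷ (- + s - + 1 , t ℕ.^ 2)
  ∷ []

{-# OPTIONS --safe #-}
-- Put B = I + A and N[x] = {z : B x z = 1}.  The characteristic polynomial determines the traces of all
-- powers of B, and with regularity these give Σ (Z i j)² = 0 for the symmetric integer matrix
-- Z = B³ - s(t-1)B² - s²tB - 2s²(2t+1)J, so that Z = 0.  It follows that nonadjacent vertices have 2s common
-- neighbours and that F = B² - s(t-1)B - 2sJ satisfies BF = s²tB and Σ_z (F x z)² = s³t²; here F x z is
-- |N[x] ∩ N[z]| - s(t+1) for z in N[x], and 0 otherwise.
--
-- Fix x.  By the sum of squares, F x z > -st/4 for all but 16s vertices z of N[x].  No three of these are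
-- pairwise nonadjacent, since their neighbourhoods inside N[x] would be almost disjoint and too large.  So
-- N[x] is covered by two cliques L, M and a small remainder R.  On L ∩ M and on R the value of F x z is
-- close to st and to -st, hence |L ∩ M| + |R| ≤ s.  The rows of BF = s²tB then exclude vertices in R and
-- give |L ∩ M| = s, |L| = |M| = s(t+1), and F x z = 0 outside L ∩ M.  So L ∩ M consists of the s twins of x,
-- and every vertex lies on exactly two such lines.  Projecting onto the two lines through one fixed vertex
-- yields coordinates that identify the quotient by twins with the grid.
module Submission where

open import Defs

-- Everything takes place over the integers: no eigenvector, projection or real number is ever
-- formed. A polynomial is available only through its values, so degrees are replaced by orders of
-- growth, and traces are extracted from the characteristic polynomial by a recurrence whose error
-- terms are of too low an order. The spectral theorem is replaced by positivity of the trace form,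
-- applied to a matrix that is orthogonal to all of its own constituents.
--
-- The sum of squares s³t² = s(st)² is a budget that the desired configuration spends entirely on
-- the s twins of x, each with the value st. This is why rough estimates can end in exact
-- statements: the values on L ∩ M and R nearly exhaust the budget, and once |L ∩ M| = s is known
-- nothing is left for any other vertex. The budget alone cannot exclude R, because a vertex there
-- costs about as much as a twin; the sign of its value is what the rows of BF = s²tB detect. All
-- inequalities are linear combinations of earlier ones with explicit coefficients, checked by the
-- ring solver.

module Proof where

  open import Data.Nat as ℕ using (ℕ; zero; suc)
  import Data.Nat.Properties as ℕ
  import Data.Nat.Tactic.RingSolver as ℕSolver
  open import Data.Integer as ℤ using (ℤ; +_; -_; _-_; _+_; _*_; _^_; _≤_; ∣_∣)
  import Data.Integer.Properties as ℤ
  open import Data.Integer.Tactic.RingSolver using (solve-∀)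
  open import Data.Fin as Fin using (Fin; zero; suc; punchIn)
  import Data.Fin.Properties as Fin
  open import Data.Bool using (Bool; true; false; _∧_; _∨_; not)
  import Data.Bool.Properties as Bool
  open import Data.Product using (_×_; _,_; ∃; proj₁; proj₂)
  open import Data.Sum as Sum using (_⊎_; inj₁; inj₂; [_,_]′)
  open import Data.List using (List; []; _∷_; length; _++_; replicate)
  import Data.List.Properties as List
  open import Data.Empty using (⊥; ⊥-elim)
  open import Function using (_∘_)
  open import Function.Bundles using (_↔_; mk↔ₛ′)
  open import Function.Definitions using (Injective)
  open import Relation.Binary.Definitions using (tri<; tri≈; tri>)
  open import Relation.Binary.PropositionalEquality renaming (sym to ≡-sym)
  open import Relation.Nullary using (¬_; Dec; yes; no; does; contradiction)
  open import Relation.Nullary.Decidable using (⌊_⌋; True; toWitness; _×-dec_; _→-dec_)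
  open ≡-Reasoning

  -- Finite sums

  sum-cong : ∀ {n} {f g : Fin n → ℤ} → (∀ i → f i ≡ g i) → sumℤ f ≡ sumℤ g
  sum-cong {zero}  e = refl
  sum-cong {suc n} e = cong₂ _+_ (e zero) (sum-cong (e ∘ suc))

  sum-zero : ∀ {n} {f : Fin n → ℤ} → (∀ i → f i ≡ + 0) → sumℤ f ≡ + 0
  sum-zero {zero}  e = refl
  sum-zero {suc n} e = cong₂ _+_ (e zero) (sum-zero (e ∘ suc))

  sum-+ : ∀ {n} (f g : Fin n → ℤ) → sumℤ (λ i → f i + g i) ≡ sumℤ f + sumℤ g
  sum-+ {zero}  f g = refl
  sum-+ {suc n} f g = trans (cong (λ z → (f zero + g zero) + z) (sum-+ (f ∘ suc) (g ∘ suc)))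
    (interchange (f zero) (g zero) (sumℤ (f ∘ suc)) (sumℤ (g ∘ suc)))
    where
    interchange : ∀ a b c d → (a + b) + (c + d) ≡ (a + c) + (b + d)
    interchange = solve-∀

  sum-*ˡ : ∀ {n} c (f : Fin n → ℤ) → sumℤ (λ i → c * f i) ≡ c * sumℤ f
  sum-*ˡ {zero}  c f = ≡-sym (ℤ.*-zeroʳ c)
  sum-*ˡ {suc n} c f = trans (cong (λ z → c * f zero + z) (sum-*ˡ c (f ∘ suc)))
    (≡-sym (ℤ.*-distribˡ-+ c (f zero) (sumℤ (f ∘ suc))))

  sum-*ʳ : ∀ {n} c (f : Fin n → ℤ) → sumℤ (λ i → f i * c) ≡ sumℤ f * c
  sum-*ʳ c f = trans (sum-cong (λ i → ℤ.*-comm (f i) c)) (trans (sum-*ˡ c f) (ℤ.*-comm c _))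

  sum-swap : ∀ {m n} (f : Fin m → Fin n → ℤ) →
    sumℤ (λ i → sumℤ (f i)) ≡ sumℤ (λ j → sumℤ (λ i → f i j))
  sum-swap {zero} {n} f = ≡-sym (sum-zero {n} (λ _ → refl))
  sum-swap {suc m} f = trans (cong (λ z → sumℤ (f zero) + z) (sum-swap (f ∘ suc)))
    (≡-sym (sum-+ (f zero) (λ j → sumℤ (λ i → f (suc i) j))))

  sum-δ : ∀ {n} (i : Fin n) (f : Fin n → ℤ) → sumℤ (λ j → δ i j * f j) ≡ f i
  sum-δ zero    f = trans (cong (λ z → + 1 * f zero + z) (sum-zero (λ j → ℤ.*-zeroˡ (f (suc j)))))
    (trans (ℤ.+-identityʳ _) (ℤ.*-identityˡ _))
  sum-δ (suc i) f = trans (cong (λ z → + 0 * f zero + z) (sum-δ i (f ∘ suc)))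
    (trans (cong (_+ f (suc i)) (ℤ.*-zeroˡ (f zero))) (ℤ.+-identityˡ _))

  sum-const : ∀ n c → sumℤ {n} (λ _ → c) ≡ + n * c
  sum-const zero    c = ≡-sym (ℤ.*-zeroˡ c)
  sum-const (suc n) c = trans (cong (λ z → c + z) (sum-const n c)) (≡-sym (ℤ.suc-* (+ n) c))

  -- Determinants

  minor : ∀ {n} → Matrix (suc n) → Fin (suc n) → Matrix n
  minor M j i k = M (suc i) (punchIn j k)

  det-cong : ∀ {n} {M N : Matrix n} → (∀ i j → M i j ≡ N i j) → det M ≡ det N
  det-cong {zero}  e = refl
  det-cong {suc n} {M} {N} e = sum-cong λ j →
    cong (sign j *_) (cong₂ _*_ (e zero j) (det-cong (λ i k → e (suc i) (punchIn j k))))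

  -- The recursion on the row index drops leading rows and keeps all columns, so the array is
  -- rectangular. Replacing a row below the first thus passes to the minors along the top row, as
  -- inductions on `det` require.
  setRow : ∀ {m n} → (Fin m → Fin n → ℤ) → Fin m → (Fin n → ℤ) → Fin m → Fin n → ℤ
  setRow M zero    r zero    = r
  setRow M zero    r (suc i) = M (suc i)
  setRow M (suc a) r zero    = M zero
  setRow M (suc a) r (suc i) = setRow (M ∘ suc) a r i

  setRow-∘ : ∀ {l m n} (M : Fin m → Fin n → ℤ) a r (g : Fin l → Fin n) i k →
    setRow M a r i (g k) ≡ setRow (λ i k → M i (g k)) a (r ∘ g) i k
  setRow-∘ M zero    r g zero    k = refl
  setRow-∘ M zero    r g (suc i) k = refl
  setRow-∘ M (suc a) r g zero    k = refl
  setRow-∘ M (suc a) r g (suc i) k = setRow-∘ (M ∘ suc) a r g i k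

  setRow-at : ∀ {m n} (M : Fin m → Fin n → ℤ) a r k → setRow M a r a k ≡ r k
  setRow-at M zero    r k = refl
  setRow-at M (suc a) r k = setRow-at (M ∘ suc) a r k

  setRow-other : ∀ {m n} (M : Fin m → Fin n → ℤ) a r i k → a ≢ i → setRow M a r i k ≡ M i k
  setRow-other M zero    r zero    k ne = contradiction refl ne
  setRow-other M zero    r (suc i) k ne = refl
  setRow-other M (suc a) r zero    k ne = refl
  setRow-other M (suc a) r (suc i) k ne = setRow-other (M ∘ suc) a r i k (ne ∘ cong suc)

  setRow-self : ∀ {m n} (M : Fin m → Fin n → ℤ) a i k → setRow M a (M a) i k ≡ M i k
  setRow-self M zero    zero    k = refl
  setRow-self M zero    (suc i) k = refl
  setRow-self M (suc a) zero    k = refl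
  setRow-self M (suc a) (suc i) k = setRow-self (M ∘ suc) a i k

  setRow-cong : ∀ {m n} (M : Fin m → Fin n → ℤ) a {r r′ : Fin n → ℤ} → (∀ k → r k ≡ r′ k) →
    ∀ i k → setRow M a r i k ≡ setRow M a r′ i k
  setRow-cong M zero    e zero    k = e k
  setRow-cong M zero    e (suc i) k = refl
  setRow-cong M (suc a) e zero    k = refl
  setRow-cong M (suc a) e (suc i) k = setRow-cong (M ∘ suc) a e i k

  det-setRow-suc : ∀ {n} (M : Matrix (suc n)) a r → det (setRow M (suc a) r) ≡
    sumℤ (λ j → sign j * (M zero j * det (setRow (minor M j) a (r ∘ punchIn j))))
  det-setRow-suc M a r = sum-cong λ j → cong (λ d → sign j * (M zero j * d))
    (det-cong (setRow-∘ (M ∘ suc) a r (punchIn j)))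

  -- Any number of summands is allowed because a row of a product `X ⊡ M` is a combination of all
  -- the rows of `M`; `detDeriv-⊡` uses it in this form.
  det-linear : ∀ {m n} (M : Matrix n) a (c : Fin m → ℤ) (v : Fin m → Fin n → ℤ) →
    det (setRow M a (λ k → sumℤ (λ b → c b * v b k))) ≡ sumℤ (λ b → c b * det (setRow M a (v b)))
  det-linear {n = suc n} M zero c v = begin
    sumℤ (λ j → sign j * (sumℤ (λ b → c b * v b j) * d j))
      ≡⟨ sum-cong (λ j → trans (cong (sign j *_) (≡-sym (sum-*ʳ (d j) (λ b → c b * v b j))))
           (≡-sym (sum-*ˡ (sign j) (λ b → c b * v b j * d j)))) ⟩
    sumℤ (λ j → sumℤ (λ b → sign j * (c b * v b j * d j)))
      ≡⟨ sum-swap (λ j b → sign j * (c b * v b j * d j)) ⟩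
    sumℤ (λ b → sumℤ (λ j → sign j * (c b * v b j * d j)))
      ≡⟨ sum-cong (λ b → trans (sum-cong (λ j → rearr (sign j) (c b) (v b j) (d j)))
           (sum-*ˡ (c b) (λ j → sign j * (v b j * d j)))) ⟩
    sumℤ (λ b → c b * sumℤ (λ j → sign j * (v b j * d j))) ∎
    where
    d : Fin (suc n) → ℤ
    d j = det (minor M j)
    rearr : ∀ a b c d → a * (b * c * d) ≡ b * (a * (c * d))
    rearr = solve-∀
  det-linear {n = suc n} M (suc a) c v = begin
    det (setRow M (suc a) (λ k → sumℤ (λ b → c b * v b k)))
      ≡⟨ det-setRow-suc M a _ ⟩
    sumℤ (λ j → sign j * (M zero j * det (setRow (minor M j) a (λ k → sumℤ (λ b → c b * v b (punchIn j k))))))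
      ≡⟨ sum-cong (λ j → cong (λ z → sign j * (M zero j * z)) (det-linear (minor M j) a c (λ b → v b ∘ punchIn j))) ⟩
    sumℤ (λ j → sign j * (M zero j * sumℤ (λ b → c b * d b j)))
      ≡⟨ sum-cong (λ j → trans (cong (sign j *_) (≡-sym (sum-*ˡ (M zero j) (λ b → c b * d b j))))
           (≡-sym (sum-*ˡ (sign j) (λ b → M zero j * (c b * d b j))))) ⟩
    sumℤ (λ j → sumℤ (λ b → sign j * (M zero j * (c b * d b j))))
      ≡⟨ sum-swap (λ j b → sign j * (M zero j * (c b * d b j))) ⟩
    sumℤ (λ b → sumℤ (λ j → sign j * (M zero j * (c b * d b j))))
      ≡⟨ sum-cong (λ b → trans (sum-cong (λ j → rearr (sign j) (M zero j) (c b) (d b j)))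
           (sum-*ˡ (c b) (λ j → sign j * (M zero j * d b j)))) ⟩
    sumℤ (λ b → c b * sumℤ (λ j → sign j * (M zero j * d b j)))
      ≡⟨ sum-cong (λ b → cong (c b *_) (≡-sym (det-setRow-suc M a (v b)))) ⟩
    sumℤ (λ b → c b * det (setRow M (suc a) (v b))) ∎
    where
    d : _ → Fin (suc n) → ℤ
    d b j = det (setRow (minor M j) a (v b ∘ punchIn j))
    rearr : ∀ a b c d → a * (b * (c * d)) ≡ c * (a * (b * d))
    rearr = solve-∀

  det-add : ∀ {n} (M : Matrix n) a (u v : Fin n → ℤ) →
    det (setRow M a (λ k → u k + v k)) ≡ det (setRow M a u) + det (setRow M a v)
  det-add M a u v = begin
    det (setRow M a (λ k → u k + v k))
      ≡⟨ det-cong (setRow-cong M a (λ k → pad (u k) (v k))) ⟩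
    det (setRow M a (λ k → sumℤ (λ b → + 1 * w b k)))
      ≡⟨ det-linear M a (λ _ → + 1) w ⟩
    + 1 * det (setRow M a u) + (+ 1 * det (setRow M a v) + + 0)
      ≡⟨ ≡-sym (pad (det (setRow M a u)) (det (setRow M a v))) ⟩
    det (setRow M a u) + det (setRow M a v) ∎
    where
    w : Fin 2 → Fin _ → ℤ
    w zero       = u
    w (suc zero) = v
    pad : ∀ a b → a + b ≡ + 1 * a + (+ 1 * b + + 0)
    pad = solve-∀

  -- The pairs (j , k) and (j′ , k′) below delete the same two columns in opposite orders.

  punchIn-comm : ∀ {n} (j j′ : Fin (suc (suc n))) (k k′ : Fin (suc n)) →
    punchIn j k ≡ j′ → punchIn j′ k′ ≡ j → ∀ i → punchIn j (punchIn k i) ≡ punchIn j′ (punchIn k′ i)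
  punchIn-comm zero    _ k zero refl _  i = refl
  punchIn-comm zero    _ k (suc k′) refl () i
  punchIn-comm (suc j) _ zero k′ refl e i with Fin.suc-injective e
  ... | refl = refl
  punchIn-comm (suc j) _ (suc k) zero refl () i
  punchIn-comm (suc j) _ (suc k) (suc k′) refl e zero = refl
  punchIn-comm {suc n} (suc j) _ (suc k) (suc k′) refl e (suc i) =
    cong suc (punchIn-comm j _ k k′ refl (Fin.suc-injective e) i)

  -- The terms that delete column 0 first cancel those that delete it second. The remaining terms
  -- form a sum of the same kind with one column fewer: of the two sign changes, one is pulled out
  -- in front and the other is absorbed into `H`.
  sum-alternating : ∀ {n} (H : Fin (suc n) → Fin n → ℤ) →
    (∀ j k j′ k′ → punchIn j k ≡ j′ → punchIn j′ k′ ≡ j → H j k ≡ H j′ k′) →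
    sumℤ (λ j → sign j * sumℤ (λ k → sign k * H j k)) ≡ + 0
  sum-alternating {zero}  H h = refl
  sum-alternating {suc n} H h = begin
    + 1 * sumℤ (λ k → sign k * H zero k) + sumℤ (λ j → - sign j * (+ 1 * H (suc j) zero + R j))
      ≡⟨ cong₂ _+_ (ℤ.*-identityˡ (sumℤ (λ k → sign k * H zero k)))
           (trans (sum-cong (λ j → expand (sign j) (H (suc j) zero) (R j))) (sum-+ (λ j → - (+ 1) * (sign j * H (suc j) zero)) (λ j → - (+ 1) * (sign j * R j)))) ⟩
    P + (sumℤ (λ j → - (+ 1) * (sign j * H (suc j) zero)) + sumℤ (λ j → - (+ 1) * (sign j * R j)))
      ≡⟨ cong₂ (λ a b → P + (a + b)) (sum-*ˡ (- (+ 1)) (λ j → sign j * H (suc j) zero))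
           (sum-*ˡ (- (+ 1)) (λ j → sign j * R j)) ⟩
    P + (- (+ 1) * sumℤ (λ j → sign j * H (suc j) zero) + - (+ 1) * sumℤ (λ j → sign j * R j))
      ≡⟨ cong₂ (λ a b → P + (- (+ 1) * a + - (+ 1) * b))
           (sum-cong (λ j → cong (sign j *_) (h (suc j) zero zero j refl refl))) rest ⟩
    P + (- (+ 1) * P + - (+ 1) * + 0)
      ≡⟨ cancel P ⟩
    + 0 ∎
    where
    P = sumℤ (λ k → sign k * H zero k)
    R : Fin (suc n) → ℤ
    R j = sumℤ (λ k → - sign k * H (suc j) (suc k))
    expand : ∀ a b c → - a * (+ 1 * b + c) ≡ - (+ 1) * (a * b) + - (+ 1) * (a * c)
    expand = solve-∀
    cancel : ∀ p → p + (- (+ 1) * p + - (+ 1) * + 0) ≡ + 0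
    cancel = solve-∀
    neg : ∀ a b → - a * b ≡ a * (- (+ 1) * b)
    neg = solve-∀
    rest : sumℤ (λ j → sign j * R j) ≡ + 0
    rest = trans
      (sum-cong (λ j → cong (sign j *_) (sum-cong (λ k → neg (sign k) (H (suc j) (suc k))))))
      (sum-alternating (λ j k → - (+ 1) * H (suc j) (suc k))
        (λ j k j′ k′ e e′ → cong (- (+ 1) *_) (h (suc j) (suc k) (suc j′) (suc k′) (cong suc e) (cong suc e′))))

  -- Expanding along two equal rows gives a sum over ordered pairs of deleted columns in which
  -- exchanging the pair changes neither the entries nor the minor, only the sign.
  det-rows01 : ∀ {n} (M : Matrix (suc (suc n))) → (∀ k → M zero k ≡ M (suc zero) k) → det M ≡ + 0
  det-rows01 {n} M e = begin
    sumℤ (λ j → sign j * (M zero j * sumℤ (λ k → sign k * (M (suc zero) (punchIn j k) * d j k))))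
      ≡⟨ sum-cong (λ j → cong (sign j *_) (trans (≡-sym (sum-*ˡ (M zero j) (λ k → sign k * (M (suc zero) (punchIn j k) * d j k))))
           (sum-cong (λ k → trans (rearr (M zero j) (sign k) (M (suc zero) (punchIn j k)) (d j k))
             (cong (λ z → sign k * (M zero j * z * d j k)) (≡-sym (e (punchIn j k)))))))) ⟩
    sumℤ (λ j → sign j * sumℤ (λ k → sign k * H j k))
      ≡⟨ sum-alternating H H-sym ⟩
    + 0 ∎
    where
    d : Fin (suc (suc n)) → Fin (suc n) → ℤ
    d j k = det (λ i l → M (suc (suc i)) (punchIn j (punchIn k l)))
    H : Fin (suc (suc n)) → Fin (suc n) → ℤ
    H j k = M zero j * M zero (punchIn j k) * d j k
    rearr : ∀ a b c d → a * (b * (c * d)) ≡ b * (a * c * d)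
    rearr = solve-∀
    H-sym : ∀ j k j′ k′ → punchIn j k ≡ j′ → punchIn j′ k′ ≡ j → H j k ≡ H j′ k′
    H-sym j k j′ k′ p q = cong₂ _*_
      (trans (cong (λ z → M zero j * M zero z) p)
        (trans (ℤ.*-comm (M zero j) (M zero j′)) (cong (λ z → M zero j′ * M zero z) (≡-sym q))))
      (det-cong (λ i l → cong (M (suc (suc i))) (punchIn-comm j j′ k k′ p q l)))

  det-alternating-suc : ∀ {n} →
    (∀ (M : Matrix n) i j → i ≢ j → (∀ k → M i k ≡ M j k) → det M ≡ + 0) →
    ∀ (M : Matrix (suc n)) i j → i ≢ j → (∀ k → M (suc i) k ≡ M (suc j) k) → det M ≡ + 0
  det-alternating-suc alt M i j ne e = sum-zero λ l → begin
    sign l * (M zero l * det (minor M l))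
      ≡⟨ cong (λ z → sign l * (M zero l * z)) (alt (minor M l) i j ne (λ k → e (punchIn l k))) ⟩
    sign l * (M zero l * + 0)
      ≡⟨ cong (sign l *_) (ℤ.*-zeroʳ (M zero l)) ⟩
    sign l * + 0
      ≡⟨ ℤ.*-zeroʳ (sign l) ⟩
    + 0 ∎

  -- Rows 1 and j+2 may be exchanged up to sign, because the determinant vanishes when both are
  -- replaced by their sum; this moves the repeated row 0 into position 1.
  det-alternating-zero : ∀ {n} →
    (∀ (M : Matrix (suc n)) i j → i ≢ j → (∀ k → M (suc i) k ≡ M (suc j) k) → det M ≡ + 0) →
    ∀ (M : Matrix (suc n)) j → (∀ k → M zero k ≡ M (suc j) k) → det M ≡ + 0
  det-alternating-zero {suc n} alt M zero    e = det-rows01 M e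
  det-alternating-zero {suc (suc n)} alt M (suc j) e = begin
    det M                                   ≡⟨ det-cong restore ⟩
    det (T u v)                             ≡⟨ ≡-sym (ℤ.+-identityʳ _) ⟩
    det (T u v) + + 0                       ≡⟨ cong (λ z → det (T u v) + z) (≡-sym vu) ⟩
    det (T u v) + det (T v u)               ≡⟨ pad (det (T u v)) (det (T v u)) ⟩
    (+ 0 + det (T u v)) + (det (T v u) + + 0)
      ≡⟨ cong₂ (λ a b → (a + det (T u v)) + (det (T v u) + b)) (≡-sym (equal u)) (≡-sym (equal v)) ⟩
    (det (T u u) + det (T u v)) + (det (T v u) + det (T v v))
      ≡⟨ cong₂ _+_ (≡-sym (det-add (setRow M one u) q u v)) (≡-sym (det-add (setRow M one v) q u v)) ⟩
    det (T u w) + det (T v w)               ≡⟨ cong₂ _+_ (det-cong (comm u)) (det-cong (comm v)) ⟩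
    det (setRow (setRow M q w) one u) + det (setRow (setRow M q w) one v)
      ≡⟨ ≡-sym (det-add (setRow M q w) one u v) ⟩
    det (setRow (setRow M q w) one w)       ≡⟨ ≡-sym (det-cong (comm w)) ⟩
    det (T w w)                             ≡⟨ equal w ⟩
    + 0 ∎
    where
    one q : Fin (suc (suc (suc n)))
    one = suc zero
    q   = suc (suc j)
    u v w : Fin (suc (suc (suc n))) → ℤ
    u = M one
    v = M q
    w k = u k + v k
    T : (a b : Fin (suc (suc (suc n))) → ℤ) → Matrix (suc (suc (suc n)))
    T a b = setRow (setRow M one a) q b
    equal : ∀ a → det (T a a) ≡ + 0
    equal a = alt (T a a) zero (suc j) (λ ()) (λ k →
      ≡-sym (setRow-at (setRow M one a) q a k))
    vu : det (T v u) ≡ + 0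
    vu = det-rows01 (T v u) e
    comm : ∀ a i k → T a w i k ≡ setRow (setRow M q w) one a i k
    comm a zero          k = refl
    comm a (suc zero)    k = refl
    comm a (suc (suc i)) k = refl
    restore : ∀ i k → M i k ≡ T u v i k
    restore zero          k = refl
    restore (suc zero)    k = refl
    restore (suc (suc i)) k = ≡-sym (setRow-self (λ i → M (suc (suc i))) j i k)
    pad : ∀ a b → a + b ≡ (+ 0 + a) + (b + + 0)
    pad = solve-∀

  det-alternating : ∀ {n} (M : Matrix n) i j → i ≢ j → (∀ k → M i k ≡ M j k) → det M ≡ + 0
  det-alternating {suc n} M zero    zero    ne e = contradiction refl ne
  det-alternating {suc n} M zero    (suc j) ne e =
    det-alternating-zero (det-alternating-suc det-alternating) M j e
  det-alternating {suc n} M (suc i) zero    ne e =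
    det-alternating-zero (det-alternating-suc det-alternating) M i (≡-sym ∘ e)
  det-alternating {suc n} M (suc i) (suc j) ne e =
    det-alternating-suc det-alternating M i j (ne ∘ cong suc) e

  δ-diag : ∀ {n} (i : Fin n) → δ i i ≡ + 1
  δ-diag zero    = refl
  δ-diag (suc i) = δ-diag i

  δ-off : ∀ {n} (i j : Fin n) → i ≢ j → δ i j ≡ + 0
  δ-off zero    zero    ne = contradiction refl ne
  δ-off zero    (suc j) ne = refl
  δ-off (suc i) zero    ne = refl
  δ-off (suc i) (suc j) ne = δ-off i j (ne ∘ cong suc)

  δ-sym : ∀ {n} (i j : Fin n) → δ i j ≡ δ j i
  δ-sym zero    zero    = refl
  δ-sym zero    (suc j) = refl
  δ-sym (suc i) zero    = refl
  δ-sym (suc i) (suc j) = δ-sym i j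

  -- Jacobi's formula and the first-order expansion of the determinant

  trace : ∀ {n} → Matrix n → ℤ
  trace X = sumℤ (λ i → X i i)

  infixl 7 _⊡_
  _⊡_ : ∀ {n} → Matrix n → Matrix n → Matrix n
  (X ⊡ Y) i k = sumℤ (λ j → X i j * Y j k)

  -- The directional derivative of `det` at `M` along `N`, by the product rule over the rows.
  detDeriv : ∀ {n} → Matrix n → Matrix n → ℤ
  detDeriv M N = sumℤ (λ a → det (setRow M a (N a)))

  det-setRow-row : ∀ {n} (M : Matrix n) a b → det (setRow M a (M b)) ≡ δ a b * det M
  det-setRow-row M a b with a Fin.≟ b
  ... | yes refl = trans (det-cong (setRow-self M a))
    (≡-sym (trans (cong (_* det M) (δ-diag a)) (ℤ.*-identityˡ (det M))))
  ... | no a≢b = trans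
    (det-alternating (setRow M a (M b)) a b a≢b (λ k →
      trans (setRow-at M a (M b) k) (≡-sym (setRow-other M a (M b) b k a≢b))))
    (≡-sym (trans (cong (_* det M) (δ-off a b a≢b)) (ℤ.*-zeroˡ (det M))))

  -- Jacobi's formula without the adjugate: putting row `b` of `M` in place of row `a` repeats a row
  -- unless `a` and `b` agree, so only the diagonal of `X` survives.
  detDeriv-⊡ : ∀ {n} (M X : Matrix n) → detDeriv M (X ⊡ M) ≡ det M * trace X
  detDeriv-⊡ M X = begin
    sumℤ (λ a → det (setRow M a (λ k → sumℤ (λ b → X a b * M b k))))
      ≡⟨ sum-cong (λ a → det-linear M a (X a) M) ⟩
    sumℤ (λ a → sumℤ (λ b → X a b * det (setRow M a (M b))))
      ≡⟨ sum-cong (λ a → sum-cong (λ b →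
           trans (cong (X a b *_) (det-setRow-row M a b)) (rearr (X a b) (δ a b) (det M)))) ⟩
    sumℤ (λ a → sumℤ (λ b → δ a b * (det M * X a b)))
      ≡⟨ sum-cong (λ a → sum-δ a (λ b → det M * X a b)) ⟩
    sumℤ (λ a → det M * X a a)
      ≡⟨ sum-*ˡ (det M) (λ a → X a a) ⟩
    det M * trace X ∎
    where
    rearr : ∀ a b c → a * (b * c) ≡ b * (c * a)
    rearr = solve-∀

  detDeriv-cong : ∀ {n} (M : Matrix n) {N N′ : Matrix n} → (∀ i j → N i j ≡ N′ i j) →
    detDeriv M N ≡ detDeriv M N′
  detDeriv-cong M e = sum-cong λ a → det-cong (setRow-cong M a (e a))

  detDeriv-linear : ∀ {n} (M P Q : Matrix n) x →
    detDeriv M (λ i k → x * P i k - Q i k) ≡ x * detDeriv M P - detDeriv M Q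
  detDeriv-linear {n} M P Q x = begin
    sumℤ (λ a → det (setRow M a (λ k → x * P a k - Q a k)))
      ≡⟨ sum-cong (λ a → trans (det-cong (setRow-cong M a (λ k → pad x (P a k) (Q a k))))
           (det-linear M a c (v a))) ⟩
    sumℤ (λ a → x * det (setRow M a (P a)) + (- (+ 1) * det (setRow M a (Q a)) + + 0))
      ≡⟨ sum-cong (λ a → drop (x * det (setRow M a (P a))) (det (setRow M a (Q a)))) ⟩
    sumℤ (λ a → x * det (setRow M a (P a)) + - (+ 1) * det (setRow M a (Q a)))
      ≡⟨ sum-+ (λ a → x * det (setRow M a (P a))) (λ a → - (+ 1) * det (setRow M a (Q a))) ⟩
    sumℤ (λ a → x * det (setRow M a (P a))) + sumℤ (λ a → - (+ 1) * det (setRow M a (Q a)))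
      ≡⟨ cong₂ _+_ (sum-*ˡ x (λ a → det (setRow M a (P a)))) (sum-*ˡ (- (+ 1)) (λ a → det (setRow M a (Q a)))) ⟩
    x * detDeriv M P + - (+ 1) * detDeriv M Q
      ≡⟨ minus (x * detDeriv M P) (detDeriv M Q) ⟩
    x * detDeriv M P - detDeriv M Q ∎
    where
    c : Fin 2 → ℤ
    c zero       = x
    c (suc zero) = - (+ 1)
    v : Fin n → Fin 2 → Fin n → ℤ
    v a zero       = P a
    v a (suc zero) = Q a
    pad : ∀ x p q → x * p - q ≡ x * p + (- (+ 1) * q + + 0)
    pad = solve-∀
    drop : ∀ p q → p + (- (+ 1) * q + + 0) ≡ p + - (+ 1) * q
    drop = solve-∀
    minus : ∀ p q → p + - (+ 1) * q ≡ p - q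
    minus = solve-∀

  detDeriv-expand : ∀ {n} (M N : Matrix (suc n)) → detDeriv M N ≡
    sumℤ (λ j → sign j * (N zero j * det (minor M j) + M zero j * detDeriv (minor M j) (minor N j)))
  detDeriv-expand {n} M N = begin
    A + sumℤ (λ a → det (setRow M (suc a) (N (suc a))))
      ≡⟨ cong (λ z → A + z) (sum-cong (λ a → det-setRow-suc M a (N (suc a)))) ⟩
    A + sumℤ (λ a → sumℤ (λ j → sign j * (M zero j * d a j)))
      ≡⟨ cong (λ z → A + z) (sum-swap (λ a j → sign j * (M zero j * d a j))) ⟩
    A + sumℤ (λ j → sumℤ (λ a → sign j * (M zero j * d a j)))
      ≡⟨ cong (λ z → A + z) (sum-cong (λ j → trans (sum-*ˡ (sign j) (λ a → M zero j * d a j))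
           (cong (sign j *_) (sum-*ˡ (M zero j) (λ a → d a j))))) ⟩
    A + sumℤ (λ j → sign j * (M zero j * detDeriv (minor M j) (minor N j)))
      ≡⟨ ≡-sym (sum-+ (λ j → sign j * (N zero j * det (minor M j)))
           (λ j → sign j * (M zero j * detDeriv (minor M j) (minor N j)))) ⟩
    sumℤ (λ j → sign j * (N zero j * det (minor M j)) + sign j * (M zero j * detDeriv (minor M j) (minor N j)))
      ≡⟨ sum-cong (λ j → ≡-sym (ℤ.*-distribˡ-+ (sign j) (N zero j * det (minor M j))
           (M zero j * detDeriv (minor M j) (minor N j)))) ⟩
    sumℤ (λ j → sign j * (N zero j * det (minor M j) + M zero j * detDeriv (minor M j) (minor N j))) ∎
    where
    A = sumℤ (λ j → sign j * (N zero j * det (minor M j)))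
    d : Fin n → Fin (suc n) → ℤ
    d a j = det (setRow (minor M j) a (minor N j a))

  -- With polynomials given as functions only, the derivative is characterised by a remainder that
  -- is an integer multiple of ε².
  det-taylor : ∀ {n} (M N : Matrix n) ε →
    ∃ λ r → det (λ i j → M i j + ε * N i j) ≡ det M + ε * detDeriv M N + ε * ε * r
  det-taylor {zero}  M N ε = + 0 , pad ε
    where
    pad : ∀ ε → + 1 ≡ + 1 + ε * + 0 + ε * ε * + 0
    pad = solve-∀
  det-taylor {suc n} M N ε = sumℤ (λ j → sign j * ρ j) , (begin
    sumℤ (λ j → sign j * ((M zero j + ε * N zero j) * det (λ i k → M (suc i) (punchIn j k) + ε * N (suc i) (punchIn j k))))
      ≡⟨ sum-cong (λ j → trans
           (cong (λ z → sign j * ((M zero j + ε * N zero j) * z)) (proj₂ (det-taylor (minor M j) (minor N j) ε)))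
           (expand (sign j) (M zero j) (N zero j) ε (det (minor M j)) (detDeriv (minor M j) (minor N j)) (r j))) ⟩
    sumℤ (λ j → a j + ε * b j + ε * ε * (sign j * ρ j))
      ≡⟨ sum-+ (λ j → a j + ε * b j) (λ j → ε * ε * (sign j * ρ j)) ⟩
    sumℤ (λ j → a j + ε * b j) + sumℤ (λ j → ε * ε * (sign j * ρ j))
      ≡⟨ cong₂ _+_ (trans (sum-+ a (λ j → ε * b j)) (cong (λ z → sumℤ a + z) (sum-*ˡ ε b)))
           (sum-*ˡ (ε * ε) (λ j → sign j * ρ j)) ⟩
    det M + ε * sumℤ b + ε * ε * sumℤ (λ j → sign j * ρ j)
      ≡⟨ cong (λ z → det M + ε * z + ε * ε * sumℤ (λ j → sign j * ρ j)) (≡-sym (detDeriv-expand M N)) ⟩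
    det M + ε * detDeriv M N + ε * ε * sumℤ (λ j → sign j * ρ j) ∎)
    where
    r ρ a b : Fin (suc n) → ℤ
    r j = proj₁ (det-taylor (minor M j) (minor N j) ε)
    ρ j = M zero j * r j + N zero j * detDeriv (minor M j) (minor N j) + ε * N zero j * r j
    a j = sign j * (M zero j * det (minor M j))
    b j = sign j * (N zero j * det (minor M j) + M zero j * detDeriv (minor M j) (minor N j))
    expand : ∀ s m n ε d e r → s * ((m + ε * n) * (d + ε * e + ε * ε * r)) ≡
      s * (m * d) + ε * (s * (n * d + m * e)) + ε * ε * (s * (m * r + n * e + ε * n * r))
    expand = solve-∀

  -- Growth of functions of a large positive integer

  record Bounded (n : ℕ) (φ : ℤ → ℤ) : Set where
    constructor bound
    field
      factor : ℕ
      holds  : ∀ x → ∣ φ (+ suc x) ∣ ℕ.≤ factor ℕ.* suc x ℕ.^ n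

  -- Says φ = O(x^(n-1)), the substitute for degree below `n`. Multiplying by x avoids the
  -- predecessor and covers `n` = 0, where an integer-valued φ must vanish at all large arguments.
  record Small (n : ℕ) (φ : ℤ → ℤ) : Set where
    constructor small
    field
      times-id : Bounded n (λ x → x * φ x)

  bounded-cong : ∀ n {φ ψ : ℤ → ℤ} → (∀ x → φ x ≡ ψ x) → Bounded n φ → Bounded n ψ
  bounded-cong n e (bound C h) = bound C λ x → subst (λ z → ∣ z ∣ ℕ.≤ C ℕ.* suc x ℕ.^ n) (e (+ suc x)) (h x)

  bounded-const : ∀ c → Bounded 0 (λ _ → c)
  bounded-const c = bound ∣ c ∣ λ x → ℕ.≤-reflexive (≡-sym (ℕ.*-identityʳ ∣ c ∣))

  bounded-id : Bounded 1 (λ x → x)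
  bounded-id = bound 1 λ x → ℕ.≤-reflexive (≡-sym (trans (ℕ.+-identityʳ _) (ℕ.*-identityʳ (suc x))))

  bounded-+ : ∀ n {φ ψ : ℤ → ℤ} → Bounded n φ → Bounded n ψ → Bounded n (λ x → φ x + ψ x)
  bounded-+ n {φ} {ψ} (bound C h) (bound D k) = bound (C ℕ.+ D) λ x →
    ℕ.≤-trans (ℤ.∣i+j∣≤∣i∣+∣j∣ (φ (+ suc x)) (ψ (+ suc x)))
    (ℕ.≤-trans (ℕ.+-mono-≤ (h x) (k x))
      (ℕ.≤-reflexive (≡-sym (ℕ.*-distribʳ-+ (suc x ℕ.^ n) C D))))

  bounded-* : ∀ m n {φ ψ : ℤ → ℤ} → Bounded m φ → Bounded n ψ → Bounded (m ℕ.+ n) (λ x → φ x * ψ x)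
  bounded-* m n {φ} {ψ} (bound C h) (bound D k) = bound (C ℕ.* D) λ x →
    ℕ.≤-trans (ℕ.≤-reflexive (ℤ.abs-* (φ (+ suc x)) (ψ (+ suc x))))
    (ℕ.≤-trans (ℕ.*-mono-≤ (h x) (k x)) (ℕ.≤-reflexive (trans
      (ℕ.[m*n]*[o*p]≡[m*o]*[n*p] C (suc x ℕ.^ m) D (suc x ℕ.^ n))
      (cong (C ℕ.* D ℕ.*_) (≡-sym (ℕ.^-distribˡ-+-* (suc x) m n))))))

  bounded-weaken : ∀ {m n} {φ : ℤ → ℤ} → m ℕ.≤ n → Bounded m φ → Bounded n φ
  bounded-weaken m≤n (bound C h) = bound C λ x →
    ℕ.≤-trans (h x) (ℕ.*-monoʳ-≤ C (ℕ.^-monoʳ-≤ (suc x) m≤n))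

  bounded-sum : ∀ n {m} (f : Fin m → ℤ → ℤ) → (∀ i → Bounded n (f i)) → Bounded n (λ x → sumℤ (λ i → f i x))
  bounded-sum n {zero}  f h = bounded-weaken {n = n} ℕ.z≤n (bounded-const (+ 0))
  bounded-sum n {suc m} f h = bounded-+ n (h zero) (bounded-sum n (f ∘ suc) (h ∘ suc))

  bounded-scale : ∀ n c {φ : ℤ → ℤ} → Bounded n φ → Bounded n (λ x → c * φ x)
  bounded-scale n c b = bounded-* 0 n (bounded-const c) b

  small-suc : ∀ n {φ : ℤ → ℤ} → Bounded n φ → Small (suc n) φ
  small-suc n b = small (bounded-* 1 n bounded-id b)

  small-+ : ∀ n {φ ψ : ℤ → ℤ} → Small n φ → Small n ψ → Small n (λ x → φ x + ψ x)
  small-+ n {φ} {ψ} (small a) (small b) =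
    small (bounded-cong n (λ x → ≡-sym (ℤ.*-distribˡ-+ x (φ x) (ψ x))) (bounded-+ n a b))

  small-cong : ∀ n {φ ψ : ℤ → ℤ} → (∀ x → φ x ≡ ψ x) → Small n φ → Small n ψ
  small-cong n e (small a) = small (bounded-cong n (λ x → cong (x *_) (e x)) a)

  small-* : ∀ m n {φ ψ : ℤ → ℤ} → Bounded m φ → Small n ψ → Small (m ℕ.+ n) (λ x → φ x * ψ x)
  small-* m n {φ} {ψ} a (small b) =
    small (bounded-cong (m ℕ.+ n) (λ x → rearr (φ x) x (ψ x)) (bounded-* m n a b))
    where
    rearr : ∀ a x b → a * (x * b) ≡ x * (a * b)
    rearr = solve-∀

  small-scale : ∀ n c {φ : ℤ → ℤ} → Small n φ → Small n (λ x → c * φ x)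
  small-scale n c a = small-* 0 n (bounded-const c) a

  small-sum : ∀ n {m} (f : Fin m → ℤ → ℤ) → (∀ i → Small n (f i)) → Small n (λ x → sumℤ (λ i → f i x))
  small-sum n f h = small (bounded-cong n (λ x → sum-*ˡ x (λ i → f i x))
    (bounded-sum n (λ i x → x * f i x) (λ i → Small.times-id (h i))))

  small-zero : ∀ n → Small n (λ _ → + 0)
  small-zero n = small (bounded-weaken {n = n} ℕ.z≤n
    (bounded-cong 0 (λ x → ≡-sym (ℤ.*-zeroʳ x)) (bounded-const (+ 0))))

  small-weaken : ∀ {m n} {φ : ℤ → ℤ} → m ℕ.≤ n → Small m φ → Small n φ
  small-weaken m≤n (small a) = small (bounded-weaken m≤n a)

  small-lead : ∀ n c → Small n (λ x → c * x ^ n) → c ≡ + 0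
  -- At x = C + 1 the bound reads (C + 1)|c|(C + 1)^n ≤ C(C + 1)^n, which is impossible for |c| ≥ 1.
  small-lead n c (small (bound C h)) = ℤ.∣i∣≡0⇒i≡0 (ℕ.n<1⇒n≡0 (ℕ.≰⇒> λ 1≤c →
    ℕ.<-irrefl refl (ℕ.≤-trans (ℕ.m≤m*n (suc C) ∣ c ∣ {{ℕ.>-nonZero 1≤c}})
      (ℕ.*-cancelʳ-≤ (suc C ℕ.* ∣ c ∣) C (suc C ℕ.^ n) {{ℕ.m^n≢0 (suc C) n}}
        (ℕ.≤-trans (ℕ.≤-reflexive (≡-sym size)) (h C))))))
    where
    abs-^ : ∀ x n → ∣ x ^ n ∣ ≡ ∣ x ∣ ℕ.^ n
    abs-^ x zero    = refl
    abs-^ x (suc n) = trans (ℤ.abs-* x (x ^ n)) (cong (∣ x ∣ ℕ.*_) (abs-^ x n))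
    size : ∣ + suc C * (c * (+ suc C) ^ n) ∣ ≡ suc C ℕ.* ∣ c ∣ ℕ.* suc C ℕ.^ n
    size = trans (ℤ.abs-* (+ suc C) (c * (+ suc C) ^ n))
      (trans (cong (suc C ℕ.*_) (trans (ℤ.abs-* c ((+ suc C) ^ n)) (cong (∣ c ∣ ℕ.*_) (abs-^ (+ suc C) n))))
        (≡-sym (ℕ.*-assoc (suc C) ∣ c ∣ (suc C ℕ.^ n))))

  Monic : ℕ → (ℤ → ℤ) → Set
  Monic n φ = Small n (λ x → φ x - x ^ n)

  bounded-^ : ∀ n → Bounded n (λ x → x ^ n)
  bounded-^ zero    = bounded-const (+ 1)
  bounded-^ (suc n) = bounded-* 1 n bounded-id (bounded-^ n)

  monic-lead : ∀ n c {φ : ℤ → ℤ} → Monic n φ → Small n (λ x → c * φ x) → c ≡ + 0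
  monic-lead n c {φ} m s = small-lead n c (small-cong n (λ x → rearr c (φ x) (x ^ n))
    (small-+ n s (small-scale n (- c) m)))
    where
    rearr : ∀ c p q → c * p + - c * (p - q) ≡ c * q
    rearr = solve-∀

  monic-≮ : ∀ {m n} (φ : ℤ → ℤ) → Monic m φ → Monic n φ → ¬ (m ℕ.< n)
  monic-≮ {m} {n} φ a b (ℕ.s≤s m≤n) = contradiction (monic-lead n (+ 1) b (small-cong n
    (λ x → rearr (φ x) (x ^ m)) (small-+ n (small-weaken (ℕ.m≤n⇒m≤1+n m≤n) a)
      (small-weaken (ℕ.s≤s m≤n) (small-suc m (bounded-^ m)))))) λ ()
    where
    rearr : ∀ p q → (p - q) + q ≡ + 1 * p
    rearr = solve-∀

  -- An equality of polynomial functions thus determines the degree; in `Newton` this reads the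
  -- number of vertices off the multiplicities.
  monic-unique : ∀ {m n} (φ : ℤ → ℤ) → Monic m φ → Monic n φ → m ≡ n
  monic-unique φ a b = ℕ.≤-antisym (ℕ.≮⇒≥ (monic-≮ φ b a)) (ℕ.≮⇒≥ (monic-≮ φ a b))

  det-bounded : ∀ {n} (M : ℤ → Matrix n) → (∀ i j → Bounded 1 (λ x → M x i j)) →
    Bounded n (λ x → det (M x))
  det-bounded {zero}  M h = bounded-const (+ 1)
  det-bounded {suc n} M h = bounded-sum (suc n) (λ j x → sign j * (M x zero j * det (minor (M x) j))) λ j →
    bounded-scale (suc n) (sign j) (bounded-* 1 n (h zero j)
      (det-bounded (λ x → minor (M x) j) (λ i k → h (suc i) (punchIn j k))))

  -- A constant row supplies no factor x, so one degree is lost. Applied to each summand of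
  -- `detDeriv`, this keeps the derivative of the characteristic matrix below degree `n`.
  det-setRow-small : ∀ {n} (M : ℤ → Matrix n) → (∀ i j → Bounded 1 (λ x → M x i j)) →
    ∀ a (r : Fin n → ℤ) → Small n (λ x → det (setRow (M x) a r))
  det-setRow-small {suc n} M h zero r =
    small-sum (suc n) (λ j x → sign j * (r j * det (minor (M x) j))) λ j →
    small-scale (suc n) (sign j) (small-suc n (bounded-scale n (r j)
      (det-bounded (λ x → minor (M x) j) (λ i k → h (suc i) (punchIn j k)))))
  det-setRow-small {suc n} M h (suc a) r = small-cong (suc n) (λ x → ≡-sym (det-setRow-suc (M x) a r))
    (small-sum (suc n) (λ j x → sign j * (M x zero j * det (setRow (minor (M x) j) a (r ∘ punchIn j)))) λ j →
    small-scale (suc n) (sign j) (small-* 1 n (h zero j)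
      (det-setRow-small (λ x → minor (M x) j) (λ i k → h (suc i) (punchIn j k)) a (r ∘ punchIn j))))

  charMat : ∀ {n} → Matrix n → ℤ → Matrix n
  charMat B x i j = x * δ i j - B i j

  charMat-bounded : ∀ {n} (B : Matrix n) i j → Bounded 1 (λ x → charMat B x i j)
  charMat-bounded B i j = bounded-+ 1
    (bounded-cong 1 (λ x → ℤ.*-comm (δ i j) x) (bounded-scale 1 (δ i j) bounded-id))
    (bounded-weaken ℕ.z≤n (bounded-const (- B i j)))

  -- In the first row only the diagonal entry contains x, and its minor is `charPoly B₀`; every
  -- other contribution is a constant times a determinant of size `n`.
  charPoly-monic : ∀ {n} (B : Matrix n) → Monic n (charPoly B)
  charPoly-monic {zero}  B = small-cong 0 (λ x → refl) (small-zero 0)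
  charPoly-monic {suc n} B = small-cong (suc n) (λ x → ≡-sym (split x))
    (small-+ (suc n) (small-* 1 n bounded-id (charPoly-monic B₀))
      (small-+ (suc n)
        (small-suc n (bounded-scale n (- B zero zero) (det-bounded (charMat B₀) (charMat-bounded B₀))))
        (small-sum (suc n) tail λ j → small-scale (suc n) (sign (suc j)) (small-suc n
          (bounded-scale n (- B zero (suc j))
            (det-bounded (λ x → minor (charMat B x) (suc j))
              (λ i k → charMat-bounded B (suc i) (punchIn (suc j) k))))))))
    where
    B₀ : Matrix n
    B₀ i k = B (suc i) (suc k)
    tail : Fin n → ℤ → ℤ
    tail j x = sign (suc j) * (- B zero (suc j) * det (minor (charMat B x) (suc j)))
    head-eq : ∀ x b d p σ → + 1 * ((x * + 1 - b) * d) + σ - x * p ≡ x * (d - p) + (- b * d + σ)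
    head-eq = solve-∀
    tail-eq : ∀ x b d → (x * + 0 - b) * d ≡ - b * d
    tail-eq = solve-∀
    split : ∀ x → charPoly B x - x ^ suc n ≡
      x * (charPoly B₀ x - x ^ n) + (- B zero zero * charPoly B₀ x + sumℤ (λ j → tail j x))
    split x = trans
      (cong (λ σ → + 1 * ((x * + 1 - B zero zero) * charPoly B₀ x) + σ - x * x ^ n)
        (sum-cong (λ j → cong (sign (suc j) *_) (tail-eq x (B zero (suc j)) (det (minor (charMat B x) (suc j)))))))
      (head-eq x (B zero zero) (charPoly B₀ x) (x ^ n) (sumℤ (λ j → tail j x)))

  -- Products of linear factors

  rootProd : List ℤ → ℤ → ℤ
  rootProd []      x = + 1
  rootProd (θ ∷ l) x = (x - θ) * rootProd l x

  powerSum : ℕ → List ℤ → ℤ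
  powerSum r []      = + 0
  powerSum r (θ ∷ l) = θ ^ r + powerSum r l

  -- The sum of θ ^ r · rootProd l x / (x - θ) over the roots θ in l.
  rootDeriv : ℕ → List ℤ → ℤ → ℤ
  rootDeriv r []      x = + 0
  rootDeriv r (θ ∷ l) x = θ ^ r * rootProd l x + (x - θ) * rootDeriv r l x

  shift-bounded : ∀ θ → Bounded 1 (λ x → x - θ)
  shift-bounded θ = bounded-+ 1 bounded-id (bounded-weaken ℕ.z≤n (bounded-const (- θ)))

  rootProd-bounded : ∀ l → Bounded (length l) (rootProd l)
  rootProd-bounded []      = bounded-const (+ 1)
  rootProd-bounded (θ ∷ l) = bounded-* 1 (length l) (shift-bounded θ) (rootProd-bounded l)

  rootProd-monic : ∀ l → Monic (length l) (rootProd l)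
  rootProd-monic []      = small-cong 0 (λ x → refl) (small-zero 0)
  rootProd-monic (θ ∷ l) = small-cong (suc (length l))
    (λ x → rearr x θ (rootProd l x) (x ^ length l))
    (small-+ (suc (length l)) (small-* 1 (length l) bounded-id (rootProd-monic l))
      (small-suc (length l) (bounded-scale (length l) (- θ) (rootProd-bounded l))))
    where
    rearr : ∀ x θ p q → x * (p - q) + - θ * p ≡ (x - θ) * p - x * q
    rearr = solve-∀

  rootDeriv-small : ∀ r l → Small (length l) (rootDeriv r l)
  rootDeriv-small r []      = small-zero 0
  rootDeriv-small r (θ ∷ l) = small-+ (suc (length l))
    (small-suc (length l) (bounded-scale (length l) (θ ^ r) (rootProd-bounded l)))
    (small-* 1 (length l) (shift-bounded θ) (rootDeriv-small r l))

  -- Because xθ^r - θ^(r+1) = θ^r(x - θ), each summand regains exactly the linear factor that it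
  -- lacks.
  rootDeriv-step : ∀ r l x → x * rootDeriv r l x - rootDeriv (suc r) l x ≡ rootProd l x * powerSum r l
  rootDeriv-step r []      x = zeros x
    where
    zeros : ∀ x → x * + 0 - + 0 ≡ + 1 * + 0
    zeros = solve-∀
  rootDeriv-step r (θ ∷ l) x = begin
    x * (θ ^ r * P + (x - θ) * D) - (θ * θ ^ r * P + (x - θ) * D′)
      ≡⟨ expand x θ (θ ^ r) P D D′ ⟩
    (x - θ) * (P * θ ^ r) + (x - θ) * (x * D - D′)
      ≡⟨ cong (λ z → (x - θ) * (P * θ ^ r) + (x - θ) * z) (rootDeriv-step r l x) ⟩
    (x - θ) * (P * θ ^ r) + (x - θ) * (P * powerSum r l)
      ≡⟨ collect (x - θ) P (θ ^ r) (powerSum r l) ⟩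
    (x - θ) * P * (θ ^ r + powerSum r l) ∎
    where
    P = rootProd l x
    D = rootDeriv r l x
    D′ = rootDeriv (suc r) l x
    expand : ∀ x θ q p d d′ → x * (q * p + (x - θ) * d) - (θ * q * p + (x - θ) * d′) ≡
      (x - θ) * (p * q) + (x - θ) * (x * d - d′)
    expand = solve-∀
    collect : ∀ a p q s → a * (p * q) + a * (p * s) ≡ a * p * (q + s)
    collect = solve-∀

  rootProd-taylor : ∀ l x ε → ∃ λ r → rootProd l (x + ε) ≡ rootProd l x + ε * rootDeriv 0 l x + ε * ε * r
  rootProd-taylor []      x ε = + 0 , pad ε
    where
    pad : ∀ ε → + 1 ≡ + 1 + ε * + 0 + ε * ε * + 0
    pad = solve-∀
  rootProd-taylor (θ ∷ l) x ε with rootProd-taylor l x ε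
  ... | r , e = rootDeriv 0 l x + (x + ε - θ) * r , trans (cong ((x + ε - θ) *_) e)
    (expand x ε θ (rootProd l x) (rootDeriv 0 l x) r)
    where
    expand : ∀ x ε θ p d r → (x + ε - θ) * (p + ε * d + ε * ε * r) ≡
      (x - θ) * p + ε * (+ 1 * p + (x - θ) * d) + ε * ε * (d + (x + ε - θ) * r)
    expand = solve-∀

  -- The two coefficients agree modulo ε; take ε larger than their difference.
  linear-coefficient : ∀ p a b → (∀ ε → ∃ λ r → ∃ λ r′ → p + ε * a + ε * ε * r ≡ p + ε * b + ε * ε * r′) → a ≡ b
  linear-coefficient p a b h with h (+ suc ∣ a - b ∣)
  ... | r , r′ , e = ℤ.i-j≡0⇒i≡j a b (multiple (a - b) (r′ - r) (ℤ.*-cancelˡ-≡ ε (a - b) (ε * (r′ - r)) (begin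
    ε * (a - b)                                                       ≡⟨ left p ε a b r ⟩
    (p + ε * a + ε * ε * r) - (p + ε * b + ε * ε * r)                 ≡⟨ cong (_- (p + ε * b + ε * ε * r)) e ⟩
    (p + ε * b + ε * ε * r′) - (p + ε * b + ε * ε * r)                ≡⟨ right p ε b r r′ ⟩
    ε * (ε * (r′ - r))                                                ∎)))
    where
    ε = + suc ∣ a - b ∣
    left : ∀ p ε a b r → ε * (a - b) ≡ (p + ε * a + ε * ε * r) - (p + ε * b + ε * ε * r)
    left = solve-∀
    right : ∀ p ε b r r′ → (p + ε * b + ε * ε * r′) - (p + ε * b + ε * ε * r) ≡ ε * (ε * (r′ - r))
    right = solve-∀
    multiple : ∀ d k → d ≡ + suc ∣ d ∣ * k → d ≡ + 0
    multiple d k e with ∣ k ∣ ℕ.≟ 0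
    ... | yes k≡0 = trans e (trans (cong (+ suc ∣ d ∣ *_) (ℤ.∣i∣≡0⇒i≡0 k≡0)) (ℤ.*-zeroʳ (+ suc ∣ d ∣)))
    ... | no  k≢0 = contradiction
      (ℕ.≤-trans (ℕ.m≤m*n (suc ∣ d ∣) ∣ k ∣ {{ℕ.≢-nonZero k≢0}})
        (ℕ.≤-reflexive (≡-sym (trans (cong ∣_∣ e) (ℤ.abs-* (+ suc ∣ d ∣) k)))))
      ℕ.1+n≰n

  -- Traces of powers from the characteristic polynomial

  infixr 8 _^^_
  _^^_ : ∀ {n} → Matrix n → ℕ → Matrix n
  B ^^ zero  = δ
  B ^^ suc r = (B ^^ r) ⊡ B

  -- φ_r = detDeriv (xI - B) (B ^^ r) and ψ_r = rootDeriv r both satisfy x φ_r - φ_{r+1} = p(x) c_r, where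
  -- c_r is the trace of B ^^ r, respectively the r-th power sum of the roots.  They start with
  -- φ_0 = ψ_0 = p′ and have lower degree than p, so that they agree term by term.
  module Newton {n} (B : Matrix n) (roots : List ℤ) (h : ∀ x → charPoly B x ≡ rootProd roots x) where

    size : n ≡ length roots
    size = monic-unique (charPoly B) (charPoly-monic B) (small-cong (length roots)
      (λ x → cong (_- x ^ length roots) (≡-sym (h x))) (rootProd-monic roots))

    deriv : ℕ → ℤ → ℤ
    deriv r x = detDeriv (charMat B x) (B ^^ r)

    deriv-step : ∀ r x → x * deriv r x - deriv (suc r) x ≡ charPoly B x * trace (B ^^ r)
    deriv-step r x = begin
      x * deriv r x - deriv (suc r) x
        ≡⟨ ≡-sym (detDeriv-linear (charMat B x) (B ^^ r) (B ^^ suc r) x) ⟩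
      detDeriv (charMat B x) (λ i k → x * (B ^^ r) i k - (B ^^ suc r) i k)
        ≡⟨ detDeriv-cong (charMat B x) (λ i k → ≡-sym (product i k)) ⟩
      detDeriv (charMat B x) ((B ^^ r) ⊡ charMat B x)
        ≡⟨ detDeriv-⊡ (charMat B x) (B ^^ r) ⟩
      charPoly B x * trace (B ^^ r) ∎
      where
      expand : ∀ p x d b → p * (x * d - b) ≡ d * (x * p) + - (+ 1) * (p * b)
      expand = solve-∀
      minus : ∀ p q → p + - (+ 1) * q ≡ p - q
      minus = solve-∀
      product : ∀ i k → ((B ^^ r) ⊡ charMat B x) i k ≡ x * (B ^^ r) i k - (B ^^ suc r) i k
      product i k = begin
        sumℤ (λ j → (B ^^ r) i j * (x * δ j k - B j k))
          ≡⟨ sum-cong (λ j → trans (cong (λ d → (B ^^ r) i j * (x * d - B j k)) (δ-sym j k))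
               (expand ((B ^^ r) i j) x (δ k j) (B j k))) ⟩
        sumℤ (λ j → δ k j * (x * (B ^^ r) i j) + - (+ 1) * ((B ^^ r) i j * B j k))
          ≡⟨ sum-+ (λ j → δ k j * (x * (B ^^ r) i j)) (λ j → - (+ 1) * ((B ^^ r) i j * B j k)) ⟩
        sumℤ (λ j → δ k j * (x * (B ^^ r) i j)) + sumℤ (λ j → - (+ 1) * ((B ^^ r) i j * B j k))
          ≡⟨ cong₂ _+_ (sum-δ k (λ j → x * (B ^^ r) i j)) (sum-*ˡ (- (+ 1)) (λ j → (B ^^ r) i j * B j k)) ⟩
        x * (B ^^ r) i k + - (+ 1) * (B ^^ suc r) i k
          ≡⟨ minus (x * (B ^^ r) i k) ((B ^^ suc r) i k) ⟩
        x * (B ^^ r) i k - (B ^^ suc r) i k ∎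

    deriv-small : ∀ r → Small n (deriv r)
    deriv-small r = small-sum n (λ a x → det (setRow (charMat B x) a ((B ^^ r) a)))
      (λ a → det-setRow-small (charMat B) (charMat-bounded B) a ((B ^^ r) a))

    -- Replacing x by x + ε adds ε times the identity to the matrix. Both sides are therefore linear
    -- coefficients of one function, expanded once as a determinant and once as a product.
    deriv-zero : ∀ x → deriv 0 x ≡ rootDeriv 0 roots x
    deriv-zero x = linear-coefficient (charPoly B x) (deriv 0 x) (rootDeriv 0 roots x) λ ε →
      let (r , e) = det-taylor (charMat B x) δ ε
          (r′ , e′) = rootProd-taylor roots x ε
      in r , r′ , (begin
        charPoly B x + ε * deriv 0 x + ε * ε * r             ≡⟨ ≡-sym e ⟩
        det (λ i j → charMat B x i j + ε * δ i j)            ≡⟨ det-cong (λ i j → rearr x ε (δ i j) (B i j)) ⟩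
        charPoly B (x + ε)                                   ≡⟨ h (x + ε) ⟩
        rootProd roots (x + ε)                               ≡⟨ e′ ⟩
        rootProd roots x + ε * rootDeriv 0 roots x + ε * ε * r′
          ≡⟨ cong (λ z → z + ε * rootDeriv 0 roots x + ε * ε * r′) (≡-sym (h x)) ⟩
        charPoly B x + ε * rootDeriv 0 roots x + ε * ε * r′  ∎)
      where
      rearr : ∀ x ε d b → x * d - b + ε * d ≡ (x + ε) * d - b
      rearr = solve-∀

    -- Subtracting the two recurrences leaves the constant `trace (B ^^ r) - powerSum r roots` times
    -- `charPoly B x` on one side and a function of lower order on the other, so the constant is
    -- zero.
    trace-step : ∀ r → (∀ x → deriv r x ≡ rootDeriv r roots x) → trace (B ^^ r) ≡ powerSum r roots
    trace-step r e = ℤ.i-j≡0⇒i≡j _ _ (monic-lead n (trace (B ^^ r) - powerSum r roots) (charPoly-monic B)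
      (small-cong n difference (small-+ n
        (subst (λ m → Small m (rootDeriv (suc r) roots)) (≡-sym size) (rootDeriv-small (suc r) roots))
        (small-scale n (- (+ 1)) (deriv-small (suc r))))))
      where
      rearr : ∀ x d a b p t q → x * d - a ≡ p * t → x * d - b ≡ p * q → b + - (+ 1) * a ≡ (t - q) * p
      rearr x d a b p t q e e′ = trans (left x d a b) (trans (cong₂ _-_ e e′) (right p t q))
        where
        left : ∀ x d a b → b + - (+ 1) * a ≡ (x * d - a) - (x * d - b)
        left = solve-∀
        right : ∀ p t q → p * t - p * q ≡ (t - q) * p
        right = solve-∀
      difference : ∀ x → rootDeriv (suc r) roots x + - (+ 1) * deriv (suc r) x ≡
        (trace (B ^^ r) - powerSum r roots) * charPoly B x
      difference x = rearr x (deriv r x) (deriv (suc r) x) (rootDeriv (suc r) roots x) (charPoly B x)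
        (trace (B ^^ r)) (powerSum r roots) (deriv-step r x)
        (trans (cong (λ z → x * z - rootDeriv (suc r) roots x) (e x))
          (trans (rootDeriv-step r roots x) (cong (_* powerSum r roots) (≡-sym (h x)))))

    deriv-agree : ∀ r x → deriv r x ≡ rootDeriv r roots x
    deriv-agree zero    x = deriv-zero x
    deriv-agree (suc r) x = rearr x (deriv r x) (deriv (suc r) x) (rootDeriv (suc r) roots x) (begin
      x * deriv r x - deriv (suc r) x                       ≡⟨ deriv-step r x ⟩
      charPoly B x * trace (B ^^ r)                         ≡⟨ cong₂ _*_ (h x) (trace-step r (deriv-agree r)) ⟩
      rootProd roots x * powerSum r roots                   ≡⟨ ≡-sym (rootDeriv-step r roots x) ⟩
      x * rootDeriv r roots x - rootDeriv (suc r) roots x   ≡⟨ cong (λ z → x * z - rootDeriv (suc r) roots x) (≡-sym (deriv-agree r x)) ⟩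
      x * deriv r x - rootDeriv (suc r) roots x             ∎)
      where
      rearr : ∀ x d a b → x * d - a ≡ x * d - b → a ≡ b
      rearr x d a b e = trans (there x d a) (trans (cong (λ z → x * d - z) e) (≡-sym (there x d b)))
        where
        there : ∀ x d a → a ≡ x * d - (x * d - a)
        there = solve-∀

    trace-power : ∀ r → trace (B ^^ r) ≡ powerSum r roots
    trace-power r = trace-step r (deriv-agree r)

  -- Matrix powers

  ⊡-assoc : ∀ {n} (X Y Z : Matrix n) i j → ((X ⊡ Y) ⊡ Z) i j ≡ (X ⊡ (Y ⊡ Z)) i j
  ⊡-assoc X Y Z i j = begin
    sumℤ (λ k → sumℤ (λ l → X i l * Y l k) * Z k j)
      ≡⟨ sum-cong (λ k → ≡-sym (sum-*ʳ (Z k j) (λ l → X i l * Y l k))) ⟩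
    sumℤ (λ k → sumℤ (λ l → X i l * Y l k * Z k j))
      ≡⟨ sum-swap (λ k l → X i l * Y l k * Z k j) ⟩
    sumℤ (λ l → sumℤ (λ k → X i l * Y l k * Z k j))
      ≡⟨ sum-cong (λ l → trans (sum-cong (λ k → ℤ.*-assoc (X i l) (Y l k) (Z k j)))
           (sum-*ˡ (X i l) (λ k → Y l k * Z k j))) ⟩
    sumℤ (λ l → X i l * sumℤ (λ k → Y l k * Z k j)) ∎

  ⊡-δʳ : ∀ {n} (X : Matrix n) i j → (X ⊡ δ) i j ≡ X i j
  ⊡-δʳ X i j = trans (sum-cong (λ k → trans (cong (X i k *_) (δ-sym k j)) (ℤ.*-comm (X i k) (δ j k))))
    (sum-δ j (X i))

  ⊡-cong : ∀ {n} {X X′ Y Y′ : Matrix n} → (∀ i j → X i j ≡ X′ i j) → (∀ i j → Y i j ≡ Y′ i j) →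
    ∀ i j → (X ⊡ Y) i j ≡ (X′ ⊡ Y′) i j
  ⊡-cong e e′ i j = sum-cong λ k → cong₂ _*_ (e i k) (e′ k j)

  ^^-one : ∀ {n} (B : Matrix n) i j → (B ^^ 1) i j ≡ B i j
  ^^-one B i j = sum-δ i (λ k → B k j)

  ^^-+ : ∀ {n} (B : Matrix n) a b i j → (B ^^ a ⊡ B ^^ b) i j ≡ (B ^^ (a ℕ.+ b)) i j
  ^^-+ B a zero    i j = trans (⊡-δʳ (B ^^ a) i j) (cong (λ r → (B ^^ r) i j) (≡-sym (ℕ.+-identityʳ a)))
  ^^-+ B a (suc b) i j = trans (≡-sym (⊡-assoc (B ^^ a) (B ^^ b) B i j))
    (trans (⊡-cong {Y = B} (^^-+ B a b) (λ _ _ → refl) i j)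
      (cong (λ r → (B ^^ r) i j) (≡-sym (ℕ.+-suc a b))))

  ^^-sym : ∀ {n} (B : Matrix n) → (∀ i j → B i j ≡ B j i) → ∀ r i j → (B ^^ r) i j ≡ (B ^^ r) j i
  ^^-sym B B-sym zero    i j = δ-sym i j
  ^^-sym B B-sym (suc r) i j = begin
    sumℤ (λ k → (B ^^ r) i k * B k j)        ≡⟨ sum-cong (λ k → trans (cong₂ _*_ (^^-sym B B-sym r i k)
      (trans (B-sym k j) (≡-sym (^^-one B j k)))) (ℤ.*-comm ((B ^^ r) k i) ((B ^^ 1) j k))) ⟩
    sumℤ (λ k → (B ^^ 1) j k * (B ^^ r) k i) ≡⟨ ^^-+ B 1 r j i ⟩
    (B ^^ suc r) j i                          ∎

  ^^-rowSum : ∀ {n} (B : Matrix n) κ → (∀ i → sumℤ (B i) ≡ κ) → ∀ r i → sumℤ ((B ^^ r) i) ≡ κ ^ r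
  ^^-rowSum B κ h zero    i = trans (sum-cong (λ j → ≡-sym (ℤ.*-identityʳ (δ i j)))) (sum-δ i (λ _ → + 1))
  ^^-rowSum B κ h (suc r) i = begin
    sumℤ (λ j → sumℤ (λ k → (B ^^ r) i k * B k j))  ≡⟨ sum-swap (λ j k → (B ^^ r) i k * B k j) ⟩
    sumℤ (λ k → sumℤ (λ j → (B ^^ r) i k * B k j))
      ≡⟨ sum-cong (λ k → trans (sum-*ˡ ((B ^^ r) i k) (B k)) (cong ((B ^^ r) i k *_) (h k))) ⟩
    sumℤ (λ k → (B ^^ r) i k * κ)                   ≡⟨ sum-*ʳ κ ((B ^^ r) i) ⟩
    sumℤ ((B ^^ r) i) * κ                           ≡⟨ cong (_* κ) (^^-rowSum B κ h r i) ⟩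
    κ ^ r * κ                                       ≡⟨ ℤ.*-comm (κ ^ r) κ ⟩
    κ * κ ^ r                                       ∎

  -- The trace form and its positivity

  ⟪_,_⟫ : ∀ {n} → Matrix n → Matrix n → ℤ
  ⟪ X , Y ⟫ = sumℤ (λ i → sumℤ (λ j → X i j * Y i j))

  ⟪⟫-comm : ∀ {n} (X Y : Matrix n) → ⟪ X , Y ⟫ ≡ ⟪ Y , X ⟫
  ⟪⟫-comm X Y = sum-cong λ i → sum-cong λ j → ℤ.*-comm (X i j) (Y i j)

  ⟪⟫-trace : ∀ {n} (B : Matrix n) → (∀ i j → B i j ≡ B j i) → ∀ a b → ⟪ B ^^ a , B ^^ b ⟫ ≡ trace (B ^^ (a ℕ.+ b))
  ⟪⟫-trace B B-sym a b = sum-cong λ i → trans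
    (sum-cong (λ j → cong ((B ^^ a) i j *_) (^^-sym B B-sym b i j))) (^^-+ B a b i i)

  sum-lin₃ : ∀ {n} a b (f g h : Fin n → ℤ) →
    sumℤ (λ i → f i + a * g i + b * h i) ≡ sumℤ f + a * sumℤ g + b * sumℤ h
  sum-lin₃ a b f g h = begin
    sumℤ (λ i → f i + a * g i + b * h i)
      ≡⟨ sum-+ (λ i → f i + a * g i) (λ i → b * h i) ⟩
    sumℤ (λ i → f i + a * g i) + sumℤ (λ i → b * h i)
      ≡⟨ cong₂ _+_ (sum-+ f (λ i → a * g i)) (sum-*ˡ b h) ⟩
    sumℤ f + sumℤ (λ i → a * g i) + b * sumℤ h
      ≡⟨ cong (λ p → sumℤ f + p + b * sumℤ h) (sum-*ˡ a g) ⟩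
    sumℤ f + a * sumℤ g + b * sumℤ h ∎

  sum-lin₄ : ∀ {n} a b c (f g h k : Fin n → ℤ) →
    sumℤ (λ i → f i + a * g i + b * h i + c * k i) ≡ sumℤ f + a * sumℤ g + b * sumℤ h + c * sumℤ k
  sum-lin₄ a b c f g h k = trans (sum-+ (λ i → f i + a * g i + b * h i) (λ i → c * k i))
    (cong₂ _+_ (sum-lin₃ a b f g h) (sum-*ˡ c k))

  ⟪⟫-lin₄ : ∀ {n} a b c (X₁ X₂ X₃ X₄ Y : Matrix n) →
    ⟪ (λ i j → X₁ i j + a * X₂ i j + b * X₃ i j + c * X₄ i j) , Y ⟫ ≡
    ⟪ X₁ , Y ⟫ + a * ⟪ X₂ , Y ⟫ + b * ⟪ X₃ , Y ⟫ + c * ⟪ X₄ , Y ⟫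
  ⟪⟫-lin₄ a b c X₁ X₂ X₃ X₄ Y = trans
    (sum-cong (λ i → trans
      (sum-cong (λ j → distrib a b c (X₁ i j) (X₂ i j) (X₃ i j) (X₄ i j) (Y i j)))
      (sum-lin₄ a b c (λ j → X₁ i j * Y i j) (λ j → X₂ i j * Y i j) (λ j → X₃ i j * Y i j) (λ j → X₄ i j * Y i j))))
    (sum-lin₄ a b c (λ i → sumℤ (λ j → X₁ i j * Y i j)) (λ i → sumℤ (λ j → X₂ i j * Y i j))
      (λ i → sumℤ (λ j → X₃ i j * Y i j)) (λ i → sumℤ (λ j → X₄ i j * Y i j)))
    where
    distrib : ∀ a b c p q r s y → (p + a * q + b * r + c * s) * y ≡ p * y + a * (q * y) + b * (r * y) + c * (s * y)
    distrib = solve-∀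

  sum-mono : ∀ {n} {f g : Fin n → ℤ} → (∀ i → f i ℤ.≤ g i) → sumℤ f ℤ.≤ sumℤ g
  sum-mono {zero}  h = ℤ.≤-refl
  sum-mono {suc n} h = ℤ.+-mono-≤ (h zero) (sum-mono (h ∘ suc))

  sum-nonneg : ∀ {n} {f : Fin n → ℤ} → (∀ i → + 0 ℤ.≤ f i) → + 0 ℤ.≤ sumℤ f
  sum-nonneg {n} h = ℤ.≤-trans (ℤ.≤-reflexive (≡-sym (sum-zero {n} (λ _ → refl)))) (sum-mono h)

  sum-nonneg-zero : ∀ {n} {f : Fin n → ℤ} → (∀ i → + 0 ℤ.≤ f i) → sumℤ f ≡ + 0 → ∀ i → f i ≡ + 0
  sum-nonneg-zero {suc n} {f} h e zero = ℤ.≤-antisym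
    (ℤ.≤-trans (ℤ.≤-reflexive (≡-sym (ℤ.+-identityʳ (f zero))))
      (ℤ.≤-trans (ℤ.+-monoʳ-≤ (f zero) (sum-nonneg (h ∘ suc))) (ℤ.≤-reflexive e))) (h zero)
  sum-nonneg-zero {suc n} {f} h e (suc i) = sum-nonneg-zero (h ∘ suc) (ℤ.≤-antisym
    (ℤ.≤-trans (ℤ.≤-reflexive (≡-sym (ℤ.+-identityˡ (sumℤ (f ∘ suc)))))
      (ℤ.≤-trans (ℤ.+-monoˡ-≤ (sumℤ (f ∘ suc)) (h zero)) (ℤ.≤-reflexive e))) (sum-nonneg (h ∘ suc))) i

  square-nonneg : ∀ a → + 0 ℤ.≤ a * a
  square-nonneg (+ a)      = ℤ.≤-trans (ℤ.+≤+ ℕ.z≤n) (ℤ.≤-reflexive (ℤ.pos-* a a))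
  square-nonneg ℤ.-[1+ a ] = ℤ.+≤+ ℕ.z≤n

  square-zero : ∀ a → a * a ≡ + 0 → a ≡ + 0
  square-zero a e with ℤ.i*j≡0⇒i≡0∨j≡0 a e
  ... | inj₁ p = p
  ... | inj₂ p = p

  -- Takes the place of diagonalising symmetric matrices: a matrix identity follows as soon as the
  -- squares of the entries of the difference are known to sum to zero.
  ⟪⟫-definite : ∀ {n} (X : Matrix n) → ⟪ X , X ⟫ ≡ + 0 → ∀ i j → X i j ≡ + 0
  ⟪⟫-definite X e i j = square-zero (X i j) (sum-nonneg-zero (λ j → square-nonneg (X i j))
    (sum-nonneg-zero (λ i → sum-nonneg (λ j → square-nonneg (X i j))) e i) j)

  -- The cubic relation satisfied by I + A

  module Cubic {n} (B : Matrix n) (B-sym : ∀ i j → B i j ≡ B j i) (B-idem : ∀ i j → B i j * B i j ≡ B i j)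
    (κ S T : ℤ) (regular : ∀ i → sumℤ (B i) ≡ κ) (n≢0 : + n ≢ + 0)
    (order : + n ≡ S * ((T + + 1) * (T + + 1)))
    -- The exponents start at 1, where the eigenvalue 0 of `B` contributes nothing, whatever its
    -- multiplicity.
    (traces : ∀ r → trace (B ^^ suc r) ≡
      (S * (+ 2 * T + + 1)) ^ suc r + + 2 * T * (S * T) ^ suc r + T * T * (- S) ^ suc r) where

    K : ℤ
    K = S * (+ 2 * T + + 1)

    -- Entries 0 and 1 make the trace of `B ^^ 2` the number of ones in `B`, which is `n` times the
    -- common row sum.
    degree-eq : κ ≡ K
    degree-eq = ℤ.*-cancelˡ-≡ (+ n) κ K {{ℤ.≢-nonZero n≢0}} (begin
      + n * κ                                         ≡⟨ ≡-sym (sum-const n κ) ⟩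
      sumℤ {n} (λ _ → κ)                              ≡⟨ sum-cong (λ i → ≡-sym (regular i)) ⟩
      sumℤ (λ i → sumℤ (B i))                         ≡⟨ sum-cong (λ i → sum-cong (λ j → ≡-sym (trans
                                                           (cong₂ _*_ (^^-one B i j) (^^-one B i j)) (B-idem i j)))) ⟩
      ⟪ B ^^ 1 , B ^^ 1 ⟫                             ≡⟨ ⟪⟫-trace B B-sym 1 1 ⟩
      trace (B ^^ 2)                                  ≡⟨ traces 1 ⟩
      K ^ 2 + + 2 * T * (S * T) ^ 2 + T * T * (- S) ^ 2 ≡⟨ identity S T ⟩
      S * ((T + + 1) * (T + + 1)) * K                 ≡⟨ cong (_* K) (≡-sym order) ⟩
      + n * K ∎)
      where
      identity : ∀ S T → S * (+ 2 * T + + 1) * (S * (+ 2 * T + + 1) * + 1) + + 2 * T * (S * T * (S * T * + 1)) + T * T * (- S * (- S * + 1))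
        ≡ S * ((T + + 1) * (T + + 1)) * (S * (+ 2 * T + + 1))
      identity = solve-∀

    rowSums : ∀ r i → sumℤ ((B ^^ r) i) ≡ K ^ r
    rowSums r i = trans (^^-rowSum B κ regular r i) (cong (_^ r) degree-eq)

    -- `α` and `β` are the coefficients of X(X - ST)(X + S), which vanishes at the eigenvalues ST, 0
    -- and -S of `B`. At `K` this cubic takes the value 2S²(2T + 1)n, and `γ` times the all-ones
    -- matrix cancels it.
    α β γ : ℤ
    α = - (S * (T - + 1))
    β = - (S * S * T)
    γ = - (+ 2 * S * S * (+ 2 * T + + 1))

    one : Matrix n
    one _ _ = + 1

    Z : Matrix n
    Z i j = (B ^^ 3) i j + α * (B ^^ 2) i j + β * (B ^^ 1) i j + γ * one i j

    ⟪one,power⟫ : ∀ r → ⟪ one , B ^^ r ⟫ ≡ + n * K ^ r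
    ⟪one,power⟫ r = trans (sum-cong (λ i → trans (sum-cong (λ j → ℤ.*-identityˡ ((B ^^ r) i j))) (rowSums r i)))
      (sum-const n (K ^ r))

    ⟪one,one⟫ : ⟪ one , one ⟫ ≡ + n * + n
    ⟪one,one⟫ = trans (sum-cong {n} (λ _ → trans (sum-const n (+ 1)) (ℤ.*-identityʳ (+ n)))) (sum-const n (+ n))

    -- The pairing evaluates the cubic at each nonzero eigenvalue, weighted by a power of it: ST and
    -- -S are roots, and the `γ` term cancels the contribution of `K`.
    Z⊥power : ∀ r → ⟪ Z , B ^^ suc r ⟫ ≡ + 0
    Z⊥power r = begin
      ⟪ Z , B ^^ suc r ⟫
        ≡⟨ ⟪⟫-lin₄ α β γ (B ^^ 3) (B ^^ 2) (B ^^ 1) one (B ^^ suc r) ⟩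
      ⟪ B ^^ 3 , B ^^ suc r ⟫ + α * ⟪ B ^^ 2 , B ^^ suc r ⟫ + β * ⟪ B ^^ 1 , B ^^ suc r ⟫ + γ * ⟪ one , B ^^ suc r ⟫
        ≡⟨ cong₂ (λ p q → p + γ * q)
             (cong₂ (λ p q → p + β * q)
               (cong₂ (λ p q → p + α * q) (pair 2) (pair 1)) (pair 0))
             (trans (⟪one,power⟫ (suc r)) (cong (_* K ^ suc r) order)) ⟩
      m (3 ℕ.+ suc r) + α * m (2 ℕ.+ suc r) + β * m (1 ℕ.+ suc r) + γ * (S * ((T + + 1) * (T + + 1)) * K ^ suc r)
        ≡⟨ identity S T (K ^ suc r) ((S * T) ^ suc r) ((- S) ^ suc r) ⟩
      + 0 ∎
      where
      m : ℕ → ℤ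
      m r = K ^ r + + 2 * T * (S * T) ^ r + T * T * (- S) ^ r
      pair : ∀ a → ⟪ B ^^ suc a , B ^^ suc r ⟫ ≡ m (suc a ℕ.+ suc r)
      pair a = trans (⟪⟫-trace B B-sym (suc a) (suc r)) (traces (a ℕ.+ suc r))
      identity : ∀ S T k u v →
        (S * (+ 2 * T + + 1) * (S * (+ 2 * T + + 1) * (S * (+ 2 * T + + 1) * k)) + + 2 * T * (S * T * (S * T * (S * T * u))) + T * T * (- S * (- S * (- S * v))))
        + - (S * (T - + 1)) * (S * (+ 2 * T + + 1) * (S * (+ 2 * T + + 1) * k) + + 2 * T * (S * T * (S * T * u)) + T * T * (- S * (- S * v)))
        + - (S * S * T) * (S * (+ 2 * T + + 1) * k + + 2 * T * (S * T * u) + T * T * (- S * v))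
        + - (+ 2 * S * S * (+ 2 * T + + 1)) * (S * ((T + + 1) * (T + + 1)) * k) ≡ + 0
      identity = solve-∀

    Z⊥one : ⟪ Z , one ⟫ ≡ + 0
    Z⊥one = begin
      ⟪ Z , one ⟫
        ≡⟨ ⟪⟫-lin₄ α β γ (B ^^ 3) (B ^^ 2) (B ^^ 1) one one ⟩
      ⟪ B ^^ 3 , one ⟫ + α * ⟪ B ^^ 2 , one ⟫ + β * ⟪ B ^^ 1 , one ⟫ + γ * ⟪ one , one ⟫
        ≡⟨ cong₂ (λ p q → p + γ * q)
             (cong₂ (λ p q → p + β * q) (cong₂ (λ p q → p + α * q) (pair 3) (pair 2)) (pair 1)) ⟪one,one⟫ ⟩
      + n * K ^ 3 + α * (+ n * K ^ 2) + β * (+ n * K ^ 1) + γ * (+ n * + n)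
        ≡⟨ cong (λ ν → ν * K ^ 3 + α * (ν * K ^ 2) + β * (ν * K ^ 1) + γ * (ν * ν)) order ⟩
      N * K ^ 3 + α * (N * K ^ 2) + β * (N * K ^ 1) + γ * (N * N)
        ≡⟨ identity S T ⟩
      + 0 ∎
      where
      N = S * ((T + + 1) * (T + + 1))
      pair : ∀ r → ⟪ B ^^ r , one ⟫ ≡ + n * K ^ r
      pair r = trans (⟪⟫-comm (B ^^ r) one) (⟪one,power⟫ r)
      identity : ∀ S T →
        S * ((T + + 1) * (T + + 1)) * (S * (+ 2 * T + + 1) * (S * (+ 2 * T + + 1) * (S * (+ 2 * T + + 1) * + 1)))
        + - (S * (T - + 1)) * (S * ((T + + 1) * (T + + 1)) * (S * (+ 2 * T + + 1) * (S * (+ 2 * T + + 1) * + 1)))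
        + - (S * S * T) * (S * ((T + + 1) * (T + + 1)) * (S * (+ 2 * T + + 1) * + 1))
        + - (+ 2 * S * S * (+ 2 * T + + 1)) * (S * ((T + + 1) * (T + + 1)) * (S * ((T + + 1) * (T + + 1)))) ≡ + 0
      identity = solve-∀

    -- `Z` is orthogonal to each of the four matrices that it combines, hence to itself.
    Z≡0 : ∀ i j → Z i j ≡ + 0
    Z≡0 = ⟪⟫-definite Z (begin
      ⟪ Z , Z ⟫
        ≡⟨ ⟪⟫-lin₄ α β γ (B ^^ 3) (B ^^ 2) (B ^^ 1) one Z ⟩
      ⟪ B ^^ 3 , Z ⟫ + α * ⟪ B ^^ 2 , Z ⟫ + β * ⟪ B ^^ 1 , Z ⟫ + γ * ⟪ one , Z ⟫
        ≡⟨ cong₂ (λ p q → p + γ * q)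
             (cong₂ (λ p q → p + β * q) (cong₂ (λ p q → p + α * q) (flip 2) (flip 1)) (flip 0))
             (trans (⟪⟫-comm one Z) Z⊥one) ⟩
      + 0 + α * + 0 + β * + 0 + γ * + 0
        ≡⟨ zeros α β γ ⟩
      + 0 ∎)
      where
      flip : ∀ r → ⟪ B ^^ suc r , Z ⟫ ≡ + 0
      flip r = trans (⟪⟫-comm (B ^^ suc r) Z) (Z⊥power r)
      zeros : ∀ α β γ → + 0 + α * + 0 + β * + 0 + γ * + 0 ≡ + 0
      zeros = solve-∀

    codeg : Matrix n
    codeg x y = sumℤ (λ z → B x z * B z y)

    power-two : ∀ x y → (B ^^ 2) x y ≡ codeg x y
    power-two x y = sum-cong (λ z → cong (_* B z y) (^^-one B x z))

    cubic : ∀ x y → sumℤ (λ z → B x z * codeg z y) ≡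
      S * (T - + 1) * codeg x y + S * S * T * B x y + + 2 * S * S * (+ 2 * T + + 1)
    cubic x y = trans (≡-sym cube) (rearr _ _ _ S T (trans
        (cong₂ (λ q b → (B ^^ 3) x y + α * q + β * b + γ * + 1) (≡-sym (power-two x y)) (≡-sym (^^-one B x y))) (Z≡0 x y)))
      where
      cube : (B ^^ 3) x y ≡ sumℤ (λ z → B x z * codeg z y)
      cube = trans (≡-sym (^^-+ B 1 2 x y)) (sum-cong (λ z → cong₂ _*_ (^^-one B x z) (power-two z y)))
      rearr : ∀ p q b S T → p + - (S * (T - + 1)) * q + - (S * S * T) * b + - (+ 2 * S * S * (+ 2 * T + + 1)) * + 1 ≡ + 0 →
        p ≡ S * (T - + 1) * q + S * S * T * b + + 2 * S * S * (+ 2 * T + + 1)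
      rearr p q b S T e = trans (split p q b S T) (trans (cong (λ z → z + (S * (T - + 1) * q + S * S * T * b + + 2 * S * S * (+ 2 * T + + 1))) e) (ℤ.+-identityˡ _))
        where
        split : ∀ p q b S T → p ≡ (p + - (S * (T - + 1)) * q + - (S * S * T) * b + - (+ 2 * S * S * (+ 2 * T + + 1)) * + 1)
          + (S * (T - + 1) * q + S * S * T * b + + 2 * S * S * (+ 2 * T + + 1))
        split = solve-∀

  -- Closed neighbourhoods

  b2ℤ-∧ : ∀ a b → b2ℤ (a ∧ b) ≡ b2ℤ a * b2ℤ b
  b2ℤ-∧ true  true  = refl
  b2ℤ-∧ true  false = refl
  b2ℤ-∧ false true  = refl
  b2ℤ-∧ false false = refl

  b2ℤ-idem : ∀ a → b2ℤ a * b2ℤ a ≡ b2ℤ a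
  b2ℤ-idem true  = refl
  b2ℤ-idem false = refl

  b2ℤ-b2ℕ : ∀ a → b2ℤ a ≡ + b2ℕ a
  b2ℤ-b2ℕ true  = refl
  b2ℤ-b2ℕ false = refl

  sumℕ-sumℤ : ∀ {n} (f : Fin n → ℕ) → + sumℕ f ≡ sumℤ (λ i → + f i)
  sumℕ-sumℤ {zero}  f = refl
  sumℕ-sumℤ {suc n} f = cong (λ z → + f zero + z) (sumℕ-sumℤ (f ∘ suc))

  closed : ∀ {n} → Graph n → Fin n → Fin n → Bool
  closed Γ x y = adj Γ x y ∨ ⌊ x Fin.≟ y ⌋

  closed-refl : ∀ {n} (Γ : Graph n) x → closed Γ x x ≡ true
  closed-refl Γ x rewrite irrefl Γ x with x Fin.≟ x
  ... | yes _ = refl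
  ... | no ne = contradiction refl ne

  closed-sym : ∀ {n} (Γ : Graph n) x y → closed Γ x y ≡ closed Γ y x
  closed-sym Γ x y rewrite sym Γ x y with x Fin.≟ y | y Fin.≟ x
  ... | yes _ | yes _ = refl
  ... | yes p | no ne = contradiction (≡-sym p) ne
  ... | no ne | yes p = contradiction (≡-sym p) ne
  ... | no _  | no _  = refl

  closed-distinct : ∀ {n} (Γ : Graph n) x y → x ≢ y → closed Γ x y ≡ adj Γ x y
  closed-distinct Γ x y ne with adj Γ x y | x Fin.≟ y
  ... | true  | _     = refl
  ... | false | yes p = contradiction p ne
  ... | false | no _  = refl

  loopMatrix : ∀ {n} → Graph n → Matrix n
  loopMatrix Γ x y = b2ℤ (closed Γ x y)

  loopMatrix-adj : ∀ {n} (Γ : Graph n) x y → loopMatrix Γ x y ≡ adjMatrix Γ x y + δ x y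
  loopMatrix-adj Γ x y with x Fin.≟ y in eq
  ... | yes refl rewrite irrefl Γ x | δ-diag x = refl
  ... | no ne rewrite δ-off x y ne with adj Γ x y
  ...   | true  = refl
  ...   | false = refl

  loop-charPoly : ∀ {n} (Γ : Graph n) x → charPoly (loopMatrix Γ) x ≡ charPoly (adjMatrix Γ) (x - + 1)
  loop-charPoly Γ x = det-cong λ i j → trans (cong (λ z → x * δ i j - z) (loopMatrix-adj Γ i j))
    (rearr x (δ i j) (adjMatrix Γ i j))
    where
    rearr : ∀ x d a → x * d - (a + d) ≡ (x - + 1) * d - a
    rearr = solve-∀

  loop-rowSum : ∀ {n} (Γ : Graph n) x → sumℤ (loopMatrix Γ x) ≡ + degree Γ x + + 1
  loop-rowSum Γ x = begin
    sumℤ (loopMatrix Γ x)                          ≡⟨ sum-cong (loopMatrix-adj Γ x) ⟩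
    sumℤ (λ y → adjMatrix Γ x y + δ x y)           ≡⟨ sum-+ (adjMatrix Γ x) (δ x) ⟩
    sumℤ (adjMatrix Γ x) + sumℤ (δ x)              ≡⟨ cong₂ _+_
      (trans (sum-cong (λ y → b2ℤ-b2ℕ (adj Γ x y))) (≡-sym (sumℕ-sumℤ (λ y → b2ℕ (adj Γ x y)))))
      (trans (sum-cong (λ y → ≡-sym (ℤ.*-identityʳ (δ x y)))) (sum-δ x (λ _ → + 1))) ⟩
    + degree Γ x + + 1                             ∎

  -- If `closed Γ x y` is false, neither endpoint lies in the closed neighbourhood of the other, so
  -- the loops create no new common neighbour.
  loop-codegree : ∀ {n} (Γ : Graph n) x y → closed Γ x y ≡ false →
    sumℤ (λ z → loopMatrix Γ x z * loopMatrix Γ z y) ≡ + commonNbrs Γ x y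
  loop-codegree Γ x y h = begin
    sumℤ (λ z → loopMatrix Γ x z * loopMatrix Γ z y)
      ≡⟨ sum-cong (λ z → trans (≡-sym (b2ℤ-∧ (closed Γ x z) (closed Γ z y)))
           (trans (cong b2ℤ (pointwise z)) (b2ℤ-b2ℕ (adj Γ x z ∧ adj Γ y z)))) ⟩
    sumℤ (λ z → + b2ℕ (adj Γ x z ∧ adj Γ y z))     ≡⟨ ≡-sym (sumℕ-sumℤ (λ z → b2ℕ (adj Γ x z ∧ adj Γ y z))) ⟩
    + commonNbrs Γ x y                             ∎
    where
    false-∧ : ∀ a → a ∧ false ≡ false
    false-∧ true  = refl
    false-∧ false = refl
    pointwise : ∀ z → closed Γ x z ∧ closed Γ z y ≡ adj Γ x z ∧ adj Γ y z
    pointwise z = go (x Fin.≟ z) (z Fin.≟ y)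
      where
      go : Dec (x ≡ z) → Dec (z ≡ y) → closed Γ x z ∧ closed Γ z y ≡ adj Γ x z ∧ adj Γ y z
      go (yes refl) _ = trans (cong (closed Γ x x ∧_) h)
        (trans (false-∧ (closed Γ x x)) (cong (_∧ adj Γ y x) (≡-sym (irrefl Γ x))))
      go (no _) (yes refl) = trans (cong (_∧ closed Γ y y) h)
        (≡-sym (trans (cong (adj Γ x y ∧_) (irrefl Γ y)) (false-∧ (adj Γ x y))))
      go (no x≢z) (no z≢y) = cong₂ _∧_ (closed-distinct Γ x z x≢z)
        (trans (closed-distinct Γ z y z≢y) (sym Γ z y))

  -- Spectra with multiplicities

  roots : List (ℤ × ℕ) → List ℤ
  roots []            = []
  roots ((θ , m) ∷ l) = replicate m θ ++ roots l

  rootProd-replicate : ∀ m θ l x → rootProd (replicate m θ ++ l) x ≡ (x - θ) ^ m * rootProd l x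
  rootProd-replicate zero    θ l x = ≡-sym (ℤ.*-identityˡ (rootProd l x))
  rootProd-replicate (suc m) θ l x = trans (cong ((x - θ) *_) (rootProd-replicate m θ l x))
    (≡-sym (ℤ.*-assoc (x - θ) ((x - θ) ^ m) (rootProd l x)))

  rootProd-roots : ∀ l x → rootProd (roots l) x ≡ prodSpec l x
  rootProd-roots []            x = refl
  rootProd-roots ((θ , m) ∷ l) x = trans (rootProd-replicate m θ (roots l) x)
    (cong ((x - θ) ^ m *_) (rootProd-roots l x))

  powerSum-replicate : ∀ r m θ l → powerSum r (replicate m θ ++ l) ≡ + m * θ ^ r + powerSum r l
  powerSum-replicate r zero    θ l = trans (≡-sym (ℤ.+-identityˡ (powerSum r l)))
    (cong (λ z → z + powerSum r l) (≡-sym (ℤ.*-zeroˡ (θ ^ r))))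
  powerSum-replicate r (suc m) θ l = trans (cong (λ z → θ ^ r + z) (powerSum-replicate r m θ l))
    (trans (≡-sym (ℤ.+-assoc (θ ^ r) (+ m * θ ^ r) (powerSum r l)))
      (cong (λ z → z + powerSum r l) (≡-sym (ℤ.suc-* (+ m) (θ ^ r)))))

  moment : ℕ → List (ℤ × ℕ) → ℤ
  moment r []            = + 0
  moment r ((θ , m) ∷ l) = + m * θ ^ r + moment r l

  powerSum-roots : ∀ r l → powerSum r (roots l) ≡ moment r l
  powerSum-roots r []            = refl
  powerSum-roots r ((θ , m) ∷ l) = trans (powerSum-replicate r m θ (roots l))
    (cong (λ z → + m * θ ^ r + z) (powerSum-roots r l))

  multiplicity : List (ℤ × ℕ) → ℕ
  multiplicity []            = 0
  multiplicity ((θ , m) ∷ l) = m ℕ.+ multiplicity l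

  length-roots : ∀ l → length (roots l) ≡ multiplicity l
  length-roots []            = refl
  length-roots ((θ , m) ∷ l) = trans (List.length-++ (replicate m θ))
    (cong₂ ℕ._+_ (List.length-replicate m) (length-roots l))

  loopSpectrum : ℕ → ℕ → List (ℤ × ℕ)
  loopSpectrum s t =
      (+ s * (+ 2 * + t + + 1) , 1)
    ∷ (+ s * + t , 2 ℕ.* t)
    ∷ (+ 0 , (s ℕ.∸ 1) ℕ.* ((t ℕ.+ 1) ℕ.^ 2))
    ∷ (- + s , t ℕ.^ 2)
    ∷ []

  loopSpectrum-shift : ∀ s t x → prodSpec (theSpectrum s t) (x - + 1) ≡ prodSpec (loopSpectrum s t) x
  loopSpectrum-shift s t x = cong₂ _*_ (cong (_^ 1) first) (cong₂ _*_ (cong (_^ (2 ℕ.* t)) second)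
    (cong₂ _*_ (cong (_^ ((s ℕ.∸ 1) ℕ.* ((t ℕ.+ 1) ℕ.^ 2))) (third x))
      (cong₂ _*_ (cong (_^ (t ℕ.^ 2)) (fourth x (+ s))) (refl {x = + 1}))))
    where
    shift : ∀ x a → x - + 1 - (a - + 1) ≡ x - a
    shift = solve-∀
    first : x - + 1 - (+ (s ℕ.* (2 ℕ.* t ℕ.+ 1)) - + 1) ≡ x - + s * (+ 2 * + t + + 1)
    first = trans (shift x _) (cong (λ z → x - z) (trans (ℤ.pos-* s (2 ℕ.* t ℕ.+ 1))
      (cong (+ s *_) (trans (ℤ.pos-+ (2 ℕ.* t) 1) (cong (λ z → z + + 1) (ℤ.pos-* 2 t))))))
    second : x - + 1 - (+ (s ℕ.* t) - + 1) ≡ x - + s * + t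
    second = trans (shift x _) (cong (λ z → x - z) (ℤ.pos-* s t))
    third : ∀ x → x - + 1 - - + 1 ≡ x - + 0
    third = solve-∀
    fourth : ∀ x s → x - + 1 - (- s - + 1) ≡ x - - s
    fourth = solve-∀

  loopSpectrum-length : ∀ s t → 1 ℕ.≤ s →
    + length (roots (loopSpectrum s t)) ≡ + s * ((+ t + + 1) * (+ t + + 1))
  loopSpectrum-length (suc s) t _ = begin
    + length (roots (loopSpectrum (suc s) t))
      ≡⟨ cong +_ (length-roots (loopSpectrum (suc s) t)) ⟩
    + (1 ℕ.+ (2 ℕ.* t ℕ.+ (s ℕ.* ((t ℕ.+ 1) ℕ.^ 2) ℕ.+ (t ℕ.^ 2 ℕ.+ 0))))
      ≡⟨ cong +_ (identity s t) ⟩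
    + (suc s ℕ.* ((t ℕ.+ 1) ℕ.* (t ℕ.+ 1)))
      ≡⟨ trans (ℤ.pos-* (suc s) _) (cong (+ suc s *_) (ℤ.pos-* (t ℕ.+ 1) (t ℕ.+ 1))) ⟩
    + suc s * ((+ t + + 1) * (+ t + + 1)) ∎
    where
    identity : ∀ s t → 1 ℕ.+ (2 ℕ.* t ℕ.+ (s ℕ.* ((t ℕ.+ 1) ℕ.* ((t ℕ.+ 1) ℕ.* 1)) ℕ.+ (t ℕ.* (t ℕ.* 1) ℕ.+ 0))) ≡
      (1 ℕ.+ s) ℕ.* ((t ℕ.+ 1) ℕ.* (t ℕ.+ 1))
    identity = ℕSolver.solve-∀

  loopSpectrum-powerSum : ∀ s t r → powerSum (suc r) (roots (loopSpectrum s t)) ≡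
    (+ s * (+ 2 * + t + + 1)) ^ suc r + + 2 * + t * (+ s * + t) ^ suc r + + t * + t * (- + s) ^ suc r
  loopSpectrum-powerSum s t r = begin
    powerSum (suc r) (roots (loopSpectrum s t))
      ≡⟨ powerSum-roots (suc r) (loopSpectrum s t) ⟩
    + 1 * k ^ suc r + (+ (2 ℕ.* t) * u ^ suc r + (+ m * (+ 0) ^ suc r + (+ (t ℕ.^ 2) * v ^ suc r + + 0)))
      ≡⟨ cong (λ z → + 1 * k ^ suc r + z) (cong₂ _+_ (cong (_* u ^ suc r) (ℤ.pos-* 2 t))
           (cong₂ _+_ (trans (cong (+ m *_) (ℤ.*-zeroˡ ((+ 0) ^ r))) (ℤ.*-zeroʳ (+ m)))
             (cong (λ z → z * v ^ suc r + + 0) square))) ⟩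
    + 1 * k ^ suc r + (+ 2 * + t * u ^ suc r + (+ 0 + (+ t * + t * v ^ suc r + + 0)))
      ≡⟨ collect (k ^ suc r) (+ 2 * + t * u ^ suc r) (+ t * + t * v ^ suc r) ⟩
    k ^ suc r + + 2 * + t * u ^ suc r + + t * + t * v ^ suc r ∎
    where
    k = + s * (+ 2 * + t + + 1)
    u = + s * + t
    v = - + s
    m = (s ℕ.∸ 1) ℕ.* ((t ℕ.+ 1) ℕ.^ 2)
    square : + (t ℕ.^ 2) ≡ + t * + t
    square = trans (cong (λ z → + (t ℕ.* z)) (ℕ.*-identityʳ t)) (ℤ.pos-* t t)
    collect : ∀ a b c → + 1 * a + (b + (+ 0 + (c + + 0))) ≡ a + b + c
    collect = solve-∀

  -- N[x] is the row of nb at x.  The numbers |N[x] ∩ N[z]| - s(t+1), for z in N[x], are collected in f x z,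
  -- which is s²t times the (x , z) entry of the projection onto the column space of I + A.
  record CountingData (n : ℕ) (S T : ℤ) : Set where
    field
      nb          : Fin n → Fin n → Bool
      nb-refl     : ∀ x → nb x x ≡ true
      nb-sym      : ∀ x y → nb x y ≡ nb y x
      f           : Fin n → Fin n → ℤ
      order       : + n ≡ S * ((T + + 1) * (T + + 1))
      degree-nb   : ∀ x → sumℤ (λ z → b2ℤ (nb x z)) ≡ S * (+ 2 * T + + 1)
      f-square    : ∀ x → sumℤ (λ z → f x z * f x z) ≡ S * S * S * T * T
      f-flat      : ∀ x y → sumℤ (λ z → b2ℤ (nb y z) * f x z) ≡ S * S * T * b2ℤ (nb y x)
      f-nonadj    : ∀ x z → nb x z ≡ false → f x z ≡ + 0
      codeg-adj   : ∀ x z → nb x z ≡ true → sumℤ (λ w → b2ℤ (nb x w ∧ nb z w)) ≡ S * (T + + 1) + f x z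
      codeg-nonadj : ∀ x z → nb x z ≡ false → sumℤ (λ w → b2ℤ (nb x w ∧ nb z w)) ≡ + 2 * S

  -- From the spectrum to the counting data

  module FromSpectrum (s t : ℕ) (1≤s : 1 ℕ.≤ s) (1≤t : 1 ℕ.≤ t) {n} (Γ : Graph n)
    (Γ-coedge : CoEdgeRegular Γ) (spectrum : HasSpectrum Γ (theSpectrum s t)) where

    S T : ℤ
    S = + s
    T = + t

    B : Matrix n
    B = loopMatrix Γ

    B-sym : ∀ x y → B x y ≡ B y x
    B-sym x y = cong b2ℤ (closed-sym Γ x y)

    open Newton B (roots (loopSpectrum s t)) (λ x → trans (loop-charPoly Γ x) (trans (spectrum (x - + 1))
      (trans (loopSpectrum-shift s t x) (≡-sym (rootProd-roots (loopSpectrum s t) x)))))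
      using (size; trace-power)

    order : + n ≡ S * ((T + + 1) * (T + + 1))
    order = trans (cong +_ size) (loopSpectrum-length s t 1≤s)

    S≢0 : S ≢ + 0
    S≢0 e = ℕ.<⇒≢ 1≤s (≡-sym (ℤ.+-injective e))

    T≢0 : T ≢ + 0
    T≢0 e = ℕ.<⇒≢ 1≤t (≡-sym (ℤ.+-injective e))

    nonzero-* : ∀ {a b} → a ≢ + 0 → b ≢ + 0 → a * b ≢ + 0
    nonzero-* {a} p q e with ℤ.i*j≡0⇒i≡0∨j≡0 a e
    ... | inj₁ e′ = p e′
    ... | inj₂ e′ = q e′

    n≢0 : + n ≢ + 0
    n≢0 e = nonzero-* S≢0 (nonzero-* T+1≢0 T+1≢0) (trans (≡-sym order) e)
      where
      T+1≢0 : T + + 1 ≢ + 0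
      T+1≢0 e = ℕ.m+1+n≢0 t (ℤ.+-injective e)

    open Cubic B B-sym (λ x y → b2ℤ-idem (closed Γ x y)) (+ proj₁ (proj₁ Γ-coedge) + + 1) S T
      (λ x → trans (loop-rowSum Γ x) (cong (λ d → + d + + 1) (proj₂ (proj₁ Γ-coedge) x)))
      n≢0 order (λ r → trans (trace-power (suc r)) (loopSpectrum-powerSum s t r))
      using (K; codeg; cubic; rowSums; power-two)

    B-rowSum : ∀ x → sumℤ (B x) ≡ K
    B-rowSum x = trans (sum-cong (λ z → ≡-sym (^^-one B x z))) (trans (rowSums 1 x) (ℤ.*-identityʳ K))

    codeg-sym : ∀ x y → codeg x y ≡ codeg y x
    codeg-sym x y = sum-cong λ z → trans (cong₂ _*_ (B-sym x z) (B-sym z y)) (ℤ.*-comm (B z x) (B y z))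

    codeg-count : ∀ x y → sumℤ (λ z → b2ℤ (closed Γ x z ∧ closed Γ y z)) ≡ codeg x y
    codeg-count x y = sum-cong λ z → trans (b2ℤ-∧ (closed Γ x z) (closed Γ y z)) (cong (B x z *_) (B-sym y z))

    μ : ℤ
    μ = + proj₁ (proj₂ Γ-coedge)

    codeg-μ : ∀ x y → closed Γ x y ≡ false → codeg x y ≡ μ
    codeg-μ x y h = trans (loop-codegree Γ x y h) (cong +_ (proj₂ (proj₂ Γ-coedge) x y x≢y adj≡false))
      where
      x≢y : x ≢ y
      x≢y refl = contradiction (trans (≡-sym (closed-refl Γ x)) h) λ ()
      adj≡false : adj Γ x y ≡ false
      adj≡false = trans (≡-sym (closed-distinct Γ x y x≢y)) h

    codeg-rowSum : ∀ x → sumℤ (codeg x) ≡ K * K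
    codeg-rowSum x = trans (sum-cong (λ z → ≡-sym (power-two x z)))
      (trans (rowSums 2 x) (cong (K *_) (ℤ.*-identityʳ K)))

    B-diag : ∀ x → B x x ≡ + 1
    B-diag x = cong b2ℤ (closed-refl Γ x)

    codeg-diag : ∀ x → codeg x x ≡ K
    codeg-diag x = trans (sum-cong (λ z → trans (cong (B x z *_) (B-sym z x)) (b2ℤ-idem (closed Γ x z)))) (B-rowSum x)

    -- Count the walks of length two from x by their end point.
    μ-value : Fin n → μ ≡ + 2 * S
    μ-value x = ℤ.i-j≡0⇒i≡j μ (+ 2 * S) (cancel (trans (identity S T μ) (ℤ.i≡j⇒i-j≡0 (≡-sym walks))))
      where
      split : ∀ z → codeg x z ≡ B x z * codeg z x + μ * + 1 + - μ * B x z
      split z with closed Γ x z in eq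
      ... | true  = trans (codeg-sym x z) (one μ (codeg z x))
        where
        one : ∀ μ c → c ≡ + 1 * c + μ * + 1 + - μ * + 1
        one = solve-∀
      ... | false = trans (codeg-μ x z eq) (none μ (codeg z x))
        where
        none : ∀ μ c → μ ≡ + 0 * c + μ * + 1 + - μ * + 0
        none = solve-∀
      -- The factor ST² is the number of vertices outside the closed neighbourhood of `x`, each of
      -- which is the end of μ walks. It can be cancelled since S and T are nonzero.
      identity : ∀ S T μ → S * (T * T) * (μ - + 2 * S) ≡
        (S * (T - + 1) * (S * (+ 2 * T + + 1)) + S * S * T * + 1 + + 2 * S * S * (+ 2 * T + + 1) + μ * (S * ((T + + 1) * (T + + 1))) + - μ * (S * (+ 2 * T + + 1)))
        - S * (+ 2 * T + + 1) * (S * (+ 2 * T + + 1))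
      identity = solve-∀
      cancel : ∀ {d} → S * (T * T) * d ≡ + 0 → d ≡ + 0
      cancel {d} e with ℤ.i*j≡0⇒i≡0∨j≡0 (S * (T * T)) e
      ... | inj₁ e′ = contradiction e′ (nonzero-* S≢0 (nonzero-* T≢0 T≢0))
      ... | inj₂ e′ = e′
      walks : K * K ≡ S * (T - + 1) * K + S * S * T * + 1 + + 2 * S * S * (+ 2 * T + + 1)
        + μ * (S * ((T + + 1) * (T + + 1))) + - μ * K
      walks = begin
        K * K
          ≡⟨ ≡-sym (codeg-rowSum x) ⟩
        sumℤ (codeg x)
          ≡⟨ sum-cong split ⟩
        sumℤ (λ z → B x z * codeg z x + μ * + 1 + - μ * B x z)
          ≡⟨ sum-lin₃ μ (- μ) (λ z → B x z * codeg z x) (λ _ → + 1) (B x) ⟩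
        sumℤ (λ z → B x z * codeg z x) + μ * sumℤ {n} (λ _ → + 1) + - μ * sumℤ (B x)
          ≡⟨ cong₂ (λ p q → p + - μ * q) (cong₂ (λ p q → p + μ * q)
               (trans (cubic x x) (cong₂ (λ p q → S * (T - + 1) * p + S * S * T * q + + 2 * S * S * (+ 2 * T + + 1))
                 (codeg-diag x) (B-diag x)))
               (trans (sum-const n (+ 1)) (trans (ℤ.*-identityʳ (+ n)) order))) (B-rowSum x) ⟩
        S * (T - + 1) * K + S * S * T * + 1 + + 2 * S * S * (+ 2 * T + + 1)
          + μ * (S * ((T + + 1) * (T + + 1))) + - μ * K ∎

    -- The cubic relation divided by `B`: the rows of `B` sum to `K` and 2S · K = 2S²(2T + 1), so
    -- the constant term disappears on multiplying by `B`. As 2S is also the value of μ, `F`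
    -- vanishes at nonadjacent pairs.
    F : Matrix n
    F x z = codeg x z + - (S * (T - + 1)) * B x z + - (+ 2 * S) * + 1

    F-sym : ∀ x z → F x z ≡ F z x
    F-sym x z = cong₂ (λ p q → p + - (S * (T - + 1)) * q + - (+ 2 * S) * + 1) (codeg-sym x z) (B-sym x z)

    F-flat : ∀ x y → sumℤ (λ z → B y z * F x z) ≡ S * S * T * B y x
    F-flat x y = begin
      sumℤ (λ z → B y z * F x z)
        ≡⟨ sum-cong (λ z → trans (cong (B y z *_) (F-sym x z))
             (distrib (B y z) (codeg z x) (B z x) (- (S * (T - + 1))) (- (+ 2 * S)))) ⟩
      sumℤ (λ z → B y z * codeg z x + - (S * (T - + 1)) * (B y z * B z x) + - (+ 2 * S) * B y z)
        ≡⟨ sum-lin₃ (- (S * (T - + 1))) (- (+ 2 * S)) (λ z → B y z * codeg z x) (λ z → B y z * B z x) (B y) ⟩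
      sumℤ (λ z → B y z * codeg z x) + - (S * (T - + 1)) * codeg y x + - (+ 2 * S) * sumℤ (B y)
        ≡⟨ cong₂ (λ p q → p + - (S * (T - + 1)) * codeg y x + - (+ 2 * S) * q) (cubic y x) (B-rowSum y) ⟩
      S * (T - + 1) * codeg y x + S * S * T * B y x + + 2 * S * S * (+ 2 * T + + 1) + - (S * (T - + 1)) * codeg y x + - (+ 2 * S) * K
        ≡⟨ identity S T (codeg y x) (B y x) ⟩
      S * S * T * B y x ∎
      where
      distrib : ∀ b c d p q → b * (c + p * d + q * + 1) ≡ b * c + p * (b * d) + q * b
      distrib = solve-∀
      identity : ∀ S T c b →
        S * (T - + 1) * c + S * S * T * b + + 2 * S * S * (+ 2 * T + + 1) + - (S * (T - + 1)) * c + - (+ 2 * S) * (S * (+ 2 * T + + 1))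
        ≡ S * S * T * b
      identity = solve-∀

    F-rowSum : ∀ x → sumℤ (F x) ≡ S * S * T
    F-rowSum x = begin
      sumℤ (F x)
        ≡⟨ sum-lin₃ (- (S * (T - + 1))) (- (+ 2 * S)) (codeg x) (B x) (λ _ → + 1) ⟩
      sumℤ (codeg x) + - (S * (T - + 1)) * sumℤ (B x) + - (+ 2 * S) * sumℤ {n} (λ _ → + 1)
        ≡⟨ cong₂ (λ p q → p + - (+ 2 * S) * q) (cong₂ (λ p q → p + - (S * (T - + 1)) * q) (codeg-rowSum x) (B-rowSum x))
             (trans (sum-const n (+ 1)) (trans (ℤ.*-identityʳ (+ n)) order)) ⟩
      K * K + - (S * (T - + 1)) * K + - (+ 2 * S) * (S * ((T + + 1) * (T + + 1)))
        ≡⟨ identity S T ⟩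
      S * S * T ∎
      where
      identity : ∀ S T → S * (+ 2 * T + + 1) * (S * (+ 2 * T + + 1)) + - (S * (T - + 1)) * (S * (+ 2 * T + + 1))
        + - (+ 2 * S) * (S * ((T + + 1) * (T + + 1))) ≡ S * S * T
      identity = solve-∀

    F-square : ∀ x → sumℤ (λ z → F x z * F x z) ≡ S * S * S * T * T
    F-square x = begin
      sumℤ (λ z → F x z * F x z)
        ≡⟨ sum-cong (λ z → distrib (codeg x z) (B x z) (- (S * (T - + 1))) (- (+ 2 * S)) (F x z)) ⟩
      sumℤ (λ z → codeg x z * F x z + - (S * (T - + 1)) * (B x z * F x z) + - (+ 2 * S) * F x z)
        ≡⟨ sum-lin₃ (- (S * (T - + 1))) (- (+ 2 * S)) (λ z → codeg x z * F x z) (λ z → B x z * F x z) (F x) ⟩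
      sumℤ (λ z → codeg x z * F x z) + - (S * (T - + 1)) * sumℤ (λ z → B x z * F x z) + - (+ 2 * S) * sumℤ (F x)
        ≡⟨ cong₂ (λ p q → p + - (+ 2 * S) * q) (cong₂ (λ p q → p + - (S * (T - + 1)) * q) codegF
             (trans (F-flat x x) (cong (S * S * T *_) (B-diag x)))) (F-rowSum x) ⟩
      S * S * T * K + - (S * (T - + 1)) * (S * S * T * + 1) + - (+ 2 * S) * (S * S * T)
        ≡⟨ identity S T ⟩
      S * S * S * T * T ∎
      where
      distrib : ∀ c b p q f → (c + p * b + q * + 1) * f ≡ c * f + p * (b * f) + q * f
      distrib = solve-∀
      identity : ∀ S T → S * S * T * (S * (+ 2 * T + + 1)) + - (S * (T - + 1)) * (S * S * T * + 1) + - (+ 2 * S) * (S * S * T)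
        ≡ S * S * S * T * T
      identity = solve-∀
      codegF : sumℤ (λ z → codeg x z * F x z) ≡ S * S * T * K
      codegF = begin
        sumℤ (λ z → sumℤ (λ w → B x w * B w z) * F x z)
          ≡⟨ sum-cong (λ z → ≡-sym (sum-*ʳ (F x z) (λ w → B x w * B w z))) ⟩
        sumℤ (λ z → sumℤ (λ w → B x w * B w z * F x z))
          ≡⟨ sum-swap (λ z w → B x w * B w z * F x z) ⟩
        sumℤ (λ w → sumℤ (λ z → B x w * B w z * F x z))
          ≡⟨ sum-cong (λ w → trans (sum-cong (λ z → ℤ.*-assoc (B x w) (B w z) (F x z)))
               (trans (sum-*ˡ (B x w) (λ z → B w z * F x z)) (cong (B x w *_) (F-flat x w)))) ⟩
        sumℤ (λ w → B x w * (S * S * T * B w x))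
          ≡⟨ sum-cong (λ w → swap (B x w) (S * S * T) (B w x)) ⟩
        sumℤ (λ w → S * S * T * (B x w * B w x))
          ≡⟨ sum-*ˡ (S * S * T) (λ w → B x w * B w x) ⟩
        S * S * T * codeg x x
          ≡⟨ cong (S * S * T *_) (codeg-diag x) ⟩
        S * S * T * K ∎
        where
        swap : ∀ a b c → a * (b * c) ≡ b * (a * c)
        swap = solve-∀

    countingData : CountingData n S T
    countingData = record
      { nb           = closed Γ
      ; nb-refl      = closed-refl Γ
      ; nb-sym       = closed-sym Γ
      ; f            = F
      ; order        = order
      ; degree-nb    = B-rowSum
      ; f-square     = F-square
      ; f-flat       = F-flat
      ; f-nonadj     = λ x z h → trans (cong₂ (λ p q → p + - (S * (T - + 1)) * b2ℤ q + - (+ 2 * S) * + 1)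
                         (trans (codeg-μ x z h) (μ-value x)) h) (nonadj S T)
      ; codeg-adj    = λ x z h → trans (codeg-count x z) (trans (adjacent S T (codeg x z))
                         (cong (λ q → S * (T + + 1) + (codeg x z + - (S * (T - + 1)) * b2ℤ q + - (+ 2 * S) * + 1)) (≡-sym h)))
      ; codeg-nonadj = λ x z h → trans (codeg-count x z) (trans (codeg-μ x z h) (μ-value x))
      }
      where
      nonadj : ∀ S T → + 2 * S + - (S * (T - + 1)) * + 0 + - (+ 2 * S) * + 1 ≡ + 0
      nonadj = solve-∀
      adjacent : ∀ S T c → c ≡ S * (T + + 1) + (c + - (S * (T - + 1)) * + 1 + - (+ 2 * S) * + 1)
      adjacent = solve-∀

  -- Certificates for integer inequalities: a ≤ b holds if b - a is, as a polynomial, a combination with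
  -- nonnegative coefficients of quantities known to be nonnegative; hypotheses are contradictory if such a
  -- combination is a negative constant.

  0≤diff : ∀ {a b} → a ≤ b → + 0 ≤ b - a
  0≤diff = ℤ.i≤j⇒0≤j-i

  by-diff : ∀ {a b e} → + 0 ≤ e → b - a ≡ e → a ≤ b
  by-diff {a} {b} p e = ℤ.0≤i-j⇒j≤i (subst (+ 0 ≤_) (≡-sym e) p)

  infixl 6 _⊕_
  infixl 7 _⊗_

  _⊕_ : ∀ {a b} → + 0 ≤ a → + 0 ≤ b → + 0 ≤ a + b
  _⊕_ = ℤ.+-mono-≤

  _⊗_ : ∀ {a b} → + 0 ≤ a → + 0 ≤ b → + 0 ≤ a * b
  _⊗_ {+ a} {+ b} _ _ = ℤ.≤-trans (ℤ.+≤+ ℕ.z≤n) (ℤ.≤-reflexive (ℤ.pos-* a b))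

  absurd : ∀ {e k} → + 0 ≤ e → e ≡ ℤ.-[1+ k ] → ⊥
  absurd () refl

  nat : ∀ k → + 0 ≤ + k
  nat k = ℤ.+≤+ ℕ.z≤n

  ≰⇒+1≤ : ∀ {a b} → ¬ (a ≤ b) → b + + 1 ≤ a
  ≰⇒+1≤ {a} {b} h = ℤ.≤-trans (ℤ.≤-reflexive (ℤ.+-comm b (+ 1))) (ℤ.i<j⇒suc[i]≤j (ℤ.≰⇒> h))

  by-refuting : ∀ {a b} → (b + + 1 ≤ a → ⊥) → a ≤ b
  by-refuting {a} {b} h with a ℤ.≤? b
  ... | yes p = p
  ... | no  p = ⊥-elim (h (≰⇒+1≤ p))

  cancel-≤ : ∀ {c a b} → + 1 ≤ c → c * a ≤ c * b → a ≤ b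
  cancel-≤ {c} {a} {b} 1≤c h = by-refuting λ k →
    absurd (0≤diff h ⊕ (nat 0 ⊕ 0≤diff 1≤c) ⊗ 0≤diff k ⊕ 0≤diff k ⊕ 0≤diff 1≤c) (identity a b c)
    where
    identity : ∀ a b c → c * b - c * a + (+ 0 + (c - + 1)) * (a - (b + + 1)) + (a - (b + + 1)) + (c - + 1) ≡ - + 1
    identity = solve-∀

  square-mono : ∀ {a b} → + 0 ≤ a → a ≤ b → a * a ≤ b * b
  square-mono {a} {b} p h = by-diff (0≤diff h ⊗ 0≤diff h ⊕ nat 2 ⊗ p ⊗ 0≤diff h) (identity a b)
    where
    identity : ∀ a b → b * b - a * a ≡ (b - a) * (b - a) + + 2 * a * (b - a)
    identity = solve-∀

  square-mono-neg : ∀ {a b} → + 0 ≤ a → b ≤ - a → a * a ≤ b * b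
  square-mono-neg {a} {b} p h = subst (a * a ≤_) (identity b)
    (square-mono p (subst (_≤ - b) (ℤ.neg-involutive a) (ℤ.neg-mono-≤ h)))
    where
    identity : ∀ b → - b * - b ≡ b * b
    identity = solve-∀

  -- Subsets of Fin n and their cardinalities

  Subset : ℕ → Set
  Subset n = Fin n → Bool

  infix 4 _∈_ _∉_ _⊆_
  infixl 6 _∖_
  infixl 7 _∩_
  infixl 6 _∪_

  _∈_ _∉_ : ∀ {n} → Fin n → Subset n → Set
  z ∈ P = P z ≡ true
  z ∉ P = P z ≡ false

  _⊆_ : ∀ {n} → Subset n → Subset n → Set
  P ⊆ Q = ∀ z → z ∈ P → z ∈ Q

  _∩_ _∪_ _∖_ : ∀ {n} → Subset n → Subset n → Subset n
  (P ∩ Q) z = P z ∧ Q z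
  (P ∪ Q) z = P z ∨ Q z
  (P ∖ Q) z = P z ∧ not (Q z)

  # : ∀ {n} → Subset n → ℤ
  # P = sumℤ (λ z → b2ℤ (P z))

  _∈?_ : ∀ {n} (z : Fin n) (P : Subset n) → z ∈ P ⊎ z ∉ P
  z ∈? P with P z
  ... | true  = inj₁ refl
  ... | false = inj₂ refl

  clash : ∀ {b} {A : Set} → b ≡ true → b ≡ false → A
  clash refl ()

  ∧-intro : ∀ {a b} → a ≡ true → b ≡ true → a ∧ b ≡ true
  ∧-intro refl refl = refl

  ∧-elimˡ : ∀ {a b} → a ∧ b ≡ true → a ≡ true
  ∧-elimˡ {true} _ = refl

  ∧-elimʳ : ∀ {a b} → a ∧ b ≡ true → b ≡ true
  ∧-elimʳ {true} h = h

  not-intro : ∀ {a} → a ≡ false → not a ≡ true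
  not-intro refl = refl

  not-elim : ∀ {a} → not a ≡ true → a ≡ false
  not-elim {false} _ = refl

  not-true : ∀ {a} → ¬ (a ≡ true) → a ≡ false
  not-true {true}  h = ⊥-elim (h refl)
  not-true {false} h = refl

  ∨-introˡ : ∀ {a b} → a ≡ true → a ∨ b ≡ true
  ∨-introˡ refl = refl

  ∨-introʳ : ∀ {a b} → b ≡ true → a ∨ b ≡ true
  ∨-introʳ {true}  _ = refl
  ∨-introʳ {false} h = h

  ∨-elim : ∀ {a b} → a ∨ b ≡ true → a ≡ true ⊎ b ≡ true
  ∨-elim {true}  _ = inj₁ refl
  ∨-elim {false} h = inj₂ h

  ∖-intro : ∀ {n} {P Q : Subset n} z → z ∈ P → z ∉ Q → z ∈ P ∖ Q
  ∖-intro z p q = ∧-intro p (not-intro q)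

  does-intro : ∀ {A : Set} (d : Dec A) → A → does d ≡ true
  does-intro (yes _) _ = refl
  does-intro (no ¬a) a = contradiction a ¬a

  does-elim : ∀ {A : Set} (d : Dec A) → does d ≡ true → A
  does-elim (yes a) _ = a

  does-refute : ∀ {A : Set} (d : Dec A) → does d ≡ false → ¬ A
  does-refute (no ¬a) _ = ¬a

  decide-≤ : ∀ {a b} {_ : True (a ℤ.≤? b)} → a ≤ b
  decide-≤ {_} {_} {w} = toWitness w

  b2ℤ-nonneg : ∀ a → + 0 ≤ b2ℤ a
  b2ℤ-nonneg true  = nat 1
  b2ℤ-nonneg false = nat 0

  b2ℤ-mono : ∀ {a b} → (a ≡ true → b ≡ true) → b2ℤ a ≤ b2ℤ b
  b2ℤ-mono {true}  {b} h rewrite h refl = ℤ.≤-refl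
  b2ℤ-mono {false} {b} h = b2ℤ-nonneg b

  #-nonneg : ∀ {n} (P : Subset n) → + 0 ≤ # P
  #-nonneg P = sum-nonneg (λ z → b2ℤ-nonneg (P z))

  #-mono : ∀ {n} {P Q : Subset n} → P ⊆ Q → # P ≤ # Q
  #-mono h = sum-mono (λ z → b2ℤ-mono (h z))

  #-cover₂ : ∀ {n} {P : Subset n} (Q R : Subset n) → (∀ z → z ∈ P → z ∈ Q ⊎ z ∈ R) → # P ≤ # Q + # R
  #-cover₂ {P = P} Q R h = ℤ.≤-trans (sum-mono pointwise)
    (ℤ.≤-reflexive (sum-+ (λ z → b2ℤ (Q z)) (λ z → b2ℤ (R z))))
    where
    pointwise : ∀ z → b2ℤ (P z) ≤ b2ℤ (Q z) + b2ℤ (R z)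
    pointwise z with z ∈? P
    ... | inj₂ z∉P rewrite z∉P = b2ℤ-nonneg (Q z) ⊕ b2ℤ-nonneg (R z)
    ... | inj₁ z∈P with h z z∈P
    ...   | inj₁ z∈Q rewrite z∈P | z∈Q = ℤ.+-monoʳ-≤ (+ 1) (b2ℤ-nonneg (R z))
    ...   | inj₂ z∈R rewrite z∈P | z∈R = ℤ.+-monoˡ-≤ (+ 1) (b2ℤ-nonneg (Q z))

  #-cover₃ : ∀ {n} {P : Subset n} (Q R U : Subset n) → (∀ z → z ∈ P → z ∈ Q ⊎ z ∈ R ⊎ z ∈ U) → # P ≤ # Q + # R + # U
  #-cover₃ {P = P} Q R U h = ℤ.≤-trans
    (#-cover₂ (Q ∪ R) U cover)
    (ℤ.+-monoˡ-≤ (# U) (#-cover₂ Q R (λ z → ∨-elim)))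
    where
    cover : ∀ z → z ∈ P → z ∈ Q ∪ R ⊎ z ∈ U
    cover z z∈P with h z z∈P
    ... | inj₁ q        = inj₁ (∨-introˡ q)
    ... | inj₂ (inj₁ r) = inj₁ (∨-introʳ r)
    ... | inj₂ (inj₂ u) = inj₂ u

  #-weight : ∀ {n} (P : Subset n) c {g : Fin n → ℤ} → (∀ z → + 0 ≤ g z) → (∀ z → z ∈ P → c ≤ g z) →
    c * # P ≤ sumℤ g
  #-weight P c {g} nonneg h = ℤ.≤-trans (ℤ.≤-reflexive (≡-sym (sum-*ˡ c (λ z → b2ℤ (P z))))) (sum-mono pointwise)
    where
    pointwise : ∀ z → c * b2ℤ (P z) ≤ g z
    pointwise z with z ∈? P
    ... | inj₁ z∈P rewrite z∈P = subst (_≤ g z) (≡-sym (ℤ.*-identityʳ c)) (h z z∈P)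
    ... | inj₂ z∉P rewrite z∉P = subst (_≤ g z) (≡-sym (ℤ.*-zeroʳ c)) (nonneg z)

  sum-point : ∀ {n} (z : Fin n) c → sumℤ (λ w → δ z w * c) ≡ c
  sum-point z c = sum-δ z (λ _ → c)

  #-strict : ∀ {n} {P Q : Subset n} → P ⊆ Q → ∀ z → z ∈ Q → z ∉ P → # P + + 1 ≤ # Q
  #-strict {P = P} {Q} h z z∈Q z∉P = ℤ.≤-trans
    (ℤ.≤-reflexive (trans (cong (λ y → # P + y) (≡-sym (sum-point z (+ 1)))) (≡-sym (sum-+ (λ w → b2ℤ (P w)) (λ w → δ z w * + 1)))))
    (sum-mono pointwise)
    where
    pointwise : ∀ w → b2ℤ (P w) + δ z w * + 1 ≤ b2ℤ (Q w)
    pointwise w with z Fin.≟ w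
    ... | yes refl rewrite z∉P | z∈Q | δ-diag z = ℤ.≤-refl
    ... | no ne rewrite δ-off z w ne = subst (_≤ b2ℤ (Q w)) (≡-sym (ℤ.+-identityʳ (b2ℤ (P w)))) (b2ℤ-mono (h w))

  #-member : ∀ {n} {P : Subset n} z → z ∈ P → + 1 ≤ # P
  #-member {n} {P} z z∈P = subst (_≤ # P) (cong (_+ + 1) (sum-zero {n} (λ _ → refl)))
    (#-strict {P = λ _ → false} (λ _ ()) z z∈P refl)

  #-full : ∀ {n} {P Q : Subset n} → P ⊆ Q → # Q ≤ # P → Q ⊆ P
  #-full {P = P} {Q} h le z z∈Q with z ∈? P
  ... | inj₁ z∈P = z∈P
  ... | inj₂ z∉P = ⊥-elim (absurd (0≤diff (ℤ.≤-trans (#-strict h z z∈Q z∉P) le)) (identity (# P)))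
    where
    identity : ∀ p → p - (p + + 1) ≡ - + 1
    identity = solve-∀

  -- The closed neighbourhood of a vertex

  sum-+₃ : ∀ {n} (f g h : Fin n → ℤ) → sumℤ (λ i → f i + g i + h i) ≡ sumℤ f + sumℤ g + sumℤ h
  sum-+₃ f g h = trans (sum-+ (λ i → f i + g i) h) (cong (λ y → y + sumℤ h) (sum-+ f g))

  sum-+₄ : ∀ {n} (f g h k : Fin n → ℤ) → sumℤ (λ i → f i + g i + h i + k i) ≡ sumℤ f + sumℤ g + sumℤ h + sumℤ k
  sum-+₄ f g h k = trans (sum-+ (λ i → f i + g i + h i) k) (cong (λ y → y + sumℤ k) (sum-+₃ f g h))

  -- Bonferroni's inequality for three subsets of a set, at a single point. Summed over all points
  -- it limits three large neighbourhoods whose pairwise intersections are small.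
  ∧-triple : ∀ n a b c → b2ℤ (n ∧ a) + b2ℤ (n ∧ b) + b2ℤ (n ∧ c) ≤ b2ℤ n + b2ℤ (a ∧ b) + b2ℤ (a ∧ c) + b2ℤ (b ∧ c)
  ∧-triple true  true  true  true  = decide-≤
  ∧-triple true  true  true  false = decide-≤
  ∧-triple true  true  false true  = decide-≤
  ∧-triple true  true  false false = decide-≤
  ∧-triple true  false true  true  = decide-≤
  ∧-triple true  false true  false = decide-≤
  ∧-triple true  false false true  = decide-≤
  ∧-triple true  false false false = decide-≤
  ∧-triple false a b c = b2ℤ-nonneg false ⊕ b2ℤ-nonneg (a ∧ b) ⊕ b2ℤ-nonneg (a ∧ c) ⊕ b2ℤ-nonneg (b ∧ c)

  module Neighbourhood {n} (S T : ℤ) (1≤S : + 1 ≤ S) (large : + 100 * S * S ≤ T) (𝒟 : CountingData n S T) where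
    open CountingData 𝒟

    0≤S-1 : + 0 ≤ S - + 1
    0≤S-1 = 0≤diff 1≤S

    0≤S : + 0 ≤ S
    0≤S = ℤ.≤-trans (nat 1) 1≤S

    0≤T-100S : + 0 ≤ T - + 100 * S
    0≤T-100S = subst (+ 0 ≤_) (identity S T) (0≤diff large ⊕ nat 100 ⊗ 0≤S ⊗ 0≤S-1)
      where
      identity : ∀ S T → T - + 100 * S * S + + 100 * S * (S - + 1) ≡ T - + 100 * S
      identity = solve-∀

    0≤T-100 : + 0 ≤ T - + 100
    0≤T-100 = subst (+ 0 ≤_) (identity S T) (0≤T-100S ⊕ nat 100 ⊗ 0≤S-1)
      where
      identity : ∀ S T → T - + 100 * S + + 100 * (S - + 1) ≡ T - + 100
      identity = solve-∀

    0≤T : + 0 ≤ T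
    0≤T = subst (+ 0 ≤_) (identity T) (0≤T-100 ⊕ nat 100)
      where
      identity : ∀ T → T - + 100 + + 100 ≡ T
      identity = solve-∀

    0≤ST : + 0 ≤ S * T
    0≤ST = 0≤S ⊗ 0≤T

    1≤ST : + 1 ≤ S * T
    1≤ST = by-diff (0≤S-1 ⊗ 0≤T ⊕ 0≤T-100 ⊕ nat 99) (identity S T)
      where
      identity : ∀ S T → S * T - + 1 ≡ (S - + 1) * T + (T - + 100) + + 99
      identity = solve-∀

    nb-flip : ∀ {x y b} → nb x y ≡ b → nb y x ≡ b
    nb-flip {x} {y} h = trans (nb-sym y x) h

    module At (x : Fin n) where

      N : Subset n
      N = nb x

      g : Fin n → ℤ
      g = f x

      triple-sum : ∀ z₁ z₂ z₃ → z₁ ∈ N → z₂ ∈ N → z₃ ∈ N →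
        nb z₁ z₂ ≡ false → nb z₁ z₃ ≡ false → nb z₂ z₃ ≡ false → g z₁ + g z₂ + g z₃ ≤ + 4 * S - S * T
      triple-sum z₁ z₂ z₃ p₁ p₂ p₃ q₁₂ q₁₃ q₂₃ = by-diff (0≤diff bound′) (identity S T (g z₁) (g z₂) (g z₃))
        where
        bound′ : S * (T + + 1) + g z₁ + (S * (T + + 1) + g z₂) + (S * (T + + 1) + g z₃) ≤
          S * (+ 2 * T + + 1) + + 2 * S + + 2 * S + + 2 * S
        bound′ = subst₂ _≤_
          (trans (sum-+₃ (λ w → b2ℤ (nb x w ∧ nb z₁ w)) (λ w → b2ℤ (nb x w ∧ nb z₂ w)) (λ w → b2ℤ (nb x w ∧ nb z₃ w)))
            (cong₂ _+_ (cong₂ _+_ (codeg-adj x z₁ p₁) (codeg-adj x z₂ p₂)) (codeg-adj x z₃ p₃)))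
          (trans (sum-+₄ (λ w → b2ℤ (nb x w)) (λ w → b2ℤ (nb z₁ w ∧ nb z₂ w)) (λ w → b2ℤ (nb z₁ w ∧ nb z₃ w)) (λ w → b2ℤ (nb z₂ w ∧ nb z₃ w)))
            (cong₂ _+_ (cong₂ _+_ (cong₂ _+_ (degree-nb x) (codeg-nonadj z₁ z₂ q₁₂)) (codeg-nonadj z₁ z₃ q₁₃)) (codeg-nonadj z₂ z₃ q₂₃)))
          (sum-mono (λ w → ∧-triple (nb x w) (nb z₁ w) (nb z₂ w) (nb z₃ w)))
        identity : ∀ S T a b c → + 4 * S - S * T - (a + b + c) ≡
          S * (+ 2 * T + + 1) + + 2 * S + + 2 * S + + 2 * S - (S * (T + + 1) + a + (S * (T + + 1) + b) + (S * (T + + 1) + c))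
        identity = solve-∀

      -- Chebyshev's inequality: the squares of `g` add up to S(ST)², which bounds the number of
      -- vertices where k · g² reaches (ST)².
      few : ∀ k (P : Subset n) → (∀ z → z ∈ P → S * T * (S * T) ≤ + k * (g z * g z)) → # P ≤ + k * S
      few k P h = cancel-≤ 1≤c (subst (S * T * (S * T) * # P ≤_) total
        (#-weight P (S * T * (S * T)) (λ z → nat k ⊗ square-nonneg (g z)) h))
        where
        1≤c : + 1 ≤ S * T * (S * T)
        1≤c = square-mono (nat 1) 1≤ST
        total : sumℤ (λ z → + k * (g z * g z)) ≡ S * T * (S * T) * (+ k * S)
        total = trans (sum-*ˡ (+ k) (λ z → g z * g z)) (trans (cong (+ k *_) (f-square x)) (identity S T (+ k)))
          where
          identity : ∀ S T k → k * (S * S * S * T * T) ≡ S * T * (S * T) * (k * S)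
          identity = solve-∀

      -- The threshold must lie above -ST/3 with room to spare: three values above -ST/4 sum to more
      -- than -3ST/4, while `triple-sum` allows at most 4S - ST, and the gap ST/4 exceeds 4S.
      -- Squaring the 4 gives the 16 in `#W`.
      W : Subset n
      W z = does (+ 4 * g z ℤ.≤? - (S * T))

      #W : # W ≤ + 16 * S
      #W = few 16 W λ z z∈W → subst (S * T * (S * T) ≤_) (identity (g z))
        (square-mono-neg 0≤ST (does-elim (+ 4 * g z ℤ.≤? - (S * T)) z∈W))
        where
        identity : ∀ a → + 4 * a * (+ 4 * a) ≡ + 16 * (a * a)
        identity = solve-∀

      G : Subset n
      G = N ∖ W

      G⊆N : G ⊆ N
      G⊆N z = ∧-elimˡ

      G-value : ∀ z → z ∈ G → - (S * T) + + 1 ≤ + 4 * g z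
      G-value z z∈G = ≰⇒+1≤ (does-refute (+ 4 * g z ℤ.≤? - (S * T)) (not-elim (∧-elimʳ z∈G)))

      G-triple : ∀ z₁ z₂ z₃ → z₁ ∈ G → z₂ ∈ G → z₃ ∈ G →
        nb z₁ z₂ ≡ false → nb z₁ z₃ ≡ false → nb z₂ z₃ ≡ true
      G-triple z₁ z₂ z₃ p₁ p₂ p₃ q₁₂ q₁₃ with z₃ ∈? nb z₂
      ... | inj₁ q₂₃ = q₂₃
      ... | inj₂ q₂₃ = ⊥-elim (absurd
        (nat 4 ⊗ 0≤diff (triple-sum z₁ z₂ z₃ (G⊆N z₁ p₁) (G⊆N z₂ p₂) (G⊆N z₃ p₃) q₁₂ q₁₃ q₂₃)
          ⊕ 0≤diff (G-value z₁ p₁) ⊕ 0≤diff (G-value z₂ p₂) ⊕ 0≤diff (G-value z₃ p₃) ⊕ 0≤S ⊗ (0≤T-100 ⊕ nat 84))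
        (identity S T (g z₁) (g z₂) (g z₃)))
        where
        identity : ∀ S T a b c → + 4 * (+ 4 * S - S * T - (a + b + c)) + (+ 4 * a - (- (S * T) + + 1))
          + (+ 4 * b - (- (S * T) + + 1)) + (+ 4 * c - (- (S * T) + + 1)) + S * (T - + 100 + + 84) ≡ - + 3
        identity = solve-∀

      #G : S * (+ 2 * T + + 1) - + 16 * S ≤ # G
      #G = by-diff (0≤diff (subst (_≤ # G + # W) (degree-nb x) (#-cover₂ {P = N} G W split)) ⊕ 0≤diff #W)
        (identity (S * (+ 2 * T + + 1)) (+ 16 * S) (# G) (# W))
        where
        split : ∀ z → z ∈ N → z ∈ G ⊎ z ∈ W
        split z z∈N with z ∈? W
        ... | inj₁ z∈W = inj₂ z∈W
        ... | inj₂ z∉W = inj₁ (∖-intro {P = N} {W} z z∈N z∉W)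
        identity : ∀ k c p w → p - (k - c) ≡ p + w - k + (c - w)
        identity = solve-∀

      -- If `G` were a clique, then g ≥ |G| - S(T + 1) ≥ ST - 16S ≥ ST/2 on all of `G`, and `few 4`
      -- would leave `G` at most 4S elements.
      nonadjacent-pair : ∃ λ a → ∃ λ b → a ∈ G × b ∈ G × nb a b ≡ false
      nonadjacent-pair with Fin.any? (λ a → Fin.any? (λ b → (G a Bool.≟ true) ×-dec (G b Bool.≟ true) ×-dec (nb a b Bool.≟ false)))
      ... | yes (a , b , p) = a , b , p
      ... | no none = ⊥-elim (absurd (0≤diff (few 4 G big) ⊕ 0≤diff #G ⊕ nat 2 ⊗ 0≤S ⊗ (0≤T-100 ⊕ nat 90) ⊕ 0≤S-1)
          (identity S T (# G)))
        where
        clique : ∀ a b → a ∈ G → b ∈ G → nb a b ≡ true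
        clique a b p q with b ∈? nb a
        ... | inj₁ r = r
        ... | inj₂ r = contradiction (a , b , p , q , r) none
        size : ∀ z → z ∈ G → # G ≤ S * (T + + 1) + g z
        size z p = subst (# G ≤_) (codeg-adj x z (G⊆N z p))
          (#-mono {P = G} {N ∩ nb z} (λ w q → ∧-intro (G⊆N w q) (clique z w p q)))
        big : ∀ z → z ∈ G → S * T * (S * T) ≤ + 4 * (g z * g z)
        big z p = subst (S * T * (S * T) ≤_) (double (g z)) (square-mono {b = + 2 * g z} 0≤ST
          (by-diff (nat 2 ⊗ 0≤diff (size z p) ⊕ nat 2 ⊗ 0≤diff #G ⊕ 0≤S ⊗ (0≤T-100 ⊕ nat 68)) (arith S T (g z) (# G))))
          where
          double : ∀ a → + 2 * a * (+ 2 * a) ≡ + 4 * (a * a)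
          double = solve-∀
          arith : ∀ S T a p → + 2 * a - S * T ≡ + 2 * (S * (T + + 1) + a - p) + + 2 * (p - (S * (+ 2 * T + + 1) - + 16 * S)) + S * (T - + 100 + + 68)
          arith = solve-∀
        identity : ∀ S T p → + 4 * S - p + (p - (S * (+ 2 * T + + 1) - + 16 * S)) + + 2 * S * (T - + 100 + + 90) + (S - + 1) ≡ - + 1
        identity = solve-∀

      record Clique (L : Subset n) : Set where
        field
          sub    : L ⊆ N
          joined : ∀ u v → u ∈ L → v ∈ L → nb u v ≡ true
          few-nb : ∀ w → w ∈ N → w ∉ L → # (nb w ∩ L) ≤ + 2 * S

      record Split : Set where
        field
          L M      : Subset n
          L-clique : Clique L
          M-clique : Clique M
          a b      : Fin n
          a∈L      : a ∈ L
          a∉M      : a ∉ M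
          b∈M      : b ∈ M
          b∉L      : b ∉ L
          ab       : nb a b ≡ false
          #rest    : # (N ∖ (L ∪ M)) ≤ + 18 * S

      part : Fin n → Fin n → Subset n
      part a b = (G ∩ nb a) ∖ nb b

      part⊆G : ∀ a b → part a b ⊆ G
      part⊆G a b z p = ∧-elimˡ {G z} (∧-elimˡ p)

      -- Nonadjacent vertices have only 2S common neighbours, so 2S + 1 elements suffice to force
      -- adjacency of any two vertices joined to the whole part. The count starts from more than S(T
      -- + 1) - ST/4 neighbours of `a` in `N` and loses at most 2S to `b` and 16S to `W`.
      #part : ∀ a b → a ∈ G → nb a b ≡ false → + 2 * S + + 1 ≤ # (part a b)
      #part a b a∈G ab = by-refuting λ h → absurd
        (nat 4 ⊗ 0≤diff h ⊕ nat 4 ⊗ 0≤diff cover ⊕ 0≤diff (G-value a a∈G) ⊕ nat 4 ⊗ 0≤diff #W ⊕ nat 3 ⊗ 0≤S ⊗ (0≤T-100 ⊕ nat 74) ⊕ nat 2 ⊗ 0≤S)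
        (identity S T (# (part a b)) (g a) (# W))
        where
        identity : ∀ S T p a w → + 4 * (+ 2 * S + + 1 - (p + + 1)) + + 4 * (p + + 2 * S + w - (S * (T + + 1) + a))
          + (+ 4 * a - (- (S * T) + + 1)) + + 4 * (+ 16 * S - w) + + 3 * S * (T - + 100 + + 74) + + 2 * S ≡ - + 1
        identity = solve-∀
        cover : S * (T + + 1) + g a ≤ # (part a b) + + 2 * S + # W
        cover = subst₂ _≤_ (codeg-adj x a (G⊆N a a∈G)) (cong (λ c → # (part a b) + c + # W) (codeg-nonadj a b ab))
          (#-cover₃ {P = N ∩ nb a} (part a b) (nb a ∩ nb b) W covering)
          where
          covering : ∀ z → z ∈ N ∩ nb a → z ∈ part a b ⊎ z ∈ nb a ∩ nb b ⊎ z ∈ W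
          covering z p with z ∈? W | z ∈? nb b
          ... | inj₁ z∈W | _ = inj₂ (inj₂ z∈W)
          ... | inj₂ z∉W | inj₁ bz = inj₂ (inj₁ (∧-intro (∧-elimʳ {nb x z} p) bz))
          ... | inj₂ z∉W | inj₂ bz = inj₁ (∖-intro {P = G ∩ nb a} {nb b} z
            (∧-intro (∖-intro {P = N} {W} z (∧-elimˡ p) z∉W) (∧-elimʳ {nb x z} p)) bz)

      part-joined : ∀ a b → b ∈ G → ∀ u v → u ∈ part a b → v ∈ part a b → nb u v ≡ true
      part-joined a b b∈G u v p q = G-triple b u v b∈G (part⊆G a b u p) (part⊆G a b v q)
        (not-elim (∧-elimʳ {(G ∩ nb a) u} p)) (not-elim (∧-elimʳ {(G ∩ nb a) v} q))

      adjacent-to-part? : ∀ a b w → Dec (∀ c → c ∈ part a b → nb w c ≡ true)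
      adjacent-to-part? a b w = Fin.all? (λ c → (part a b c Bool.≟ true) →-dec (nb w c Bool.≟ true))

      -- Enlarges the part so that vertices of `W` may belong too. Testing against the part alone
      -- makes membership decidable and gives every excluded vertex of `N` a definite non-neighbour
      -- in the part.
      line : Fin n → Fin n → Subset n
      line a b w = N w ∧ does (adjacent-to-part? a b w)

      line-elim : ∀ a b w → w ∈ line a b → ∀ c → c ∈ part a b → nb w c ≡ true
      line-elim a b w p = does-elim (adjacent-to-part? a b w) (∧-elimʳ {N w} p)

      part⊆line : ∀ a b → b ∈ G → part a b ⊆ line a b
      part⊆line a b b∈G u p = ∧-intro (G⊆N u (part⊆G a b u p))
        (does-intro (adjacent-to-part? a b u) (λ c q → part-joined a b b∈G u c p q))

      -- Two members have the whole part as common neighbours, too many for a nonadjacent pair. An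
      -- excluded `w` is nonadjacent to some `c` of the part, and its neighbours on the line are
      -- common neighbours of `w` and `c`.
      line-clique : ∀ a b → a ∈ G → b ∈ G → nb a b ≡ false → Clique (line a b)
      line-clique a b a∈G b∈G ab = record { sub = λ w → ∧-elimˡ ; joined = joined ; few-nb = few-nb }
        where
        joined : ∀ u v → u ∈ line a b → v ∈ line a b → nb u v ≡ true
        joined u v p q with v ∈? nb u
        ... | inj₁ uv = uv
        ... | inj₂ uv = ⊥-elim (absurd (0≤diff (ℤ.≤-trans (#part a b a∈G ab) (subst (# (part a b) ≤_) (codeg-nonadj u v uv)
                (#-mono {P = part a b} {nb u ∩ nb v} (λ c r → ∧-intro (line-elim a b u p c r) (line-elim a b v q c r))))))
                (identity S))
          where
          identity : ∀ S → + 2 * S - (+ 2 * S + + 1) ≡ - + 1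
          identity = solve-∀
        few-nb : ∀ w → w ∈ N → w ∉ line a b → # (nb w ∩ line a b) ≤ + 2 * S
        few-nb w w∈N w∉L with Fin.¬∀⟶∃¬ n _ (λ c → (part a b c Bool.≟ true) →-dec (nb w c Bool.≟ true))
          (λ all → clash (∧-intro w∈N (does-intro (adjacent-to-part? a b w) all)) w∉L)
        ... | c , ¬imp with c ∈? part a b | c ∈? nb w
        ...   | inj₂ c∉ | _ = ⊥-elim (¬imp (λ c∈ → clash c∈ c∉))
        ...   | inj₁ _ | inj₁ wc = ⊥-elim (¬imp (λ _ → wc))
        ...   | inj₁ c∈ | inj₂ wc = subst (# (nb w ∩ line a b) ≤_) (codeg-nonadj w c wc)
          (#-mono {P = nb w ∩ line a b} {nb w ∩ nb c} (λ z p → ∧-intro (∧-elimˡ p)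
            (nb-flip (line-elim a b z (∧-elimʳ {nb w z} p) c c∈))))

      a∈part : ∀ a b → a ∈ G → nb a b ≡ false → a ∈ part a b
      a∈part a b a∈G ab = ∖-intro {P = G ∩ nb a} {nb b} a (∧-intro a∈G (nb-refl a)) (nb-flip ab)

      split : Split
      split with nonadjacent-pair
      ... | a , b , a∈G , b∈G , ab = record
        { L = line a b ; M = line b a
        ; L-clique = line-clique a b a∈G b∈G ab ; M-clique = line-clique b a b∈G a∈G (nb-flip ab)
        ; a = a ; b = b
        ; a∈L = part⊆line a b b∈G a (a∈part a b a∈G ab)
        ; a∉M = not-true (λ p → clash (line-elim b a a p b (a∈part b a b∈G (nb-flip ab))) ab)
        ; b∈M = part⊆line b a a∈G b (a∈part b a b∈G (nb-flip ab))
        ; b∉L = not-true (λ p → clash (line-elim a b b p a (a∈part a b a∈G ab)) (nb-flip ab))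
        ; ab = ab
        -- The 18S is 16S for `W` and 2S for the common neighbours of `a` and `b`: a vertex of `G`
        -- adjacent to exactly one of the two lies in a part, and `G-triple` forbids being adjacent
        -- to neither.
        ; #rest = by-diff (0≤diff (subst (λ c → # (N ∖ (line a b ∪ line b a)) ≤ # W + c) (codeg-nonadj a b ab)
            (#-cover₂ {P = N ∖ (line a b ∪ line b a)} W (nb a ∩ nb b) covering)) ⊕ 0≤diff #W)
            (identity S (# (N ∖ (line a b ∪ line b a))) (# W))
        }
        where
        identity : ∀ S r w → + 18 * S - r ≡ w + + 2 * S - r + (+ 16 * S - w)
        identity = solve-∀
        covering : ∀ z → z ∈ N ∖ (line a b ∪ line b a) → z ∈ W ⊎ z ∈ nb a ∩ nb b
        covering z p with z ∈? W
        ... | inj₁ z∈W = inj₁ z∈W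
        ... | inj₂ z∉W with z ∈? nb a | z ∈? nb b
        ...   | inj₁ az | inj₁ bz = inj₂ (∧-intro az bz)
        ...   | inj₁ az | inj₂ bz = clash (∨-introˡ (part⊆line a b b∈G z (∖-intro {P = G ∩ nb a} {nb b} z
                  (∧-intro (∖-intro {P = N} {W} z (∧-elimˡ p) z∉W) az) bz))) (not-elim (∧-elimʳ {N z} p))
        ...   | inj₂ az | inj₁ bz = clash (∨-introʳ {line a b z} (part⊆line b a a∈G z (∖-intro {P = G ∩ nb b} {nb a} z
                  (∧-intro (∖-intro {P = N} {W} z (∧-elimˡ p) z∉W) bz) az))) (not-elim (∧-elimʳ {N z} p))
        ...   | inj₂ az | inj₂ bz = clash (G-triple a b z a∈G b∈G (∖-intro {P = N} {W} z (∧-elimˡ p) z∉W) ab az) bz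

  #-disjoint : ∀ {n} {P Q : Subset n} → (∀ z → z ∈ P → z ∉ Q) → # (P ∪ Q) ≡ # P + # Q
  #-disjoint {P = P} {Q} h = trans (sum-cong (λ z → pointwise (P z) (Q z) (h z)))
    (sum-+ (λ z → b2ℤ (P z)) (λ z → b2ℤ (Q z)))
    where
    pointwise : ∀ p q → (p ≡ true → q ≡ false) → b2ℤ (p ∨ q) ≡ b2ℤ p + b2ℤ q
    pointwise true  q h rewrite h refl = refl
    pointwise false q h = ≡-sym (ℤ.+-identityˡ (b2ℤ q))

  -- The two lines through a vertex

  record LinePair {n} (nb : Fin n → Subset n) (S T : ℤ) (x : Fin n) : Set where
    field
      L M      : Subset n
      L⊆N      : L ⊆ nb x
      M⊆N      : M ⊆ nb x
      L-joined : ∀ u v → u ∈ L → v ∈ L → nb u v ≡ true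
      M-joined : ∀ u v → u ∈ M → v ∈ M → nb u v ≡ true
      cover    : ∀ z → z ∈ nb x → z ∈ L ⊎ z ∈ M
      #L       : # L ≡ S * (T + + 1)
      #M       : # M ≡ S * (T + + 1)
      #L∩M     : # (L ∩ M) ≡ S
      L-only   : ∀ z → z ∈ L → z ∉ M → nb x ∩ nb z ⊆ L
      M-only   : ∀ z → z ∈ M → z ∉ L → nb x ∩ nb z ⊆ M

  module TwoLines {n} (S T : ℤ) (1≤S : + 1 ≤ S) (large : + 100 * S * S ≤ T) (𝒟 : CountingData n S T) (x : Fin n) where
    open CountingData 𝒟
    open Neighbourhood S T 1≤S large 𝒟
    open At x

    x∈nb : ∀ z → z ∈ N → nb z x ≡ true
    x∈nb z p = nb-flip p

    g-top : ∀ z → z ∈ N → g z ≤ S * T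
    g-top z z∈N = by-diff (0≤diff (subst₂ _≤_ (codeg-adj x z z∈N) (degree-nb x)
      (#-mono {P = N ∩ nb z} {N} (λ w → ∧-elimˡ)))) (identity S T (g z))
      where
      identity : ∀ S T a → S * T - a ≡ S * (+ 2 * T + + 1) - (S * (T + + 1) + a)
      identity = solve-∀

    1≤SS : + 1 ≤ S * S
    1≤SS = square-mono (nat 1) 1≤S

    1≤SSSTT : + 1 ≤ S * (S * T * (S * T))
    1≤SSSTT = by-diff (0≤S-1 ⊗ (0≤ST ⊗ 0≤ST) ⊕ 0≤diff (square-mono (nat 1) 1≤ST)) (identity S (S * T * (S * T)))
      where
      identity : ∀ S p → S * p - + 1 ≡ (S - + 1) * p + (p - + 1)
      identity = solve-∀

    swap : Split → Split
    swap σ = record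
      { L = M ; M = L ; L-clique = M-clique ; M-clique = L-clique ; a = b ; b = a
      ; a∈L = b∈M ; a∉M = b∉L ; b∈M = a∈L ; b∉L = a∉M ; ab = nb-flip ab
      ; #rest = ℤ.≤-trans (ℤ.≤-reflexive (sum-cong (λ z → cong (λ c → b2ℤ (N z ∧ not c)) (Bool.∨-comm (M z) (L z))))) #rest
      }
      where open Split σ

    module Sizes (σ : Split) where
      open Split σ
      module L = Clique L-clique
      module M = Clique M-clique

      R D : Subset n
      R = N ∖ (L ∪ M)
      D = L ∩ M

      R-intro : ∀ z → z ∈ N → z ∉ L → z ∉ M → z ∈ R
      R-intro z p q r rewrite p | q | r = refl

      R-elim : ∀ z → z ∈ R → z ∈ N × z ∉ L × z ∉ M
      R-elim z p = ∧-elimˡ p , ∉-∪ (not-elim (∧-elimʳ {N z} p))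
        where
        ∉-∪ : ∀ {l m} → l ∨ m ≡ false → l ≡ false × m ≡ false
        ∉-∪ {false} h = refl , h

      inclusion-exclusion : # L + # M + # R ≡ S * (+ 2 * T + + 1) + # D
      inclusion-exclusion = trans (≡-sym (sum-+₃ (λ z → b2ℤ (L z)) (λ z → b2ℤ (M z)) (λ z → b2ℤ (R z))))
        (trans (sum-cong (λ z → pointwise (N z) (L z) (M z) (L.sub z) (M.sub z)))
          (trans (sum-+ (λ z → b2ℤ (N z)) (λ z → b2ℤ (D z))) (cong (λ y → y + # D) (degree-nb x))))
        where
        pointwise : ∀ n l m → (l ≡ true → n ≡ true) → (m ≡ true → n ≡ true) →
          b2ℤ l + b2ℤ m + b2ℤ (n ∧ not (l ∨ m)) ≡ b2ℤ n + b2ℤ (l ∧ m)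
        pointwise true  true  true  _ _ = refl
        pointwise true  true  false _ _ = refl
        pointwise true  false true  _ _ = refl
        pointwise true  false false _ _ = refl
        pointwise false true  m     p _ = clash (p refl) refl
        pointwise false false true  _ q = clash (q refl) refl
        pointwise false false false _ _ = refl

      -- A vertex of both cliques is adjacent to all of `N` except possibly `R`.
      D-low : ∀ z → z ∈ D → S * T - # R ≤ g z
      D-low z z∈D = by-diff (0≤diff (subst₂ _≤_ (degree-nb x) (cong (λ y → y + # R) (codeg-adj x z (L.sub z z∈L)))
        (#-cover₂ {P = N} (N ∩ nb z) R covering))) (identity S T (g z) (# R))
        where
        z∈L = ∧-elimˡ {L z} z∈D
        z∈M = ∧-elimʳ {L z} z∈D
        covering : ∀ w → w ∈ N → w ∈ N ∩ nb z ⊎ w ∈ R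
        covering w w∈N with w ∈? L | w ∈? M
        ... | inj₁ w∈L | _        = inj₁ (∧-intro w∈N (L.joined z w z∈L w∈L))
        ... | inj₂ w∉L | inj₁ w∈M = inj₁ (∧-intro w∈N (M.joined z w z∈M w∈M))
        ... | inj₂ w∉L | inj₂ w∉M = inj₂ (R-intro w w∈N w∉L w∉M)
        identity : ∀ S T a r → a - (S * T - r) ≡ S * (T + + 1) + a + r - S * (+ 2 * T + + 1)
        identity = solve-∀

      -- A vertex outside both cliques has at most 2S neighbours in each, and at most |R| others
      -- within `N`.
      R-high : ∀ z → z ∈ R → g z ≤ + 3 * S + # R - S * T
      R-high z z∈R with R-elim z z∈R
      ... | z∈N , z∉L , z∉M = by-diff
        (0≤diff (subst (_≤ # (nb z ∩ L) + # (nb z ∩ M) + # R) (codeg-adj x z z∈N)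
          (#-cover₃ {P = N ∩ nb z} (nb z ∩ L) (nb z ∩ M) R covering))
        ⊕ 0≤diff (L.few-nb z z∈N z∉L) ⊕ 0≤diff (M.few-nb z z∈N z∉M))
        (identity S T (g z) (# R) (# (nb z ∩ L)) (# (nb z ∩ M)))
        where
        covering : ∀ w → w ∈ N ∩ nb z → w ∈ nb z ∩ L ⊎ w ∈ nb z ∩ M ⊎ w ∈ R
        covering w p with w ∈? L | w ∈? M
        ... | inj₁ w∈L | _        = inj₁ (∧-intro (∧-elimʳ {N w} p) w∈L)
        ... | inj₂ w∉L | inj₁ w∈M = inj₂ (inj₁ (∧-intro (∧-elimʳ {N w} p) w∈M))
        ... | inj₂ w∉L | inj₂ w∉M = inj₂ (inj₂ (R-intro w (∧-elimˡ p) w∉L w∉M))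
        identity : ∀ S T a r p q → + 3 * S + r - S * T - a ≡ p + q + r - (S * (T + + 1) + a) + (+ 2 * S - p) + (+ 2 * S - q)
        identity = solve-∀

      -- The 21 is the 3 of `R-high` plus the 18 of `#rest`.
      R-very-high : ∀ z → z ∈ R → g z ≤ - (S * (T - + 21))
      R-very-high z z∈R = by-diff (0≤diff (R-high z z∈R) ⊕ 0≤diff #rest) (identity S T (g z) (# R))
        where
        identity : ∀ S T a r → - (S * (T - + 21)) - a ≡ + 3 * S + r - S * T - a + (+ 18 * S - r)
        identity = solve-∀

      0≤S[T-21] : + 0 ≤ S * (T - + 21)
      0≤S[T-21] = 0≤S ⊗ subst (+ 0 ≤_) (identity T) (0≤T-100 ⊕ nat 79)
        where
        identity : ∀ T → T - + 100 + + 79 ≡ T - + 21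
        identity = solve-∀

      -- With S + 1 vertices of absolute value at least S(T - 21), the squares would add up to more
      -- than S³T² once T ≥ 42(S + 1), and 100S ≤ T ensures this.
      #D+#R : # D + # R ≤ S
      #D+#R = by-refuting λ h → absurd
        (0≤diff weight ⊕ (0≤S[T-21] ⊗ 0≤S[T-21]) ⊗ 0≤diff h
          ⊕ 0≤S ⊗ 0≤S ⊗ 0≤T ⊗ (0≤T-100S ⊕ nat 42 ⊗ 0≤S-1 ⊕ nat 16 ⊗ 0≤S)
          ⊕ nat 441 ⊗ 0≤S ⊗ 0≤S ⊗ 0≤S ⊕ nat 441 ⊗ 0≤diff 1≤SS ⊕ nat 440)
        (identity S T (# D + # R))
        where
        disjoint : ∀ z → z ∈ D → z ∉ R
        disjoint z p = not-true (λ q → clash (∧-elimˡ {L z} p) (proj₁ (proj₂ (R-elim z q))))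
        bounds : ∀ z → z ∈ D ∪ R → S * (T - + 21) * (S * (T - + 21)) ≤ g z * g z
        bounds z p with ∨-elim {D z} p
        ... | inj₂ z∈R = square-mono-neg 0≤S[T-21] (R-very-high z z∈R)
        ... | inj₁ z∈D = square-mono {b = g z} 0≤S[T-21]
          (by-diff (0≤diff (D-low z z∈D) ⊕ 0≤diff #rest ⊕ nat 3 ⊗ 0≤S) (arith S T (g z) (# R)))
          where
          arith : ∀ S T a r → a - S * (T - + 21) ≡ a - (S * T - r) + (+ 18 * S - r) + + 3 * S
          arith = solve-∀
        weight : S * (T - + 21) * (S * (T - + 21)) * (# D + # R) ≤ S * S * S * T * T
        weight = subst₂ _≤_ (cong (S * (T - + 21) * (S * (T - + 21)) *_) (#-disjoint {P = D} {R} disjoint)) (f-square x)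
          (#-weight (D ∪ R) (S * (T - + 21) * (S * (T - + 21))) (λ z → square-nonneg (g z)) bounds)
        identity : ∀ S T δ → S * S * S * T * T - S * (T - + 21) * (S * (T - + 21)) * δ
          + S * (T - + 21) * (S * (T - + 21)) * (δ - (S + + 1))
          + S * S * T * (T - + 100 * S + + 42 * (S - + 1) + + 16 * S)
          + + 441 * S * S * S + + 441 * (S * S - + 1) + + 440 ≡ - + 1
        identity = solve-∀

      L-size : ∀ z → z ∈ L → # L ≤ S * (T + + 1) + g z
      L-size z z∈L = subst (# L ≤_) (codeg-adj x z (L.sub z z∈L))
        (#-mono {P = L} {N ∩ nb z} (λ w w∈L → ∧-intro (L.sub w w∈L) (L.joined z w z∈L w∈L)))

      L-only-size : ∀ z → z ∈ L → z ∉ M → S * (T + + 1) + g z ≤ # L + + 2 * S + # R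
      L-only-size z z∈L z∉M = by-diff
        (0≤diff (subst (_≤ # L + # (nb z ∩ M) + # R) (codeg-adj x z z∈N)
          (#-cover₃ {P = N ∩ nb z} L (nb z ∩ M) R covering)) ⊕ 0≤diff (M.few-nb z z∈N z∉M))
        (identity (S * (T + + 1) + g z) (# L) (# R) (# (nb z ∩ M)) S)
        where
        z∈N = L.sub z z∈L
        covering : ∀ w → w ∈ N ∩ nb z → w ∈ L ⊎ w ∈ nb z ∩ M ⊎ w ∈ R
        covering w p with w ∈? L | w ∈? M
        ... | inj₁ w∈L | _        = inj₁ w∈L
        ... | inj₂ w∉L | inj₁ w∈M = inj₂ (inj₁ (∧-intro (∧-elimʳ {N w} p) w∈M))
        ... | inj₂ w∉L | inj₂ w∉M = inj₂ (inj₂ (R-intro w (∧-elimˡ p) w∉L w∉M))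
        identity : ∀ c l r q S → l + + 2 * S + r - c ≡ l + q + r - c + (+ 2 * S - q)
        identity = solve-∀

      -- A large value on L ∖ M would be a large value on all of L ∖ M, against the sum of squares.
      L-only-high : ∀ z → z ∈ L → z ∉ M → + 4 * g z ≤ T
      L-only-high z z∈L z∉M = by-refuting λ h → absurd
        -- The values on `L ∖ M` are at least T/8, so `weight` gives |L ∖ M| ≤ 64S³, whereas `count`
        -- gives |L ∖ M| ≥ ST ≥ 100S³. Here the bound on T that is quadratic in S enters.
        (nat 4 ⊗ 0≤diff (weight h) ⊕ (0≤T ⊗ 0≤T) ⊗ 0≤diff (count h)
          ⊕ nat 4 ⊗ 0≤S ⊗ 0≤T ⊗ 0≤T ⊗ 0≤diff large ⊕ nat 144 ⊗ 0≤diff 1≤SSSTT ⊕ nat 143)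
        (identity S T (# (L ∖ M)))
        where
        bounds : T + + 1 ≤ + 4 * g z → ∀ w → w ∈ L ∖ M → T * T ≤ + 64 * (g w * g w)
        bounds h w p = subst (T * T ≤_) (eight (g w)) (square-mono {b = + 8 * g w} 0≤T
          (by-diff (nat 8 ⊗ 0≤diff (L-size w (∧-elimˡ p)) ⊕ nat 8 ⊗ 0≤diff (L-only-size z z∈L z∉M)
            ⊕ nat 8 ⊗ 0≤diff #D+#R ⊕ nat 8 ⊗ #-nonneg D ⊕ nat 2 ⊗ 0≤diff h ⊕ 0≤T-100S ⊕ nat 76 ⊗ 0≤S ⊕ nat 2)
            (arith S T (g z) (g w) (# L) (# R) (# D))))
          where
          eight : ∀ a → + 8 * a * (+ 8 * a) ≡ + 64 * (a * a)
          eight = solve-∀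
          arith : ∀ S T a b l r d → + 8 * b - T ≡ + 8 * (S * (T + + 1) + b - l) + + 8 * (l + + 2 * S + r - (S * (T + + 1) + a))
            + + 8 * (S - (d + r)) + + 8 * d + + 2 * (+ 4 * a - (T + + 1)) + (T - + 100 * S) + + 76 * S + + 2
          arith = solve-∀
        weight : T + + 1 ≤ + 4 * g z → T * T * # (L ∖ M) ≤ + 64 * (S * S * S * T * T)
        weight h = subst (T * T * # (L ∖ M) ≤_) (trans (sum-*ˡ (+ 64) (λ w → g w * g w)) (cong (+ 64 *_) (f-square x)))
          (#-weight (L ∖ M) (T * T) (λ w → nat 64 ⊗ square-nonneg (g w)) (bounds h))
        count : T + + 1 ≤ + 4 * g z → + 4 * (S * T) ≤ + 4 * # (L ∖ M)
        count h = by-diff (nat 4 ⊗ 0≤diff (#-cover₂ {P = L} (L ∖ M) D covering) ⊕ nat 4 ⊗ 0≤diff (L-only-size z z∈L z∉M)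
          ⊕ nat 4 ⊗ 0≤diff #D+#R ⊕ 0≤diff h ⊕ 0≤T-100S ⊕ nat 92 ⊗ 0≤S ⊕ nat 1)
          (arith S T (g z) (# L) (# R) (# D) (# (L ∖ M)))
          where
          covering : ∀ w → w ∈ L → w ∈ L ∖ M ⊎ w ∈ D
          covering w w∈L with w ∈? M
          ... | inj₁ w∈M = inj₂ (∧-intro w∈L w∈M)
          ... | inj₂ w∉M = inj₁ (∖-intro {P = L} {M} w w∈L w∉M)
          arith : ∀ S T a l r d p → + 4 * p - + 4 * (S * T) ≡ + 4 * (p + d - l) + + 4 * (l + + 2 * S + r - (S * (T + + 1) + a))
            + + 4 * (S - (d + r)) + (+ 4 * a - (T + + 1)) + (T - + 100 * S) + + 92 * S + + 1
          arith = solve-∀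
        identity : ∀ S T p → + 4 * (+ 64 * (S * S * S * T * T) - T * T * p) + T * T * (+ 4 * p - + 4 * (S * T))
          + + 4 * S * T * T * (T - + 100 * S * S) + + 144 * (S * (S * T * (S * T)) - + 1) + + 143 ≡ - + 1
        identity = solve-∀

    module Cover (σ : Split) where
      open Split σ
      open Sizes σ

      M-only-high : ∀ z → z ∈ M → z ∉ L → + 4 * g z ≤ T
      M-only-high = Sizes.L-only-high (swap σ)

      flat-at : ∀ y → y ∈ N → sumℤ (λ z → b2ℤ (nb y z) * g z) ≡ S * S * T
      flat-at y y∈N = trans (f-flat x y) (trans (cong (λ b → S * S * T * b2ℤ b) (x∈nb y y∈N)) (ℤ.*-identityʳ (S * S * T)))

      -- For y in R the values of f x on N[y] cannot add up to s²t: apart from negative values on R and at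
      -- most 4s small values, there are only the |D| ≤ s - 1 values on D, each at most st.
      R-empty : ∀ y → y ∈ R → ⊥
      R-empty y y∈R = absurd
        (0≤diff total ⊕ 0≤T ⊗ 0≤diff (L.few-nb y y∈N y∉L) ⊕ 0≤T ⊗ 0≤diff (M.few-nb y y∈N y∉M)
          ⊕ nat 4 ⊗ 0≤ST ⊗ 0≤diff #D+#R ⊕ nat 4 ⊗ 0≤ST ⊗ 0≤diff (#-member {P = R} y y∈R)
          ⊕ nat 4 ⊗ 0≤S ⊗ 0≤T-100 ⊕ nat 316 ⊗ 0≤S-1 ⊕ nat 315)
        (identity S T (# D) (# R) (# (nb y ∩ L)) (# (nb y ∩ M)))
        where
        y∈N = proj₁ (R-elim y y∈R)
        y∉L = proj₁ (proj₂ (R-elim y y∈R))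
        y∉M = proj₂ (proj₂ (R-elim y y∈R))
        -- Of the negative values on `R` only the one at `y` is kept. The factor 4 clears the bound
        -- T/4 for values off `D`. The total is at most 4ST(S - 1) + 4ST - 4S(T - 21), which falls
        -- short of 4S²T because T > 21.
        u = + 4 * - (S * (T - + 21))

        bounded : ∀ (b l m : Bool) (a v : ℤ) →
          (b ≡ true → + 4 * a ≤ + 4 * (S * T) * b2ℤ (l ∧ m) + T * b2ℤ l + T * b2ℤ m + v) →
          (b ≡ false → + 0 ≤ v) →
          + 4 * (b2ℤ b * a) ≤ + 4 * (S * T) * b2ℤ (l ∧ m) + T * b2ℤ (b ∧ l) + T * b2ℤ (b ∧ m) + v
        bounded true  l m a v h _ = subst (_≤ + 4 * (S * T) * b2ℤ (l ∧ m) + T * b2ℤ l + T * b2ℤ m + v)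
          (cong (+ 4 *_) (≡-sym (ℤ.*-identityˡ a))) (h refl)
        bounded false l m a v _ h = subst (_≤ + 4 * (S * T) * b2ℤ (l ∧ m) + T * + 0 + T * + 0 + v)
          (cong (+ 4 *_) (≡-sym (ℤ.*-zeroˡ a)))
          (nat 4 ⊗ 0≤ST ⊗ b2ℤ-nonneg (l ∧ m) ⊕ 0≤T ⊗ nat 0 ⊕ 0≤T ⊗ nat 0 ⊕ h refl)

        value : ∀ z → + 4 * g z ≤ + 4 * (S * T) * b2ℤ (L z ∧ M z) + T * b2ℤ (L z) + T * b2ℤ (M z) + δ y z * u
        value z with z ∈? L | z ∈? M
        ... | inj₁ z∈L | inj₁ z∈M rewrite z∈L | z∈M | δ-off y z (λ { refl → clash z∈L y∉L }) =
          by-diff (nat 4 ⊗ 0≤diff (g-top z (L.sub z z∈L)) ⊕ nat 2 ⊗ 0≤T) (arith S T (g z) u)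
          where
          arith : ∀ S T a u → + 4 * (S * T) * + 1 + T * + 1 + T * + 1 + + 0 * u - + 4 * a ≡ + 4 * (S * T - a) + + 2 * T
          arith = solve-∀
        ... | inj₁ z∈L | inj₂ z∉M rewrite z∈L | z∉M | δ-off y z (λ { refl → clash z∈L y∉L }) =
          by-diff (0≤diff (L-only-high z z∈L z∉M)) (arith (+ 4 * (S * T)) T (+ 4 * g z) u)
          where
          arith : ∀ c T a u → c * + 0 + T * + 1 + T * + 0 + + 0 * u - a ≡ T - a
          arith = solve-∀
        ... | inj₂ z∉L | inj₁ z∈M rewrite z∉L | z∈M | δ-off y z (λ { refl → clash z∈M y∉M }) =
          by-diff (0≤diff (M-only-high z z∈M z∉L)) (arith (+ 4 * (S * T)) T (+ 4 * g z) u)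
          where
          arith : ∀ c T a u → c * + 0 + T * + 0 + T * + 1 + + 0 * u - a ≡ T - a
          arith = solve-∀
        ... | inj₂ z∉L | inj₂ z∉M rewrite z∉L | z∉M = by-diff outside (arith (+ 4 * (S * T)) T (+ 4 * g z) (δ y z * u))
          where
          arith : ∀ c T a v → c * + 0 + T * + 0 + T * + 0 + v - a ≡ v - a
          arith = solve-∀
          outside : + 0 ≤ δ y z * u - + 4 * g z
          outside with y Fin.≟ z | z ∈? N
          ... | yes refl | _ rewrite δ-diag y = 0≤diff (subst (+ 4 * g y ≤_) (≡-sym (ℤ.*-identityˡ u))
            (ℤ.*-monoˡ-≤-nonNeg (+ 4) (R-very-high y y∈R)))
          ... | no ne | inj₁ z∈N rewrite δ-off y z ne =
            subst (+ 0 ≤_) (arith′ (g z) (S * (T - + 21)) u)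
              (nat 4 ⊗ 0≤diff (R-very-high z (R-intro z z∈N z∉L z∉M)) ⊕ nat 4 ⊗ 0≤S[T-21])
            where
            arith′ : ∀ a c u → + 4 * (- c - a) + + 4 * c ≡ + 0 * u - + 4 * a
            arith′ = solve-∀
          ... | no ne | inj₂ z∉N rewrite δ-off y z ne | f-nonadj x z z∉N = subst (+ 0 ≤_) (arith′ u) (nat 0)
            where
            arith′ : ∀ u → + 0 ≡ + 0 * u - + 4 * + 0
            arith′ = solve-∀

        no-loop : ∀ z → nb y z ≡ false → + 0 ≤ δ y z * u
        no-loop z h rewrite δ-off y z (λ { refl → clash (nb-refl y) h }) = subst (+ 0 ≤_) (≡-sym (ℤ.*-zeroˡ u)) (nat 0)

        total : + 4 * (S * S * T) ≤ + 4 * (S * T) * # D + T * # (nb y ∩ L) + T * # (nb y ∩ M) + u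
        total = subst₂ _≤_
          (trans (sum-*ˡ (+ 4) (λ z → b2ℤ (nb y z) * g z)) (cong (+ 4 *_) (flat-at y y∈N)))
          (trans (sum-+₄ (λ z → + 4 * (S * T) * b2ℤ (D z)) (λ z → T * b2ℤ ((nb y ∩ L) z)) (λ z → T * b2ℤ ((nb y ∩ M) z)) (λ z → δ y z * u))
            (cong₂ _+_ (cong₂ _+_ (cong₂ _+_ (sum-*ˡ (+ 4 * (S * T)) (λ z → b2ℤ (D z)))
              (sum-*ˡ T (λ z → b2ℤ ((nb y ∩ L) z)))) (sum-*ˡ T (λ z → b2ℤ ((nb y ∩ M) z)))) (sum-point y u)))
          (sum-mono (λ z → bounded (nb y z) (L z) (M z) (g z) (δ y z * u) (λ _ → value z) (no-loop z)))
        identity : ∀ S T d r p q → + 4 * (S * T) * d + T * p + T * q + + 4 * - (S * (T - + 21)) - + 4 * (S * S * T)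
          + T * (+ 2 * S - p) + T * (+ 2 * S - q) + + 4 * (S * T) * (S - (d + r)) + + 4 * (S * T) * (r - + 1)
          + + 4 * S * (T - + 100) + + 316 * (S - + 1) + + 315 ≡ - + 1
        identity = solve-∀

      cover : ∀ z → z ∈ N → z ∈ L ⊎ z ∈ M
      cover z z∈N with z ∈? L | z ∈? M
      ... | inj₁ z∈L | _        = inj₁ z∈L
      ... | inj₂ _   | inj₁ z∈M = inj₂ z∈M
      ... | inj₂ z∉L | inj₂ z∉M = ⊥-elim (R-empty z (R-intro z z∈N z∉L z∉M))

      #R≡0 : # R ≡ + 0
      #R≡0 = sum-zero (λ z → cong b2ℤ (not-true (R-empty z)))

      -- Since `x` and `a` both lie in `N`, their rows give the same sum in `f-flat`. Subtracting
      -- removes `L`, all of which is adjacent to `a`, so the values on a nonempty subset of `M ∖ L`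
      -- add up to zero.
      difference : ∀ z → ℤ
      difference z = (b2ℤ (N z) - b2ℤ (nb a z)) * g z

      a∈N : a ∈ N
      a∈N = L.sub a a∈L

      difference-sum : sumℤ difference ≡ + 0
      difference-sum = trans (sum-cong (λ z → distrib (b2ℤ (N z)) (b2ℤ (nb a z)) (g z)))
        (trans (sum-+ (λ z → b2ℤ (N z) * g z) (λ z → - (+ 1) * (b2ℤ (nb a z) * g z)))
          (trans (cong₂ _+_ (flat-at x (nb-refl x)) (trans (sum-*ˡ (- (+ 1)) (λ z → b2ℤ (nb a z) * g z)) (cong (- (+ 1) *_) (flat-at a a∈N))))
            (cancel (S * S * T))))
        where
        distrib : ∀ p q r → (p - q) * r ≡ p * r + - (+ 1) * (q * r)
        distrib = solve-∀
        cancel : ∀ c → c + - (+ 1) * c ≡ + 0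
        cancel = solve-∀

      -- The difference vanishes except on N ∖ N[a], which contains b and is contained in M ∖ L.
      difference-cases : ∀ z → (difference z ≡ + 0 × δ b z ≡ + 0) ⊎ (difference z ≡ g z × z ∈ M × z ∉ L)
      difference-cases z with z ∈? N | z ∈? nb a
      ... | inj₂ z∉N | _ = inj₁ (trans (cong ((b2ℤ (N z) - b2ℤ (nb a z)) *_) (f-nonadj x z z∉N)) (ℤ.*-zeroʳ (b2ℤ (N z) - b2ℤ (nb a z))) ,
        δ-off b z (λ { refl → clash (M.sub b b∈M) z∉N }))
      ... | inj₁ z∈N | inj₁ az = inj₁ (trans (cong₂ (λ p q → (b2ℤ p - b2ℤ q) * g z) z∈N az) (ℤ.*-zeroˡ (g z)) ,
        δ-off b z (λ { refl → clash az ab }))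
      ... | inj₁ z∈N | inj₂ az with z ∈? L | cover z z∈N
      ...   | inj₁ z∈L | _        = clash (L.joined a z a∈L z∈L) az
      ...   | inj₂ z∉L | inj₁ z∈L = clash z∈L z∉L
      ...   | inj₂ z∉L | inj₂ z∈M = inj₂ (trans (cong₂ (λ p q → (b2ℤ p - b2ℤ q) * g z) z∈N az) (ℤ.*-identityˡ (g z)) , z∈M , z∉L)

      δ≤1 : ∀ (y z : Fin n) → δ y z ≤ + 1
      δ≤1 y z with y Fin.≟ z
      ... | yes refl rewrite δ-diag y = ℤ.≤-refl
      ... | no ne rewrite δ-off y z ne = nat 1

      M-only-low : ∀ z → z ∈ M → # M ≤ S * (T + + 1) + g z
      M-only-low = Sizes.L-size (swap σ)

      M-only-size : ∀ z → z ∈ M → z ∉ L → S * (T + + 1) + g z ≤ # M + + 2 * S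
      M-only-size z z∈M z∉L = subst (S * (T + + 1) + g z ≤_)
        (trans (cong (λ r → # M + + 2 * S + r) (trans (sum-cong (λ w → cong (λ c → b2ℤ (N w ∧ not c)) (Bool.∨-comm (M w) (L w)))) #R≡0))
          (ℤ.+-identityʳ (# M + + 2 * S))) (Sizes.L-only-size (swap σ) z z∈M z∉L)

      -- On `M ∖ L` the values lie between |M| - S(T + 1) and that number plus 2S. Were the lower
      -- end positive, `difference` would be nonnegative everywhere and positive at `b`; `#M-low`
      -- treats the upper end in the same way.
      #M-high : # M ≤ S * (T + + 1)
      #M-high = by-refuting λ h → absurd (0≤diff (subst₂ _≤_ (sum-point b (+ 1)) difference-sum (sum-mono (pointwise h)))) refl
        where
        pointwise : S * (T + + 1) + + 1 ≤ # M → ∀ z → δ b z * + 1 ≤ difference z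
        pointwise h z with difference-cases z
        ... | inj₁ (e , e′) rewrite e | e′ = ℤ.≤-refl
        ... | inj₂ (e , z∈M , z∉L) rewrite e | ℤ.*-identityʳ (δ b z) = ℤ.≤-trans (δ≤1 b z)
          (by-diff (0≤diff h ⊕ 0≤diff (M-only-low z z∈M)) (arith (S * (T + + 1)) (# M) (g z)))
          where
          arith : ∀ c m a → a - + 1 ≡ m - (c + + 1) + (c + a - m)
          arith = solve-∀

      #M-low : S * (T + + 1) - + 2 * S ≤ # M
      #M-low = by-refuting λ h → absurd (0≤diff (subst₂ _≤_ difference-sum (sum-point b (- + 1)) (sum-mono (pointwise h)))) refl
        where
        pointwise : # M + + 1 ≤ S * (T + + 1) - + 2 * S → ∀ z → difference z ≤ δ b z * - + 1
        pointwise h z with difference-cases z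
        ... | inj₁ (e , e′) rewrite e | e′ = ℤ.≤-refl
        ... | inj₂ (e , z∈M , z∉L) rewrite e =
          by-diff (0≤diff (δ≤1 b z) ⊕ 0≤diff h ⊕ 0≤diff (M-only-size z z∈M z∉L)) (arith (S * (T + + 1)) S (# M) (g z) (δ b z))
          where
          arith : ∀ c S m a d → d * - + 1 - a ≡ + 1 - d + (c - + 2 * S - (m + + 1)) + (m + + 2 * S - (c + a))
          arith = solve-∀

      M-only-square : ∀ z → z ∈ M → z ∉ L → g z * g z ≤ + 4 * (S * S)
      M-only-square z z∈M z∉L = by-diff
        ((0≤diff (M-only-low z z∈M) ⊕ 0≤diff #M-low) ⊗ (0≤diff (M-only-size z z∈M z∉L) ⊕ 0≤diff #M-high))
        (identity (S * (T + + 1)) S (# M) (g z))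
        where
        identity : ∀ c S m a → + 4 * (S * S) - a * a ≡ (c + a - m + (m - (c - + 2 * S))) * (m + + 2 * S - (c + a) + (c - m))
        identity = solve-∀

      D-value : ∀ z → z ∈ D → g z ≡ S * T
      D-value z z∈D = ℤ.≤-antisym (g-top z (L.sub z (∧-elimˡ z∈D)))
        (subst (_≤ g z) (trans (cong (λ r → S * T - r) #R≡0) (ℤ.+-identityʳ (S * T))) (D-low z z∈D))

    module Exact (σ : Split) where
      open Split σ
      open Sizes σ
      open Cover σ
      module Swapped = Cover (swap σ)

      #L+#M : # L + # M ≡ S * (+ 2 * T + + 1) + # D
      #L+#M = trans (≡-sym (ℤ.+-identityʳ (# L + # M))) (trans (cong (λ r → # L + # M + r) (≡-sym #R≡0)) inclusion-exclusion)

      #D-high : # D ≤ S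
      #D-high = by-diff (0≤diff #D+#R ⊕ #-nonneg R) (identity S (# D) (# R))
        where
        identity : ∀ S d r → S - d ≡ S - (d + r) + r
        identity = solve-∀

      -- Off `D` the squares are at most 4S². With |D| ≤ S - 1 the sum of squares would give T² ≤
      -- 4S(2T + 1), which 100S ≤ T excludes.
      #D-low : S ≤ # D
      #D-low = by-refuting λ h → absurd
        (0≤diff (cancel-≤ 1≤SS (weight′ h)) ⊕ 0≤T ⊗ (0≤T-100S ⊕ nat 87 ⊗ 0≤S) ⊕ nat 5 ⊗ 0≤S ⊗ (0≤T-100 ⊕ nat 99) ⊕ 0≤S-1)
        (identity S T)
        where
        pointwise : ∀ z → g z * g z ≤ S * T * (S * T) * b2ℤ (D z) + + 4 * (S * S) * b2ℤ (N z)
        pointwise z with z ∈? L | z ∈? M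
        ... | inj₁ z∈L | inj₁ z∈M = by-diff (nat 4 ⊗ (0≤S ⊗ 0≤S)) (trans
          (cong₂ (λ p q → S * T * (S * T) * b2ℤ p + + 4 * (S * S) * b2ℤ q - g z * g z) (∧-intro z∈L z∈M) (L.sub z z∈L))
          (trans (cong (λ v → S * T * (S * T) * + 1 + + 4 * (S * S) * + 1 - v * v) (D-value z (∧-intro z∈L z∈M)))
            (arith (S * T * (S * T)) (+ 4 * (S * S)))))
          where
          arith : ∀ c e → c * + 1 + e * + 1 - c ≡ e
          arith = solve-∀
        ... | inj₁ z∈L | inj₂ z∉M rewrite L.sub z z∈L | z∈L | z∉M =
          by-diff (0≤diff (Swapped.M-only-square z z∈L z∉M)) (arith (S * T * (S * T)) (+ 4 * (S * S)) (g z * g z))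
          where
          arith : ∀ c e q → c * + 0 + e * + 1 - q ≡ e - q
          arith = solve-∀
        ... | inj₂ z∉L | inj₁ z∈M rewrite M.sub z z∈M | z∉L =
          by-diff (0≤diff (M-only-square z z∈M z∉L)) (arith (S * T * (S * T)) (+ 4 * (S * S)) (g z * g z))
          where
          arith : ∀ c e q → c * + 0 + e * + 1 - q ≡ e - q
          arith = solve-∀
        ... | inj₂ z∉L | inj₂ z∉M with z ∈? N
        ...   | inj₁ z∈N = ⊥-elim (R-empty z (R-intro z z∈N z∉L z∉M))
        ...   | inj₂ z∉N rewrite z∉L | z∉N | f-nonadj x z z∉N =
          subst (+ 0 ≤_) (arith (S * T * (S * T)) (+ 4 * (S * S))) (nat 0)
          where
          arith : ∀ c e → + 0 ≡ c * + 0 + e * + 0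
          arith = solve-∀
        weight : S * S * S * T * T ≤ S * T * (S * T) * # D + + 4 * (S * S) * (S * (+ 2 * T + + 1))
        weight = subst₂ _≤_ (f-square x) (trans
          (sum-+ (λ z → S * T * (S * T) * b2ℤ (D z)) (λ z → + 4 * (S * S) * b2ℤ (N z)))
          (cong₂ _+_ (sum-*ˡ (S * T * (S * T)) (λ z → b2ℤ (D z)))
            (trans (sum-*ˡ (+ 4 * (S * S)) (λ z → b2ℤ (N z))) (cong (+ 4 * (S * S) *_) (degree-nb x)))))
          (sum-mono pointwise)
        weight′ : # D + + 1 ≤ S → S * S * (T * T) ≤ S * S * (+ 4 * (S * (+ 2 * T + + 1)))
        weight′ h = by-diff (0≤diff weight ⊕ (0≤ST ⊗ 0≤ST) ⊗ 0≤diff h) (arith S T (# D))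
          where
          arith : ∀ S T d → S * S * (+ 4 * (S * (+ 2 * T + + 1))) - S * S * (T * T) ≡
            S * T * (S * T) * d + + 4 * (S * S) * (S * (+ 2 * T + + 1)) - S * S * S * T * T + S * T * (S * T) * (S - (d + + 1))
          arith = solve-∀
        identity : ∀ S T → + 4 * (S * (+ 2 * T + + 1)) - T * T + T * (T - + 100 * S + + 87 * S) + + 5 * S * (T - + 100 + + 99) + (S - + 1) ≡ - + 1
        identity = solve-∀

      #D : # D ≡ S
      #D = ℤ.≤-antisym #D-high #D-low

      excess : Fin n → ℤ
      excess z = g z * g z + - (S * T * (S * T)) * b2ℤ (D z)

      excess-nonneg : ∀ z → + 0 ≤ excess z
      excess-nonneg z with z ∈? D
      ... | inj₁ z∈D = subst (+ 0 ≤_) (trans (arith (S * T * (S * T)))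
        (≡-sym (cong₂ (λ v d → v * v + - (S * T * (S * T)) * b2ℤ d) (D-value z z∈D) z∈D))) (nat 0)
        where
        arith : ∀ c → + 0 ≡ c + - c * + 1
        arith = solve-∀
      ... | inj₂ z∉D = subst (+ 0 ≤_) (trans (arith (g z * g z) (S * T * (S * T)))
        (cong (λ d → g z * g z + - (S * T * (S * T)) * b2ℤ d) (≡-sym z∉D))) (square-nonneg (g z))
        where
        arith : ∀ q c → q ≡ q + - c * + 0
        arith = solve-∀

      excess-sum : sumℤ excess ≡ + 0
      excess-sum = trans (sum-+ (λ z → g z * g z) (λ z → - (S * T * (S * T)) * b2ℤ (D z)))
        (trans (cong₂ _+_ (f-square x) (trans (sum-*ˡ (- (S * T * (S * T))) (λ z → b2ℤ (D z))) (cong (- (S * T * (S * T)) *_) #D)))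
          (arith S T))
        where
        arith : ∀ S T → S * S * S * T * T + - (S * T * (S * T)) * S ≡ + 0
        arith = solve-∀

      -- The S values ST on `D` already account for the whole sum of squares S(ST)².
      off-D : ∀ z → z ∉ D → g z ≡ + 0
      off-D z z∉D = square-zero (g z) (trans (≡-sym (arith (g z * g z) (S * T * (S * T))))
        (trans (cong (λ d → g z * g z + - (S * T * (S * T)) * b2ℤ d) (≡-sym z∉D)) (sum-nonneg-zero excess-nonneg excess-sum z)))
        where
        arith : ∀ q c → q + - c * + 0 ≡ q
        arith = solve-∀

      -- Neither clique exceeds S(T + 1), and their sizes add up to S(2T + 1) + S, twice that bound.
      #M : # M ≡ S * (T + + 1)
      #M = ℤ.≤-antisym #M-high (by-diff (0≤diff Swapped.#M-high ⊕ 0≤diff (ℤ.≤-reflexive (≡-sym #L+#M)) ⊕ 0≤diff #D-low)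
        (identity S T (# L) (# M) (# D)))
        where
        identity : ∀ S T l m d → m - S * (T + + 1) ≡ S * (T + + 1) - l + (l + m - (S * (+ 2 * T + + 1) + d)) + (d - S)
        identity = solve-∀

      -- Since g vanishes at `z`, the set `N ∩ nb z` has S(T + 1) elements, as many as its subset
      -- `M`.
      M-only : ∀ z → z ∈ M → z ∉ L → N ∩ nb z ⊆ M
      M-only z z∈M z∉L = #-full {P = M} {N ∩ nb z} (λ w w∈M → ∧-intro (M.sub w w∈M) (M.joined z w z∈M w∈M))
        (ℤ.≤-reflexive (trans (codeg-adj x z (M.sub z z∈M)) (trans (cong (λ v → S * (T + + 1) + v)
          (off-D z (cong (_∧ M z) z∉L))) (trans (ℤ.+-identityʳ (S * (T + + 1))) (≡-sym #M)))))

    fromSplit : Split → LinePair nb S T x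
    fromSplit σ = record
      { L = L ; M = M ; L⊆N = L.sub ; M⊆N = M.sub ; L-joined = L.joined ; M-joined = M.joined
      ; cover = cover ; #L = Exact.#M (swap σ) ; #M = #M ; #L∩M = #D
      ; L-only = Exact.M-only (swap σ) ; M-only = M-only }
      where
      open Split σ
      open Sizes σ
      open Cover σ
      open Exact σ

    linePair : LinePair nb S T x
    linePair = fromSplit split

  -- Least elements and ranks in a finite subset

  bool-ext : ∀ {a b} → (a ≡ true → b ≡ true) → (b ≡ true → a ≡ true) → a ≡ b
  bool-ext {true}  {true}  _ _ = refl
  bool-ext {true}  {false} p _ = ≡-sym (p refl)
  bool-ext {false} {true}  _ q = q refl
  bool-ext {false} {false} _ _ = refl

  #-ext : ∀ {n} {P Q : Subset n} → P ⊆ Q → # Q ≤ # P → ∀ z → P z ≡ Q z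
  #-ext h le z = bool-ext (h z) (#-full h le z)

  least : ∀ {n} (P : Subset n) z → z ∈ P → ∃ λ r → r ∈ P × (∀ w → w Fin.< r → w ∉ P)
  least {suc n} P z z∈P with zero ∈? P
  ... | inj₁ 0∈P = zero , 0∈P , λ _ ()
  least {suc n} P zero    z∈P | inj₂ 0∉P = clash z∈P 0∉P
  least {suc n} P (suc z) z∈P | inj₂ 0∉P with least (P ∘ suc) z z∈P
  ... | r , r∈P , h = suc r , r∈P , λ { zero _ → 0∉P ; (suc w) (ℕ.s≤s lt) → h w lt }

  rank : ∀ {n} → Subset n → Fin n → ℤ
  rank P z = # (λ w → P w ∧ does (w Fin.<? z))

  rank-nonneg : ∀ {n} (P : Subset n) z → + 0 ≤ rank P z
  rank-nonneg P z = #-nonneg (λ w → P w ∧ does (w Fin.<? z))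

  rank-mono : ∀ {n} {P : Subset n} {z z′} → z ∈ P → z Fin.< z′ → rank P z + + 1 ≤ rank P z′
  rank-mono {P = P} {z} {z′} z∈P lt = #-strict
    (λ w p → ∧-intro (∧-elimˡ p) (does-intro (w Fin.<? z′) (Fin.<-trans (does-elim (w Fin.<? z) (∧-elimʳ {P w} p)) lt)))
    z (∧-intro z∈P (does-intro (z Fin.<? z′) lt))
    (not-true (λ p → Fin.<-irrefl refl (does-elim (z Fin.<? z) (∧-elimʳ {P z} p))))

  rank-bound : ∀ {n} {P : Subset n} {z} → z ∈ P → rank P z + + 1 ≤ # P
  rank-bound {P = P} {z} z∈P = #-strict (λ w → ∧-elimˡ) z z∈P
    (not-true (λ p → Fin.<-irrefl refl (does-elim (z Fin.<? z) (∧-elimʳ {P z} p))))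

  rank-injective : ∀ {n} {P : Subset n} {z z′} → z ∈ P → z′ ∈ P → rank P z ≡ rank P z′ → z ≡ z′
  rank-injective {P = P} {z} {z′} p q e with Fin.<-cmp z z′
  ... | tri≈ _ z≡z′ _ = z≡z′
  ... | tri< lt _ _ = ⊥-elim (absurd (0≤diff (subst (rank P z + + 1 ≤_) (≡-sym e) (rank-mono p lt))) (identity (rank P z)))
    where
    identity : ∀ c → c - (c + + 1) ≡ - + 1
    identity = solve-∀
  ... | tri> _ _ gt = ⊥-elim (absurd (0≤diff (subst (rank P z′ + + 1 ≤_) e (rank-mono q gt))) (identity (rank P z′)))
    where
    identity : ∀ c → c - (c + + 1) ≡ - + 1
    identity = solve-∀

  δ-nonneg : ∀ {n} (i j : Fin n) → + 0 ≤ δ i j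
  δ-nonneg zero    zero    = nat 1
  δ-nonneg zero    (suc _) = nat 0
  δ-nonneg (suc _) zero    = nat 0
  δ-nonneg (suc i) (suc j) = δ-nonneg i j

  #-subsingleton : ∀ {n} {P : Subset n} c b → (∀ r → r ∈ P → r ≡ c × b ≡ true) → # P ≤ b2ℤ b
  #-subsingleton {P = P} c b h = subst (# P ≤_) (sum-point c (b2ℤ b)) (sum-mono pointwise)
    where
    pointwise : ∀ r → b2ℤ (P r) ≤ δ c r * b2ℤ b
    pointwise r with r ∈? P
    ... | inj₂ r∉P rewrite r∉P = δ-nonneg c r ⊗ b2ℤ-nonneg b
    ... | inj₁ r∈P with h r r∈P
    ...   | refl , refl rewrite r∈P | δ-diag c = ℤ.≤-refl

  -- Points and lines

  module Geometry {n} (S T : ℤ) (1≤S : + 1 ≤ S) (1≤ST : + 1 ≤ S * T) (𝒟 : CountingData n S T)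
    (pair : ∀ x → LinePair (CountingData.nb 𝒟) S T x) where
    open CountingData 𝒟

    nb-flip : ∀ {x y b} → nb x y ≡ b → nb y x ≡ b
    nb-flip {x} {y} h = trans (nb-sym y x) h

    0≤S : + 0 ≤ S
    0≤S = ℤ.≤-trans (nat 1) 1≤S

    swapPair : ∀ {x} → LinePair nb S T x → LinePair nb S T x
    swapPair p = record
      { L = M ; M = L ; L⊆N = M⊆N ; M⊆N = L⊆N ; L-joined = M-joined ; M-joined = L-joined
      ; cover = λ z q → Sum.swap (cover z q)
      ; #L = #M ; #M = #L ; #L∩M = trans (sum-cong (λ z → cong b2ℤ (Bool.∧-comm (M z) (L z)))) #L∩M
      ; L-only = M-only ; M-only = L-only }
      where open LinePair p

    record Line (Q : Subset n) : Set where
      field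
        joined : ∀ u v → u ∈ Q → v ∈ Q → nb u v ≡ true
        size   : # Q ≡ S * (T + + 1)

    L-line : ∀ {x} (p : LinePair nb S T x) → Line (LinePair.L p)
    L-line p = record { joined = LinePair.L-joined p ; size = LinePair.#L p }

    Twin : Fin n → Fin n → Set
    Twin x z = ∀ w → nb x w ≡ nb z w

    twin-sym : ∀ {x z} → Twin x z → Twin z x
    twin-sym h w = ≡-sym (h w)

    twin-trans : ∀ {x y z} → Twin x y → Twin y z → Twin x z
    twin-trans h k w = trans (h w) (k w)

    twin∈nb : ∀ {x z} → Twin x z → z ∈ nb x
    twin∈nb {x} {z} h = trans (h z) (nb-refl z)

    nb⊈line : ∀ x {Q} → # Q ≡ S * (T + + 1) → nb x ⊆ Q → ⊥
    nb⊈line x e h = absurd (0≤diff (subst₂ _≤_ (degree-nb x) e (#-mono h)) ⊕ 0≤diff 1≤ST) (identity S T)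
      where
      identity : ∀ S T → S * (T + + 1) - S * (+ 2 * T + + 1) + (S * T - + 1) ≡ - + 1
      identity = solve-∀

    line≰S : ∀ {c} → c ≡ S * (T + + 1) → c ≤ S → ⊥
    line≰S refl h = absurd (0≤diff h ⊕ 0≤diff 1≤ST) (identity S T)
      where
      identity : ∀ S T → S - S * (T + + 1) + (S * T - + 1) ≡ - + 1
      identity = solve-∀

    -- A vertex of both lines is adjacent to all of `nb x`, and equal degrees turn this inclusion
    -- into equality.
    meet-twin : ∀ {x} (p : LinePair nb S T x) → ∀ z → z ∈ LinePair.L p → z ∈ LinePair.M p → Twin x z
    meet-twin {x} p z z∈L z∈M = #-ext {P = nb x} {nb z} sub
      (ℤ.≤-reflexive (trans (degree-nb z) (≡-sym (degree-nb x))))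
      where
      open LinePair p
      sub : nb x ⊆ nb z
      sub w xw with cover w xw
      ... | inj₁ w∈L = L-joined z w z∈L w∈L
      ... | inj₂ w∈M = M-joined z w z∈M w∈M

    -- A twin in `M` but not in `L` would confine all of `nb x` to `M` by `M-only`, and `M` is too
    -- small for that.
    twin∈L : ∀ {x} (p : LinePair nb S T x) → ∀ z → Twin x z → z ∈ LinePair.L p
    twin∈L {x} p z h with LinePair.cover p z (twin∈nb h)
    ... | inj₁ z∈L = z∈L
    ... | inj₂ z∈M with z ∈? LinePair.L p
    ...   | inj₁ z∈L = z∈L
    ...   | inj₂ z∉L = ⊥-elim (nb⊈line x (LinePair.#M p)
      (λ w xw → LinePair.M-only p z z∈M z∉L w (∧-intro xw (trans (≡-sym (h w)) xw))))

    -- A clique of line size is too big for `L ∩ M`, so it has a vertex `w` on just one of the two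
    -- lines; all of `Q` is adjacent to `x` and `w`, hence lies on that line and fills it. Lines
    -- thus do not depend on the vertex from which they were obtained.
    line-at : ∀ {x} (p : LinePair nb S T x) {Q} → Line Q → x ∈ Q →
      (∀ w → Q w ≡ LinePair.L p w) ⊎ (∀ w → Q w ≡ LinePair.M p w)
    line-at {x} p {Q} ℓ x∈Q with Fin.any? (λ w → (Q w Bool.≟ true) ×-dec ((L ∩ M) w Bool.≟ false))
      where open LinePair p
    ... | no none = ⊥-elim (line≰S (Line.size ℓ) (subst (# Q ≤_) #L∩M (#-mono inside)))
      where
      open LinePair p
      inside : Q ⊆ L ∩ M
      inside w w∈Q with w ∈? (L ∩ M)
      ... | inj₁ q = q
      ... | inj₂ q = contradiction (w , w∈Q , q) none
    ... | yes (w , w∈Q , w∉D) with LinePair.cover p w (Line.joined ℓ x w x∈Q w∈Q)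
    ...   | inj₁ w∈L = inj₁ (#-ext {P = Q} {L} (λ u u∈Q → L-only w w∈L w∉M u
              (∧-intro (joined x u x∈Q u∈Q) (joined w u w∈Q u∈Q))) (ℤ.≤-reflexive (trans #L (≡-sym size))))
      where
      open LinePair p
      open Line ℓ
      w∉M = not-true (λ w∈M → clash (∧-intro w∈L w∈M) w∉D)
    ...   | inj₂ w∈M = inj₂ (#-ext {P = Q} {M} (λ u u∈Q → M-only w w∈M w∉L u
              (∧-intro (joined x u x∈Q u∈Q) (joined w u w∈Q u∈Q))) (ℤ.≤-reflexive (trans #M (≡-sym size))))
      where
      open LinePair p
      open Line ℓ
      w∉L = not-true (λ w∈L → clash (∧-intro w∈L w∈M) w∉D)

    -- The second line through `z`, with the properties of the pair stated so that it no longer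
    -- matters whether `Q` is the `L` or the `M` chosen at `z`.
    record Other (Q : Subset n) (z : Fin n) : Set where
      field
        Q′     : Subset n
        line   : Line Q′
        Q′⊆nb  : Q′ ⊆ nb z
        cover  : ∀ w → w ∈ nb z → w ∉ Q → w ∈ Q′
        meet   : ∀ w → w ∈ Q → w ∈ Q′ → Twin z w
        twin∈Q  : ∀ w → Twin z w → w ∈ Q
        twin∈Q′ : ∀ w → Twin z w → w ∈ Q′
        only   : ∀ w → w ∈ Q → w ∉ Q′ → nb z ∩ nb w ⊆ Q
        #meet  : # (Q ∩ Q′) ≡ S

    fromPair : ∀ {x} (p : LinePair nb S T x) {Q} → (∀ w → Q w ≡ LinePair.L p w) → Other Q x
    fromPair {x} p {Q} e = record
      { Q′ = M ; line = L-line (swapPair p) ; Q′⊆nb = M⊆N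
      ; cover = λ w xw w∉Q → [ (λ w∈L → clash (Q∋ w w∈L) w∉Q) , (λ w∈M → w∈M) ]′ (cover w xw)
      ; meet = λ w w∈Q w∈M → meet-twin p w (∋L w w∈Q) w∈M
      ; twin∈Q = λ w h → Q∋ w (twin∈L p w h)
      ; twin∈Q′ = λ w h → twin∈L (swapPair p) w h
      ; only = λ w w∈Q w∉M u q → Q∋ u (L-only w (∋L w w∈Q) w∉M u q)
      ; #meet = trans (sum-cong (λ w → cong (λ q → b2ℤ (q ∧ M w)) (e w))) #L∩M }
      where
      open LinePair p
      Q∋ : L ⊆ Q
      Q∋ w w∈L = trans (e w) w∈L
      ∋L : Q ⊆ L
      ∋L w w∈Q = trans (≡-sym (e w)) w∈Q

    other : ∀ {Q} → Line Q → ∀ z → z ∈ Q → Other Q z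
    other ℓ z z∈Q with line-at (pair z) ℓ z∈Q
    ... | inj₁ e = fromPair (pair z) e
    ... | inj₂ e = fromPair (swapPair (pair z)) e

    twin? : ∀ x z → Dec (Twin x z)
    twin? x z = Fin.all? (λ w → nb x w Bool.≟ nb z w)

    tw : Fin n → Subset n
    tw x z = does (twin? x z)

    #tw : ∀ x → # (tw x) ≡ S
    #tw x = trans (sum-cong (λ z → cong b2ℤ (bool-ext
      (λ h → ∧-intro (twin∈L (pair x) z (does-elim (twin? x z) h)) (twin∈L (swapPair (pair x)) z (does-elim (twin? x z) h)))
      (λ h → does-intro (twin? x z) (meet-twin (pair x) z (∧-elimˡ h) (∧-elimʳ {L z} h)))))) #L∩M
      where open LinePair (pair x)

    -- y lies on the line through z other than Q; for y on Q this means that y is a twin of z.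
    Proj : Subset n → Fin n → Fin n → Set
    Proj Q y z = z ∈ Q × (y ∈ Q × Twin y z ⊎ y ∉ Q × nb y z ≡ true)

    proj→other : ∀ {Q y z} (o : Other Q z) → Proj Q y z → y ∈ Other.Q′ o
    proj→other o (z∈Q , inj₁ (y∈Q , h))  = Other.twin∈Q′ o _ (twin-sym h)
    proj→other o (z∈Q , inj₂ (y∉Q , yz)) = Other.cover o _ (nb-flip yz) y∉Q

    other→proj : ∀ {Q y z} (o : Other Q z) → z ∈ Q → y ∈ Other.Q′ o → Proj Q y z
    other→proj {Q} {y} o z∈Q y∈Q′ with y ∈? Q
    ... | inj₁ y∈Q = z∈Q , inj₁ (y∈Q , twin-sym (Other.meet o y y∈Q y∈Q′))
    ... | inj₂ y∉Q = z∈Q , inj₂ (y∉Q , nb-flip (Other.Q′⊆nb o y y∈Q′))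

    -- If `z` and `z′` on `Q` are not twins, then `z′` is not on the second line through `z`, and
    -- every common neighbour of the two lies on `Q`; so `y` outside `Q` cannot be adjacent to both.
    proj-unique : ∀ {Q y z z′} → Line Q → Proj Q y z → Proj Q y z′ → Twin z z′
    proj-unique ℓ (_ , inj₁ (_ , h))   (_ , inj₁ (_ , h′))  = twin-trans (twin-sym h) h′
    proj-unique ℓ (_ , inj₁ (y∈Q , _)) (_ , inj₂ (y∉Q , _)) = clash y∈Q y∉Q
    proj-unique ℓ (_ , inj₂ (y∉Q , _)) (_ , inj₁ (y∈Q , _)) = clash y∈Q y∉Q
    proj-unique {Q} {y} {z} {z′} ℓ (z∈Q , inj₂ (y∉Q , yz)) (z′∈Q , inj₂ (_ , yz′)) with z′ ∈? Other.Q′ (other ℓ z z∈Q)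
    ... | inj₁ z′∈Q′ = Other.meet (other ℓ z z∈Q) z′ z′∈Q z′∈Q′
    ... | inj₂ z′∉Q′ = clash (Other.only (other ℓ z z∈Q) z′ z′∈Q z′∉Q′ y (∧-intro (nb-flip yz) (nb-flip yz′))) y∉Q

    proj-twin : ∀ {Q y z z′} → Line Q → Twin z z′ → Proj Q y z → Proj Q y z′
    proj-twin {y = y} {z} {z′} ℓ h (z∈Q , r) = Other.twin∈Q (other ℓ z z∈Q) z′ h , lift r
      where
      lift : _ ⊎ _ → _ ⊎ _
      lift (inj₁ (y∈Q , k))  = inj₁ (y∈Q , twin-trans k h)
      lift (inj₂ (y∉Q , yz)) = inj₂ (y∉Q , nb-flip (trans (≡-sym (h y)) (nb-flip yz)))

    -- By `proj-unique` these neighbours lie in a single twin class, which has S elements.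
    #nb∩line : ∀ {Q} → Line Q → ∀ y → y ∉ Q → # (nb y ∩ Q) ≤ S
    #nb∩line {Q} ℓ y y∉Q with Fin.any? (λ z → (nb y ∩ Q) z Bool.≟ true)
    ... | yes (z , q) = subst (# (nb y ∩ Q) ≤_) (#tw z) (#-mono {P = nb y ∩ Q} {tw z} (λ w r →
      does-intro (twin? z w) (proj-unique ℓ (∧-elimʳ {nb y z} q , inj₂ (y∉Q , ∧-elimˡ q)) (∧-elimʳ {nb y w} r , inj₂ (y∉Q , ∧-elimˡ r)))))
    ... | no none = ℤ.≤-trans (ℤ.≤-reflexive (sum-zero (λ z → cong b2ℤ (not-true (λ q → none (z , q)))))) 0≤S

    -- For `y` nonadjacent to `x` there are 2S common neighbours, all on `L` or `M`. At most S of
    -- them lie on `M`, so some lie on `L`.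
    proj-exists : ∀ {x} (p : LinePair nb S T x) y → ∃ (Proj (LinePair.L p) y)
    proj-exists {x} p y with y ∈? L
      where open LinePair p
    ... | inj₁ y∈L = y , y∈L , inj₁ (y∈L , λ _ → refl)
    ... | inj₂ y∉L with y ∈? nb x
    ...   | inj₁ xy = x , twin∈L p x (λ _ → refl) , inj₂ (y∉L , nb-flip xy)
    ...   | inj₂ xy with Fin.any? (λ z → (nb y ∩ LinePair.L p) z Bool.≟ true)
    ...     | yes (z , q) = z , ∧-elimʳ {nb y z} q , inj₂ (y∉L , ∧-elimˡ q)
    ...     | no none = ⊥-elim (absurd (0≤diff bound′ ⊕ 0≤diff (#nb∩line (L-line (swapPair p)) y y∉M) ⊕ 0≤diff 1≤S)
                (identity S (# (nb y ∩ M))))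
      where
      open LinePair p
      y∉M = not-true (λ y∈M → clash (M⊆N y y∈M) xy)
      covering : ∀ w → w ∈ nb x ∩ nb y → w ∈ nb y ∩ L ⊎ w ∈ nb y ∩ M
      covering w q with cover w (∧-elimˡ q)
      ... | inj₁ w∈L = inj₁ (∧-intro (∧-elimʳ {nb x w} q) w∈L)
      ... | inj₂ w∈M = inj₂ (∧-intro (∧-elimʳ {nb x w} q) w∈M)
      bound′ : + 2 * S ≤ + 0 + # (nb y ∩ M)
      bound′ = subst₂ _≤_ (codeg-nonadj x y xy)
        (cong (λ c → c + # (nb y ∩ M)) (sum-zero (λ z → cong b2ℤ (not-true (λ q → none (z , q))))))
        (#-cover₂ {P = nb x ∩ nb y} (nb y ∩ L) (nb y ∩ M) covering)
      identity : ∀ S c → + 0 + c - + 2 * S + (S - c) + (S - + 1) ≡ - + 1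
      identity = solve-∀

    -- Coordinates relative to a fixed vertex

    module Coordinates (x : Fin n) where
      open LinePair (pair x)

      ℓ : Line L
      ℓ = L-line (pair x)
      m : Line M
      m = L-line (swapPair (pair x))

      row-proj : ∀ y → ∃ (Proj L y)
      row-proj = proj-exists (pair x)
      col-proj : ∀ y → ∃ (Proj M y)
      col-proj = proj-exists (swapPair (pair x))

      row col : Fin n → Fin n
      row y = proj₁ (row-proj y)
      col y = proj₁ (col-proj y)

      row∈L : ∀ y → row y ∈ L
      row∈L y = proj₁ (proj₂ (row-proj y))
      col∈M : ∀ y → col y ∈ M
      col∈M y = proj₁ (proj₂ (col-proj y))

      vertical : ∀ y → Other L (row y)
      vertical y = other ℓ (row y) (row∈L y)
      horizontal : ∀ y → Other M (col y)
      horizontal y = other m (col y) (col∈M y)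

      V H : Fin n → Subset n
      V y = Other.Q′ (vertical y)
      H y = Other.Q′ (horizontal y)

      y∈V : ∀ y → y ∈ V y
      y∈V y = proj→other (vertical y) (proj₂ (row-proj y))
      y∈H : ∀ y → y ∈ H y
      y∈H y = proj→other (horizontal y) (proj₂ (col-proj y))

      same-row : ∀ y y′ → Twin (row y) (row y′) → y′ ∈ V y
      same-row y y′ h = proj→other (vertical y) (proj-twin ℓ (twin-sym h) (proj₂ (row-proj y′)))
      same-col : ∀ y y′ → Twin (col y) (col y′) → y′ ∈ H y
      same-col y y′ h = proj→other (horizontal y) (proj-twin m (twin-sym h) (proj₂ (col-proj y′)))

      in-V : ∀ y y′ → y′ ∈ V y → Twin (row y) (row y′)
      in-V y y′ q = proj-unique ℓ (other→proj (vertical y) (row∈L y) q) (proj₂ (row-proj y′))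
      in-H : ∀ y y′ → y′ ∈ H y → Twin (col y) (col y′)
      in-H y y′ q = proj-unique m (other→proj (horizontal y) (col∈M y) q) (proj₂ (col-proj y′))

      full-meet : ∀ {P Q} → Line P → # (P ∩ Q) ≡ S → P ⊆ Q → ⊥
      full-meet {P} {Q} ℓ′ e h = line≰S (Line.size ℓ′)
        (subst (# P ≤_) e (#-mono {P = P} {P ∩ Q} (λ w w∈P → ∧-intro w∈P (h w w∈P))))

      M⊆V : ∀ y → row y ∈ M → M ⊆ V y
      M⊆V y z∈M u u∈M with u ∈? L
      ... | inj₁ u∈L = Other.twin∈Q′ (vertical y) u (twin-trans (twin-sym (meet-twin (pair x) (row y) (row∈L y) z∈M))
                         (meet-twin (pair x) u u∈L u∈M))
      ... | inj₂ u∉L = Other.cover (vertical y) u (M-joined (row y) u z∈M u∈M) u∉L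

      L⊆H : ∀ y → col y ∈ L → L ⊆ H y
      L⊆H y z∈L u u∈L with u ∈? M
      ... | inj₁ u∈M = Other.twin∈Q′ (horizontal y) u (twin-trans (twin-sym (meet-twin (pair x) (col y) z∈L (col∈M y)))
                         (meet-twin (pair x) u u∈L u∈M))
      ... | inj₂ u∉M = Other.cover (horizontal y) u (L-joined (col y) u z∈L u∈L) u∉M

      -- If `row y` lies on `M`, then `V y` contains `M`, whereas `H y` meets `M` in only S
      -- vertices; likewise if `col y` lies on `L`. Otherwise a common line would make `row y` and
      -- `col y` adjacent, contrary to `L-only`.
      V≢H : ∀ y → (∀ w → H y w ≡ V y w) → ⊥
      V≢H y e with row y ∈? M | col y ∈? L
      ... | inj₁ z∈M | _ = full-meet m (Other.#meet (horizontal y)) (λ w w∈M → trans (e w) (M⊆V y z∈M w w∈M))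
      ... | inj₂ _ | inj₁ w∈L = full-meet ℓ (Other.#meet (vertical y)) (λ w w∈L′ → trans (≡-sym (e w)) (L⊆H y w∈L w w∈L′))
      ... | inj₂ z∉M | inj₂ w∉L = clash (L-only (row y) (row∈L y) z∉M (col y) (∧-intro (M⊆N (col y) (col∈M y))
        (Line.joined (Other.line (vertical y)) (row y) (col y) (Other.twin∈Q′ (vertical y) (row y) (λ _ → refl))
          (trans (≡-sym (e (col y))) (Other.twin∈Q′ (horizontal y) (col y) (λ _ → refl)))))) w∉L

      -- By `line-at`, each of `V y` and `H y` is one of the two lines through `y`; being different,
      -- they are both of them, in one order or the other.
      lines-through : ∀ y → (∀ w → nb y w ≡ true → w ∈ V y ⊎ w ∈ H y) × (∀ w → w ∈ V y → w ∈ H y → Twin y w)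
      lines-through y with line-at (pair y) (Other.line (vertical y)) (y∈V y) | line-at (pair y) (Other.line (horizontal y)) (y∈H y)
      ... | inj₁ e | inj₁ e′ = ⊥-elim (V≢H y (λ w → trans (e′ w) (≡-sym (e w))))
      ... | inj₂ e | inj₂ e′ = ⊥-elim (V≢H y (λ w → trans (e′ w) (≡-sym (e w))))
      ... | inj₁ e | inj₂ e′ =
        (λ w yw → Sum.map (trans (e w)) (trans (e′ w)) (LinePair.cover (pair y) w yw)) ,
        (λ w p q → meet-twin (pair y) w (trans (≡-sym (e w)) p) (trans (≡-sym (e′ w)) q))
      ... | inj₂ e | inj₁ e′ =
        (λ w yw → Sum.map (trans (e w)) (trans (e′ w)) (LinePair.cover (swapPair (pair y)) w yw)) ,
        (λ w p q → meet-twin (pair y) w (trans (≡-sym (e′ w)) q) (trans (≡-sym (e w)) p))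

      adjacent⇒collinear : ∀ y w → nb y w ≡ true → Twin (row y) (row w) ⊎ Twin (col y) (col w)
      adjacent⇒collinear y w yw = Sum.map (in-V y w) (in-H y w) (proj₁ (lines-through y) w yw)

      same-row⇒adjacent : ∀ y w → Twin (row y) (row w) → nb y w ≡ true
      same-row⇒adjacent y w h = Line.joined (Other.line (vertical y)) y w (y∈V y) (same-row y w h)

      same-col⇒adjacent : ∀ y w → Twin (col y) (col w) → nb y w ≡ true
      same-col⇒adjacent y w h = Line.joined (Other.line (horizontal y)) y w (y∈H y) (same-col y w h)

      same-position⇒twin : ∀ y w → Twin (row y) (row w) → Twin (col y) (col w) → Twin y w
      same-position⇒twin y w h k = proj₂ (lines-through y) w (same-row y w h) (same-col y w k)

    -- Numbering the twin classes and their members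

    rep : Fin n → Fin n
    rep z = proj₁ (least (tw z) z (does-intro (twin? z z) (λ _ → refl)))

    rep-twin : ∀ z → Twin z (rep z)
    rep-twin z = does-elim (twin? z (rep z)) (proj₁ (proj₂ (least (tw z) z (does-intro (twin? z z) (λ _ → refl)))))

    rep-least : ∀ z w → w Fin.< rep z → ¬ Twin z w
    rep-least z w lt = does-refute (twin? z w) (proj₂ (proj₂ (least (tw z) z (does-intro (twin? z z) (λ _ → refl)))) w lt)

    rep-cong : ∀ {z z′} → Twin z z′ → rep z ≡ rep z′
    rep-cong {z} {z′} h with Fin.<-cmp (rep z) (rep z′)
    ... | tri≈ _ e _ = e
    ... | tri< lt _ _ = contradiction (twin-trans (twin-sym h) (rep-twin z)) (rep-least z′ (rep z) lt)
    ... | tri> _ _ gt = contradiction (twin-trans h (rep-twin z′)) (rep-least z (rep z′) gt)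

    rep-injective : ∀ {z z′} → rep z ≡ rep z′ → Twin z z′
    rep-injective {z} {z′} e = twin-trans (rep-twin z) (subst (λ r → Twin r z′) (≡-sym e) (twin-sym (rep-twin z′)))

    Reps : Subset n → Subset n
    Reps Q w = Q w ∧ does (w Fin.≟ rep w)

    rep∈Reps : ∀ {Q} → Line Q → ∀ z → z ∈ Q → rep z ∈ Reps Q
    rep∈Reps ℓ z z∈Q = ∧-intro (Other.twin∈Q (other ℓ z z∈Q) (rep z) (rep-twin z))
      (does-intro (rep z Fin.≟ rep (rep z)) (rep-cong (rep-twin z)))

    -- Count the pairs of a representative on Q and a twin of it.
    #Reps : ∀ {Q} → Line Q → # (Reps Q) ≤ T + + 1
    #Reps {Q} ℓ = cancel-≤ 1≤S (subst₂ _≤_ pairs (Line.size ℓ) (sum-mono one))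
      where
      one : ∀ z → # (λ r → Reps Q r ∧ tw r z) ≤ b2ℤ (Q z)
      one z = #-subsingleton (rep z) (Q z) (λ r h → let h′ = ∧-elimˡ {Reps Q r} h ; tz = does-elim (twin? r z) (∧-elimʳ {Reps Q r} h) in
        trans (does-elim (r Fin.≟ rep r) (∧-elimʳ {Q r} h′)) (rep-cong tz) , Other.twin∈Q (other ℓ r (∧-elimˡ h′)) z tz)
      pairs : sumℤ (λ z → # (λ r → Reps Q r ∧ tw r z)) ≡ S * # (Reps Q)
      pairs = trans (sum-swap (λ z r → b2ℤ (Reps Q r ∧ tw r z))) (trans
        (sum-cong (λ r → trans (sum-cong (λ z → b2ℤ-∧ (Reps Q r) (tw r z)))
          (trans (sum-*ˡ (b2ℤ (Reps Q r)) (λ z → b2ℤ (tw r z))) (trans (cong (b2ℤ (Reps Q r) *_) (#tw r)) (ℤ.*-comm (b2ℤ (Reps Q r)) S)))))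
        (sum-*ˡ S (λ r → b2ℤ (Reps Q r))))

    -- One representative per twin class is counted, so the labels on a line run within 0, ..., T
    -- and separate exactly the twin classes.
    label : Subset n → Fin n → ℤ
    label Q z = rank (Reps Q) (rep z)

    label-bound : ∀ {Q} → Line Q → ∀ z → z ∈ Q → label Q z + + 1 ≤ T + + 1
    label-bound {Q} ℓ z z∈Q = ℤ.≤-trans (rank-bound {P = Reps Q} {rep z} (rep∈Reps ℓ z z∈Q)) (#Reps ℓ)

    label-injective : ∀ {Q} → Line Q → ∀ z z′ → z ∈ Q → z′ ∈ Q → label Q z ≡ label Q z′ → Twin z z′
    label-injective {Q} ℓ z z′ p q e = rep-injective (rank-injective {P = Reps Q} (rep∈Reps ℓ z p) (rep∈Reps ℓ z′ q) e)

    label-cong : ∀ Q {z z′} → Twin z z′ → label Q z ≡ label Q z′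
    label-cong Q h = cong (rank (Reps Q)) (rep-cong h)

    index : Fin n → ℤ
    index y = rank (tw y) y

    index-bound : ∀ y → index y + + 1 ≤ S
    index-bound y = subst (index y + + 1 ≤_) (#tw y) (rank-bound {P = tw y} {y} (does-intro (twin? y y) (λ _ → refl)))

    index-injective : ∀ y y′ → Twin y y′ → index y ≡ index y′ → y ≡ y′
    index-injective y y′ h e = rank-injective {P = tw y} (does-intro (twin? y y) (λ _ → refl)) (does-intro (twin? y y′) h)
      (trans e (sum-cong (λ w → cong (λ c → b2ℤ (c ∧ does (w Fin.<? y′))) (bool-ext
        (λ p → does-intro (twin? y w) (twin-trans h (does-elim (twin? y′ w) p)))
        (λ p → does-intro (twin? y′ w) (twin-trans (twin-sym h) (does-elim (twin? y w) p)))))))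

  -- The isomorphism with the clique extension of the grid

  injective⇒surjective : ∀ {m n} → m ≡ n → (f : Fin m → Fin n) → Injective _≡_ _≡_ f → ∀ y → ∃ λ x → f x ≡ y
  injective⇒surjective {suc n} refl f inj y with Fin.any? (λ x → f x Fin.≟ y)
  ... | yes hit = hit
  -- A missed value can be punched out of the codomain, which leaves an injection into a smaller
  -- finite set.
  ... | no miss = contradiction (Fin.injective⇒≤ punched) ℕ.1+n≰n
    where
    y≢f : ∀ x → y ≢ f x
    y≢f x e = miss (x , ≡-sym e)
    punched : Injective _≡_ _≡_ (λ x → Fin.punchOut (y≢f x))
    punched {a} {b} e = inj (Fin.punchOut-injective (y≢f a) (y≢f b) e)

  toFin : ∀ {m} c → + 0 ≤ c → c + + 1 ≤ + m → Fin m
  toFin {m} (+ k) _ h = Fin.fromℕ< (subst (ℕ._≤ m) (ℕ.+-comm k 1) (ℤ.drop‿+≤+ h))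

  toFin-injective : ∀ {m} c c′ (p : + 0 ≤ c) (p′ : + 0 ≤ c′) (q : c + + 1 ≤ + m) (q′ : c′ + + 1 ≤ + m) →
    toFin c p q ≡ toFin c′ p′ q′ → c ≡ c′
  toFin-injective (+ k) (+ k′) _ _ q q′ e = cong +_ (Fin.fromℕ<-injective k k′ _ _ e)

  toFin-cong : ∀ {m c c′} {p : + 0 ≤ c} {p′ : + 0 ≤ c′} {q : c + + 1 ≤ + m} {q′ : c′ + + 1 ≤ + m} →
    c ≡ c′ → toFin c p q ≡ toFin c′ p′ q′
  toFin-cong {c = + k} refl = Fin.fromℕ<-cong k k refl _ _

  module Isomorphism (s t : ℕ) (1≤S : + 1 ≤ + s) (1≤ST : + 1 ≤ + s * + t) {n} (Γ : Graph n)
    (𝒟 : CountingData n (+ s) (+ t)) (nb≡closed : ∀ x y → CountingData.nb 𝒟 x y ≡ closed Γ x y)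
    (pair : ∀ x → LinePair (CountingData.nb 𝒟) (+ s) (+ t) x) (x₀ : Fin n) where
    open CountingData 𝒟
    open Geometry (+ s) (+ t) 1≤S 1≤ST 𝒟 pair
    open Coordinates x₀
    open LinePair (pair x₀) using (L; M)

    m′ : ℕ
    m′ = t ℕ.+ 1

    i j : Fin n → Fin m′
    i y = toFin (label L (row y)) (rank-nonneg (Reps L) (rep (row y))) (label-bound ℓ (row y) (row∈L y))
    j y = toFin (label M (col y)) (rank-nonneg (Reps M) (rep (col y))) (label-bound m (col y) (col∈M y))

    k : Fin n → Fin s
    k y = toFin (index y) (rank-nonneg (tw y) y) (index-bound y)

    position : Fin n → (Fin m′ × Fin m′) × Fin s
    position y = (i y , j y) , k y

    i-twin : ∀ y w → i y ≡ i w → Twin (row y) (row w)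
    i-twin y w e = label-injective ℓ (row y) (row w) (row∈L y) (row∈L w) (toFin-injective _ _ _ _ _ _ e)

    j-twin : ∀ y w → j y ≡ j w → Twin (col y) (col w)
    j-twin y w e = label-injective m (col y) (col w) (col∈M y) (col∈M w) (toFin-injective _ _ _ _ _ _ e)

    adjacent⇒ : ∀ y w → nb y w ≡ true → i y ≡ i w ⊎ j y ≡ j w
    adjacent⇒ y w yw = Sum.map (λ h → toFin-cong (label-cong L h)) (λ h → toFin-cong (label-cong M h)) (adjacent⇒collinear y w yw)

    position-injective : ∀ {y w} → position y ≡ position w → y ≡ w
    position-injective {y} {w} e = index-injective y w
      (same-position⇒twin y w (i-twin y w (cong (proj₁ ∘ proj₁) e)) (j-twin y w (cong (proj₂ ∘ proj₁) e)))
      (toFin-injective _ _ _ _ _ _ (cong proj₂ e))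

    size : n ≡ m′ ℕ.* m′ ℕ.* s
    size = ℤ.+-injective (trans order (trans (ℤ.*-comm (+ s) ((+ t + + 1) * (+ t + + 1)))
      (trans (cong (_* + s) (≡-sym (ℤ.pos-* m′ m′))) (≡-sym (ℤ.pos-* (m′ ℕ.* m′) s)))))

    code : (Fin m′ × Fin m′) × Fin s → Fin (m′ ℕ.* m′ ℕ.* s)
    code ((a , b) , c) = Fin.combine (Fin.combine a b) c

    code-injective : ∀ {v v′} → code v ≡ code v′ → v ≡ v′
    code-injective {(a , b) , c} {(a′ , b′) , c′} e =
      let (e₁ , e₂) = Fin.combine-injective (Fin.combine a b) c (Fin.combine a′ b′) c′ e
          (e₃ , e₄) = Fin.combine-injective a b a′ b′ e₁
      in cong₂ _,_ (cong₂ _,_ e₃ e₄) e₂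

    -- No vertex is constructed from its coordinates: `position` is injective and both sides have
    -- s(t + 1)² elements. `code` flattens the product to make the counting argument applicable.
    preimage : ∀ v → ∃ λ y → position y ≡ v
    preimage v = let (y , e) = injective⇒surjective size (λ y → code (position y)) code-position-injective (code v)
      in y , code-injective {position y} {v} e
      where
      code-position-injective : Injective _≡_ _≡_ (λ y → code (position y))
      code-position-injective {y} {w} e = position-injective {y} {w} (code-injective {position y} {position w} e)

    bijection : Fin n ↔ ((Fin m′ × Fin m′) × Fin s)
    bijection = mk↔ₛ′ position (proj₁ ∘ preimage) (proj₂ ∘ preimage)
      (λ y → position-injective {proj₁ (preimage (position y))} {y} (proj₂ (preimage (position y))))

    forward : ∀ y w → adj Γ y w ≡ true → CliqueExtAdj (GridAdj m′) s (position y) (position w)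
    forward y w yw = (λ e → y≢w (position-injective e)) , grid (i y Fin.≟ i w) (j y Fin.≟ j w)
      where
      y≢w : y ≢ w
      y≢w refl = clash yw (irrefl Γ y)
      collinear : i y ≡ i w ⊎ j y ≡ j w
      collinear = adjacent⇒ y w (trans (nb≡closed y w) (trans (closed-distinct Γ y w y≢w) yw))
      grid : Dec (i y ≡ i w) → Dec (j y ≡ j w) → (i y , j y) ≡ (i w , j w) ⊎ GridAdj m′ (i y , j y) (i w , j w)
      grid (yes p) (yes q) = inj₁ (cong₂ _,_ p q)
      grid (yes p) (no q)  = inj₂ (inj₁ (p , q))
      grid (no p)  (yes q) = inj₂ (inj₂ (p , q))
      grid (no p)  (no q)  = contradiction collinear [ p , q ]′

    backward : ∀ y w → CliqueExtAdj (GridAdj m′) s (position y) (position w) → adj Γ y w ≡ true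
    backward y w (ne , h) = trans (≡-sym (closed-distinct Γ y w (ne ∘ cong position))) (trans (≡-sym (nb≡closed y w)) (nb-true h))
      where
      nb-true : (i y , j y) ≡ (i w , j w) ⊎ GridAdj m′ (i y , j y) (i w , j w) → nb y w ≡ true
      nb-true (inj₁ e)              = same-row⇒adjacent y w (i-twin y w (cong proj₁ e))
      nb-true (inj₂ (inj₁ (p , _))) = same-row⇒adjacent y w (i-twin y w p)
      nb-true (inj₂ (inj₂ (_ , q))) = same-col⇒adjacent y w (j-twin y w q)

    isomorphism : CliqueExtGridIso Γ s (t ℕ.+ 1)
    isomorphism = bijection , λ y w → forward y w , backward y w

  vertex : ∀ {n} → + n ≢ + 0 → Fin n
  vertex {zero}  h = contradiction refl h
  vertex {suc n} h = zero

  large-enough : ∀ s t → 1 ℕ.≤ s → 11 ℕ.* ((s ℕ.+ 1) ℕ.^ 3) ℕ.* (s ℕ.+ 2) ℕ.≤ t → + 100 * + s * + s ≤ + t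
  large-enough (suc s) t _ h = ℤ.≤-trans (ℤ.≤-reflexive (≡-sym (trans (ℤ.pos-* (100 ℕ.* suc s) (suc s)) (cong (_* + suc s) (ℤ.pos-* 100 (suc s))))))
    (ℤ.+≤+ (ℕ.≤-trans (ℕ.≤-trans (ℕ.m≤m+n _ _) (ℕ.≤-reflexive (identity s))) h))
    where
    -- With the variable shifted by one to use s ≥ 1, the difference of the two bounds has
    -- nonnegative coefficients only.
    identity : ∀ s → 100 ℕ.* (1 ℕ.+ s) ℕ.* (1 ℕ.+ s) ℕ.+ (11 ℕ.* (s ℕ.* s ℕ.* s ℕ.* s) ℕ.+ 99 ℕ.* (s ℕ.* s ℕ.* s) ℕ.+ 230 ℕ.* (s ℕ.* s) ℕ.+ 284 ℕ.* s ℕ.+ 164)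
      ≡ 11 ℕ.* ((1 ℕ.+ s ℕ.+ 1) ℕ.* ((1 ℕ.+ s ℕ.+ 1) ℕ.* ((1 ℕ.+ s ℕ.+ 1) ℕ.* 1))) ℕ.* (1 ℕ.+ s ℕ.+ 2)
    identity = ℕSolver.solve-∀

  module Characterization (s t : ℕ) (1≤s : 1 ℕ.≤ s) (1≤t : 1 ℕ.≤ t) {n} (Γ : Graph n)
    (coedge : CoEdgeRegular Γ) (spectrum : HasSpectrum Γ (theSpectrum s t))
    (t-large : 11 ℕ.* ((s ℕ.+ 1) ℕ.^ 3) ℕ.* (s ℕ.+ 2) ℕ.≤ t) where

    open FromSpectrum s t 1≤s 1≤t Γ coedge spectrum using (countingData; n≢0)

    1≤S : + 1 ≤ + s
    1≤S = ℤ.+≤+ 1≤s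

    100S²≤T : + 100 * + s * + s ≤ + t
    100S²≤T = large-enough s t 1≤s t-large

    isomorphism : CliqueExtGridIso Γ s (t ℕ.+ 1)
    isomorphism = Isomorphism.isomorphism s t 1≤S (Neighbourhood.1≤ST (+ s) (+ t) 1≤S 100S²≤T countingData)
      Γ countingData (λ _ _ → refl) (TwoLines.linePair (+ s) (+ t) 1≤S 100S²≤T countingData) (vertex n≢0)

open import Data.Nat using (ℕ; _≤_; _*_; _+_; _^_)
open import Data.Nat.Properties using (≤-trans; n≤1+n)

theorem1p1 : (s t : ℕ) → 2 ≤ s → 1 ≤ t → {n : ℕ} → (Γ : Graph n) →
    CoEdgeRegular Γ → HasSpectrum Γ (theSpectrum s t) →
    11 * ((s + 1) ^ 3) * (s + 2) ≤ t →
    CliqueExtGridIso Γ s (t + 1)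
theorem1p1 s t 2≤s 1≤t = Proof.Characterization.isomorphism s t (≤-trans (n≤1+n 1) 2≤s) 1≤t
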